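{- Let $k\ge m\ge1$ be integers and let $g$ be a bounded estimable parameter of $k$-colored digraphs. Define the graph parameter $g'(G)=\max\{g(L): L \text{ a } k\text{ -colored digraph with } L'=G\}$. Then $g'$ is estimable.
   Context: A $k$-colored digraph is a finite complete directed graph whose edges (ordered pairs of distinct nodes) are colored with $1,\dots,k$. Its shadow $L'$ is the simple graph on $V(L)$ obtained by keeping only edges with colors $1,\dots,m$ and forgetting colors and orientations. A bounded graph parameter $f$ (a bounded real function on finite simple graphs invariant under isomorphism) is estimable if for every $\varepsilon,\delta>0$ there is a positive integer $r$ such that for every graph $G$ with at least $r$ nodes, if $X\subseteq V(G)$ is a uniformly random $r$-subset, then $\Pr(|f(G)-f(G[X])|>\varepsilon)<\delta$, where $G[X]$ is the induced subgraph. Estimable parameters of $k$-colored digraphs are defined in the same way, with $L[X]$ the induced $k$-colored digraph.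
   Formalization: The formal theorem assumes m < k instead of m ≤ k: when m = k every shadow is a complete graph, so the maximum defining g'(G) is over an empty set for every non-complete G and g' is undefined. -}

module Defs where

open import Level using (0ℓ)
open import Data.Nat as ℕ using (ℕ; zero; suc)
open import Data.Nat.Combinatorics using (_C_)
open import Data.Bool using (Bool; true; false; _∧_; _∨_; not; if_then_else_; T?)
open import Data.Fin using (Fin; toℕ)
import Data.Fin
open import Data.Fin.Permutation using (Permutation′; _⟨$⟩ʳ_)
open import Data.Vec using (Vec; []; _∷_)
open import Data.List using (List; []; _∷_; map; _++_; length; filter)
open import Data.Product using (Σ; ∃; _×_; _,_)
open import Relation.Nullary using (¬_; Dec; yes; no)
open import Relation.Nullary.Decidable using (⌊_⌋)
open import Relation.Binary.PropositionalEquality using (_≡_; _≢_)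
open import Algebra.Structures using (IsCommutativeRing)
open import Relation.Binary.Structures using (IsDecTotalOrder)

-- The real numbers, axiomatised as a (Dedekind-)complete ordered field.
-- Any model is isomorphic to ℝ; the theorem quantifies over all models.

record RealField : Set₁ where
  infixl 6 _+_
  infixl 7 _*_
  infix 4 _≤_
  field
    Carrier : Set
    _+_ _*_ : Carrier → Carrier → Carrier
    -_      : Carrier → Carrier
    _⁻¹     : Carrier → Carrier
    0# 1#   : Carrier
    _≤_     : Carrier → Carrier → Set
    isCommutativeRing : IsCommutativeRing _≡_ _+_ _*_ -_ 0# 1#
    0≢1     : 0# ≢ 1#
    ⁻¹-inverse : ∀ x → x ≢ 0# → x * (x ⁻¹) ≡ 1#
    isDecTotalOrder : IsDecTotalOrder _≡_ _≤_
    +-mono-≤ : ∀ x y z → x ≤ y → x + z ≤ y + z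
    *-nonneg : ∀ x y → 0# ≤ x → 0# ≤ y → 0# ≤ x * y
    complete : (P : Carrier → Set) → (∃ λ x → P x) →
               (∃ λ b → ∀ x → P x → x ≤ b) →
               ∃ λ s → (∀ x → P x → x ≤ s) ×
                       (∀ b → (∀ x → P x → x ≤ b) → s ≤ b)

  _≤?_ : ∀ x y → Dec (x ≤ y)
  _≤?_ = IsDecTotalOrder._≤?_ isDecTotalOrder

  _<_ : Carrier → Carrier → Set
  x < y = (x ≤ y) × (x ≢ y)

  _-_ : Carrier → Carrier → Carrier
  x - y = x + (- y)

  ∣_∣ : Carrier → Carrier
  ∣ x ∣ = if ⌊ x ≤? 0# ⌋ then - x else x

  fromℕ : ℕ → Carrier
  fromℕ zero    = 0#
  fromℕ (suc n) = 1# + fromℕ n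

record Graph (n : ℕ) : Set where
  field
    adj    : Fin n → Fin n → Bool
    sym    : ∀ i j → adj i j ≡ adj j i
    irrefl : ∀ i → adj i i ≡ false
open Graph public

-- k-coloured complete digraphs on Fin n: every ordered pair (i , j)
-- with i ≢ j gets a colour in Fin k (Fin k's element c is colour toℕ c + 1);
-- the value on the diagonal is irrelevant.
ColDigraph : ℕ → ℕ → Set
ColDigraph k n = Fin n → Fin n → Fin k

Subset : ℕ → Set
Subset n = Vec Bool n

size : ∀ {n} → Subset n → ℕ
size []          = 0
size (true ∷ X)  = suc (size X)
size (false ∷ X) = size X

emb : ∀ {n} (X : Subset n) → Fin (size X) → Fin n
emb (true ∷ X)  Fin.zero    = Fin.zero
emb (true ∷ X)  (Fin.suc i) = Fin.suc (emb X i)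
emb (false ∷ X) i           = Fin.suc (emb X i)

allSubsets : ∀ n → List (Subset n)
allSubsets zero    = [] ∷ []
allSubsets (suc n) = map (true ∷_) (allSubsets n) ++ map (false ∷_) (allSubsets n)

inducedGraph : ∀ {n} (X : Subset n) → Graph n → Graph (size X)
inducedGraph X G = record
  { adj    = λ i j → adj G (emb X i) (emb X j)
  ; sym    = λ i j → sym G (emb X i) (emb X j)
  ; irrefl = λ i → irrefl G (emb X i) }

inducedDigraph : ∀ {k n} (X : Subset n) → ColDigraph k n → ColDigraph k (size X)
inducedDigraph X L i j = L (emb X i) (emb X j)

-- Shadow: keep edges coloured 1..m, forget colours and orientations

isLow : ∀ {k} → ℕ → Fin k → Bool
isLow m c = ⌊ toℕ c ℕ.<? m ⌋

shadowAdj : ∀ {k n} → ℕ → ColDigraph k n → Fin n → Fin n → Bool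
shadowAdj m L i j = not ⌊ i Data.Fin.≟ j ⌋ ∧ (isLow m (L i j) ∨ isLow m (L j i))

HasShadow : ∀ {k n} → ℕ → ColDigraph k n → Graph n → Set
HasShadow m L G = ∀ i j → shadowAdj m L i j ≡ adj G i j

module _ (ℝ : RealField) where
  open RealField ℝ

  GraphParam : Set
  GraphParam = ∀ {n} → Graph n → Carrier

  DigraphParam : ℕ → Set
  DigraphParam k = ∀ {n} → ColDigraph k n → Carrier

  IsInvariantDigraphParam : ∀ {k} → DigraphParam k → Set
  IsInvariantDigraphParam g = ∀ {n} (π : Permutation′ n) (L₁ L₂ : ColDigraph _ n) →
    (∀ i j → i ≢ j → L₂ i j ≡ L₁ (π ⟨$⟩ʳ i) (π ⟨$⟩ʳ j)) → g L₂ ≡ g L₁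

  BoundedDigraphParam : ∀ {k} → DigraphParam k → Set
  BoundedDigraphParam g = ∃ λ M → ∀ {n} (L : ColDigraph _ n) → ∣ g L ∣ ≤ M

  -- Generic estimability for a family of structures S n on Fin n with
  -- induced substructures.  Pr over a uniformly random r-subset X of Fin n
  -- = (#{X : |X| = r, |f A - f A[X]| > ε}) / (n C r).
  module _ (S : ℕ → Set) (restrict : ∀ {n} (X : Subset n) → S n → S (size X))
           (f : ∀ {n} → S n → Carrier) where

    farOff : ∀ {n} → Carrier → S n → Subset n → Bool
    farOff ε A X = not ⌊ ∣ f A - f (restrict X A) ∣ ≤? ε ⌋

    badCount : ∀ {n} → ℕ → Carrier → S n → ℕ
    badCount {n} r ε A =
      length (filter (λ X → T? (⌊ size X ℕ.≟ r ⌋ ∧ farOff ε A X)) (allSubsets n))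

    prBad : ∀ {n} → ℕ → Carrier → S n → Carrier
    prBad {n} r ε A = fromℕ (badCount r ε A) * (fromℕ (n C r) ⁻¹)

    IsEstimable : Set
    IsEstimable = ∀ ε δ → 0# < ε → 0# < δ →
      ∃ λ r → 1 ℕ.≤ r × (∀ {n} (A : S n) → r ℕ.≤ n → prBad r ε A < δ)

  EstimableGraphParam : GraphParam → Set
  EstimableGraphParam f = IsEstimable Graph inducedGraph f

  EstimableDigraphParam : ∀ {k} → DigraphParam k → Set
  EstimableDigraphParam {k} g = IsEstimable (ColDigraph k) inducedDigraph g

  IsShadowMax : ∀ {k} → ℕ → DigraphParam k → ∀ {n} → Graph n → Carrier → Set
  IsShadowMax {k} m g {n} G v =
    (∃ λ (L : ColDigraph k n) → HasShadow m L G × g L ≡ v) ×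
    (∀ (L : ColDigraph k n) → HasShadow m L G → g L ≤ v)

{-# OPTIONS --safe #-}
module Submission where

-- By direction of the maximum, g′ can hardly drop on a random induced subgraph: restrict an optimal colouring.
-- Conversely, an optimal colouring J of a random sample G[X] has to be lifted to G. As a mixture of colourings suffices,
-- it is enough to reproduce the average of g over random r-tuples of vertices. Choose pivots z in X so that
-- further pivots hardly help to predict the colours of a random pair from the colours of its ends towards z (an energy
-- increment argument): drawing the colours of each pair afresh, given its shadow and the labels of its ends, then hardly
-- changes the average. Choose further pivots w so that the adjacencies of a vertex towards w predict its label as well as
-- adjacencies towards any further r vertices: drawing the labels afresh given these adjacencies changes little as well.
-- The result only depends on the frequencies of adjacency patterns, which agree on X and on G by a variance bound, and the
-- same random draws define a colouring of G.
--
-- This yields a sample size only up to double negation, since the axioms of ℝ do not provide a natural number above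
-- a given real. Suprema decide negated statements, so it remains to bound a search; the bound is read off the sample size
-- which estimability provides for a precision so small that it beats all smaller candidates.

open import Defs hiding (sym; irrefl)
open import Algebra.Bundles using (CommutativeRing)
open import Algebra.Solver.Ring.AlmostCommutativeRing using (AlmostCommutativeRing; fromCommutativeRing; _-Raw-AlmostCommutative⟶_)
open import Algebra.Structures using (IsCommutativeRing)
open import Data.Bool as Bool using (Bool; true; false; if_then_else_; _∧_; _∨_; not; T?)
import Data.Bool.Properties as Bool
open import Data.Empty using (⊥; ⊥-elim)
open import Data.Fin as Fin using (Fin; zero; suc)
open import Data.Fin.Permutation using (Permutation′; permutation)
import Data.Fin.Properties as Fin
open import Data.Integer as ℤ using (ℤ)
import Data.Integer.Properties as ℤ
open import Data.List as List using (List; []; _∷_; _++_; length; filter; allFin; tabulate; foldl; cartesianProduct)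
open import Data.List.Membership.Propositional using (_∈_)
open import Data.List.Membership.Propositional.Properties using (∈-++⁺ˡ; ∈-++⁺ʳ; ∈-map⁺; ∈-allFin; ∈-cartesianProduct⁺; ∈-filter⁺)
import Data.List.Properties as List
open import Data.List.Relation.Unary.All as All using (All; []; _∷_)
open import Data.List.Relation.Unary.All.Properties using (all-filter)
open import Data.List.Relation.Unary.AllPairs using (AllPairs; []; _∷_)
open import Data.List.Relation.Unary.Any using (here; there)
import Data.List.Relation.Unary.Unique.Propositional as List
import Data.List.Relation.Unary.Unique.Propositional.Properties as Unique
open import Data.Maybe as Maybe using (Maybe; just; nothing)
open import Data.Nat as ℕ using (ℕ; zero; suc; _^_; _∸_)
open import Data.Nat.Combinatorics using (nCn≡1; nC1≡n; nCk≡nC[n∸k]; k>n⇒nCk≡0; nCk+nC[k+1]≡[n+1]C[k+1]) renaming (_C_ to _choose_)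
import Data.Nat.Properties as ℕ
open import Data.Nat.Tactic.RingSolver using (solve-∀)
open import Data.Product using (∃; _×_; _,_; proj₁; proj₂; swap; uncurry)
import Data.Product.Properties as Product
open import Data.Sum using (_⊎_; inj₁; inj₂)
open import Data.Vec as Vec using (Vec; []; _∷_; lookup; _[_]≔_; take; drop)
import Data.Vec.Properties as Vec
import Data.Vec.Relation.Unary.All as VecAll
import Data.Vec.Relation.Unary.All.Properties as VecAll
open import Data.Vec.Relation.Unary.All using ([]; _∷_)
open import Data.Vec.Relation.Unary.AllPairs using (allPairs?; []; _∷_)
open import Data.Vec.Relation.Unary.Unique.Propositional using (Unique)
import Data.Vec.Relation.Unary.Unique.Propositional.Properties as VecUnique
open import Function using (_∘_; id)
open import Relation.Binary.Definitions using (DecidableEquality; tri<; tri≈; tri>)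
open import Relation.Binary.PropositionalEquality
open import Relation.Binary.Structures using (IsDecTotalOrder)
open import Relation.Nullary using (¬_; Dec; yes; no; does; ¬?)
open import Relation.Nullary.Decidable using (⌊_⌋; decidable-stable)

-- A mixture suffices because the mean of `g` over random r-tuples is linear in the law of a random
-- colouring: some outcome does at least as well as the mean, and a maximum only asks for a lower
-- bound. Two rounds of redrawing are forced, since labels towards z are colours of J and have no
-- meaning outside X; only adjacencies make sense in both graphs. Redraws are justified one vertex
-- or pair at a time: the rest of an r-tuple sees the redrawn item only through its relations to the
-- other entries, and these become part of its code once the entries are adjoined to the pivots. So
-- the error is governed by the energy gained from r further pivots. Tuples are drawn with
-- replacement to make coordinates independent; repeated vertices cost about r²/s. The number of
-- pivots used depends on J, so a sample counts as good only if pattern frequencies agree for all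
-- admissible numbers at once. In the final search a sample size that serves every precision would
-- escape the bound; but then `g` does not change under restriction to that size, which solves the
-- problem outright.

module OrderedField (ℝ : RealField) where
  open RealField ℝ public
    renaming (_-_ to infixl 6 _-_; _<_ to infix 4 _<_; Carrier to R)
  open IsCommutativeRing isCommutativeRing public
    using (+-assoc; +-comm; *-assoc; *-comm; +-identityˡ; +-identityʳ;
           *-identityˡ; *-identityʳ; distribˡ; distribʳ; zeroˡ; zeroʳ; -‿inverseʳ)
  open IsDecTotalOrder isDecTotalOrder public
    using (_≟_) renaming (refl to ≤-refl; trans to ≤-trans; antisym to ≤-antisym; total to ≤-total;
                          reflexive to ≤-reflexive)

  commutativeRing : CommutativeRing _ _
  commutativeRing = record { isCommutativeRing = isCommutativeRing }

  almostRing : AlmostCommutativeRing _ _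
  almostRing = fromCommutativeRing commutativeRing

  open import Algebra.Properties.Ring (CommutativeRing.ring commutativeRing) public
    using (-‿distribˡ-*; -‿distribʳ-*; -‿involutive; -0#≈0#; -‿+-comm)

  -- The homomorphism from the integers used by the ring solver

  fromℕ-+ : ∀ m n → fromℕ (m ℕ.+ n) ≡ fromℕ m + fromℕ n
  fromℕ-+ zero n = sym (+-identityˡ _)
  fromℕ-+ (suc m) n = trans (cong (1# +_) (fromℕ-+ m n)) (sym (+-assoc _ _ _))

  fromℕ-* : ∀ m n → fromℕ (m ℕ.* n) ≡ fromℕ m * fromℕ n
  fromℕ-* zero n = sym (zeroˡ _)
  fromℕ-* (suc m) n = trans (fromℕ-+ n (m ℕ.* n)) (trans
    (cong₂ _+_ (sym (*-identityˡ _)) (fromℕ-* m n)) (sym (distribʳ _ _ _)))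

  fromℤ : ℤ → R
  fromℤ (ℤ.+ n) = fromℕ n
  fromℤ (ℤ.-[1+ n ]) = - fromℕ (suc n)

  cancelˡ : ∀ a b c → (a + b) + (- (a + c)) ≡ b + (- c)
  cancelˡ a b c = begin
    (a + b) + (- (a + c))      ≡⟨ cong ((a + b) +_) (sym (-‿+-comm a c)) ⟩
    (a + b) + ((- a) + (- c))  ≡⟨ cong (_+ ((- a) + (- c))) (+-comm a b) ⟩
    (b + a) + ((- a) + (- c))  ≡⟨ +-assoc b a _ ⟩
    b + (a + ((- a) + (- c)))  ≡⟨ cong (b +_) (sym (+-assoc a (- a) (- c))) ⟩
    b + ((a + (- a)) + (- c))  ≡⟨ cong (λ x → b + (x + (- c))) (-‿inverseʳ a) ⟩
    b + (0# + (- c))           ≡⟨ cong (b +_) (+-identityˡ _) ⟩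
    b + (- c) ∎
    where open ≡-Reasoning

  fromℤ-⊖ : ∀ m n → fromℤ (m ℤ.⊖ n) ≡ fromℕ m + (- fromℕ n)
  fromℤ-⊖ m zero = sym (trans (cong (fromℕ m +_) -0#≈0#) (+-identityʳ _))
  fromℤ-⊖ zero (suc n) = sym (+-identityˡ _)
  fromℤ-⊖ (suc m) (suc n) = trans (cong fromℤ (ℤ.[1+m]⊖[1+n]≡m⊖n m n))
    (trans (fromℤ-⊖ m n) (sym (cancelˡ 1# _ _)))

  fromℤ-neg : ∀ i → fromℤ (ℤ.- i) ≡ - fromℤ i
  fromℤ-neg (ℤ.+ zero) = sym -0#≈0#
  fromℤ-neg (ℤ.+ suc n) = refl
  fromℤ-neg (ℤ.-[1+ n ]) = sym (-‿involutive _)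

  fromℤ-+ : ∀ i j → fromℤ (i ℤ.+ j) ≡ fromℤ i + fromℤ j
  fromℤ-+ (ℤ.+ m) (ℤ.+ n) = fromℕ-+ m n
  fromℤ-+ (ℤ.+ m) (ℤ.-[1+ n ]) = fromℤ-⊖ m (suc n)
  fromℤ-+ (ℤ.-[1+ m ]) (ℤ.+ n) = trans (fromℤ-⊖ n (suc m)) (+-comm _ _)
  fromℤ-+ (ℤ.-[1+ m ]) (ℤ.-[1+ n ]) = trans (cong (λ k → - fromℕ (suc k)) (sym (ℕ.+-suc m n)))
    (trans (cong -_ (fromℕ-+ (suc m) (suc n))) (sym (-‿+-comm _ _)))

  fromℤ-*-pos : ∀ m j → fromℤ (ℤ.+ m ℤ.* j) ≡ fromℕ m * fromℤ j
  fromℤ-*-pos m (ℤ.+ n) = trans (cong fromℤ (sym (ℤ.pos-* m n))) (fromℕ-* m n)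
  fromℤ-*-pos m (ℤ.-[1+ n ]) = begin
    fromℤ (ℤ.+ m ℤ.* ℤ.-[1+ n ])           ≡⟨ cong fromℤ (sym (ℤ.neg-distribʳ-* (ℤ.+ m) (ℤ.+ suc n))) ⟩
    fromℤ (ℤ.- (ℤ.+ m ℤ.* ℤ.+ suc n))      ≡⟨ fromℤ-neg (ℤ.+ m ℤ.* ℤ.+ suc n) ⟩
    - fromℤ (ℤ.+ m ℤ.* ℤ.+ suc n)          ≡⟨ cong -_ (fromℤ-*-pos m (ℤ.+ suc n)) ⟩
    - (fromℕ m * fromℕ (suc n))            ≡⟨ -‿distribʳ-* _ _ ⟩
    fromℕ m * (- fromℕ (suc n)) ∎
    where open ≡-Reasoning

  fromℤ-* : ∀ i j → fromℤ (i ℤ.* j) ≡ fromℤ i * fromℤ j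
  fromℤ-* (ℤ.+ m) j = fromℤ-*-pos m j
  fromℤ-* (ℤ.-[1+ m ]) j = begin
    fromℤ (ℤ.-[1+ m ] ℤ.* j)        ≡⟨ cong fromℤ (sym (ℤ.neg-distribˡ-* (ℤ.+ suc m) j)) ⟩
    fromℤ (ℤ.- (ℤ.+ suc m ℤ.* j))   ≡⟨ fromℤ-neg (ℤ.+ suc m ℤ.* j) ⟩
    - fromℤ (ℤ.+ suc m ℤ.* j)       ≡⟨ cong -_ (fromℤ-*-pos (suc m) j) ⟩
    - (fromℕ (suc m) * fromℤ j)     ≡⟨ -‿distribˡ-* _ _ ⟩
    (- fromℕ (suc m)) * fromℤ j ∎
    where open ≡-Reasoning

  -- The interpretation of coefficients used by the ring solver sends 1 to 1# itself, not to 1# + 0#.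
  numeral : ℕ → R
  numeral zero          = 0#
  numeral (suc zero)    = 1#
  numeral (suc (suc n)) = 1# + numeral (suc n)

  numeral≡ : ∀ n → numeral n ≡ fromℕ n
  numeral≡ zero          = refl
  numeral≡ (suc zero)    = sym (+-identityʳ 1#)
  numeral≡ (suc (suc n)) = cong (1# +_) (numeral≡ (suc n))

  coeff : ℤ → R
  coeff (ℤ.+ n)      = numeral n
  coeff (ℤ.-[1+ n ]) = - numeral (suc n)

  coeff≡ : ∀ i → coeff i ≡ fromℤ i
  coeff≡ (ℤ.+ n)      = numeral≡ n
  coeff≡ (ℤ.-[1+ n ]) = cong -_ (numeral≡ (suc n))

  morphism : ℤ.+-*-rawRing -Raw-AlmostCommutative⟶ almostRing
  morphism = record
    { ⟦_⟧ = coeff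
    ; +-homo = λ i j → trans (coeff≡ (i ℤ.+ j)) (trans (fromℤ-+ i j) (sym (cong₂ _+_ (coeff≡ i) (coeff≡ j))))
    ; *-homo = λ i j → trans (coeff≡ (i ℤ.* j)) (trans (fromℤ-* i j) (sym (cong₂ _*_ (coeff≡ i) (coeff≡ j))))
    ; -‿homo = λ i → trans (coeff≡ (ℤ.- i)) (trans (fromℤ-neg i) (sym (cong -_ (coeff≡ i))))
    ; 0-homo = refl ; 1-homo = refl }

  coeff≟ : ∀ i j → Maybe (coeff i ≡ coeff j)
  coeff≟ i j with i ℤ.≟ j
  ... | yes e = just (cong coeff e)
  ... | no _  = nothing

  open import Algebra.Solver.Ring ℤ.+-*-rawRing almostRing morphism coeff≟ public
    using (solve; _:=_; _:+_; _:*_; _:-_; :-_; con; Polynomial)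

  :0 :1 : ∀ {n} → Polynomial n
  :0 = con (ℤ.+ 0)
  :1 = con (ℤ.+ 1)

  -- Order

  +-mono : ∀ {a b c d} → a ≤ b → c ≤ d → a + c ≤ b + d
  +-mono {a} {b} {c} {d} p q = ≤-trans (+-mono-≤ a b c p)
    (subst₂ _≤_ (+-comm c b) (+-comm d b) (+-mono-≤ c d b q))

  ≤⇒0≤ : ∀ {a b} → a ≤ b → 0# ≤ b - a
  ≤⇒0≤ {a} {b} p = subst (_≤ b - a) (-‿inverseʳ a) (+-mono-≤ a b (- a) p)

  ≤-by : ∀ {a b d} → 0# ≤ d → b ≡ a + d → a ≤ b
  ≤-by {a} {b} {d} p e = subst₂ _≤_ (+-identityʳ a) (sym e) (+-mono ≤-refl p)

  +-nonneg : ∀ {a b} → 0# ≤ a → 0# ≤ b → 0# ≤ a + b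
  +-nonneg p q = subst (_≤ _) (+-identityˡ 0#) (+-mono p q)

  *-nonneg′ : ∀ {a b} → 0# ≤ a → 0# ≤ b → 0# ≤ a * b
  *-nonneg′ p q = *-nonneg _ _ p q

  neg-mono : ∀ {a b} → a ≤ b → - b ≤ - a
  neg-mono {a} {b} p = ≤-by (≤⇒0≤ p) (solve 2 (λ a b → :- a := (:- b) :+ (b :- a)) refl a b)

  *-monoˡ : ∀ {a b c} → 0# ≤ c → a ≤ b → c * a ≤ c * b
  *-monoˡ {a} {b} {c} p q = ≤-by (*-nonneg′ p (≤⇒0≤ q))
    (solve 3 (λ a b c → c :* b := c :* a :+ c :* (b :- a)) refl a b c)

  *-monoʳ : ∀ {a b c} → 0# ≤ c → a ≤ b → a * c ≤ b * c
  *-monoʳ {a} {b} {c} p q = subst₂ _≤_ (*-comm c a) (*-comm c b) (*-monoˡ p q)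

  sq-nonneg : ∀ a → 0# ≤ a * a
  sq-nonneg a with ≤-total 0# a
  ... | inj₁ p = *-nonneg′ p p
  ... | inj₂ p = subst (0# ≤_) (solve 1 (λ a → (:- a) :* (:- a) := a :* a) refl a)
                   (*-nonneg′ q q)
    where q = subst (_≤ - a) -0#≈0# (neg-mono p)

  0≤1 : 0# ≤ 1#
  0≤1 = subst (0# ≤_) (*-identityˡ 1#) (sq-nonneg 1#)

  0<1 : 0# < 1#
  0<1 = 0≤1 , 0≢1

  ≰⇒< : ∀ {a b} → ¬ (a ≤ b) → b < a
  ≰⇒< {a} {b} n with ≤-total a b
  ... | inj₁ p = ⊥-elim (n p)
  ... | inj₂ p = p , λ e → n (≤-reflexive (sym e))

  <⇒≱ : ∀ {a b} → a < b → ¬ (b ≤ a)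
  <⇒≱ (p , n) q = n (≤-antisym p q)

  ≮⇒≥ : ∀ {a b} → ¬ (a < b) → b ≤ a
  ≮⇒≥ {a} {b} n with b ≤? a
  ... | yes p = p
  ... | no  p = ⊥-elim (n (≰⇒< p))

  <-≤-trans : ∀ {a b c} → a < b → b ≤ c → a < c
  <-≤-trans p q = ≤-trans (proj₁ p) q , λ { refl → <⇒≱ p q }

  ≤-<-trans : ∀ {a b c} → a ≤ b → b < c → a < c
  ≤-<-trans p q = ≤-trans p (proj₁ q) , λ { refl → <⇒≱ q p }

  <-stable : ∀ {a b} → ¬ ¬ (a < b) → a < b
  <-stable {a} {b} nn = ≰⇒< λ q → nn λ p → <⇒≱ p q

  +-mono-<-≤ : ∀ {a b c d} → a < b → c ≤ d → a + c < b + d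
  +-mono-<-≤ {a} {b} {c} {d} p q = +-mono (proj₁ p) q , λ e →
    <⇒≱ p (≤-by (≤⇒0≤ q) (trans (solve 3 (λ a c d → a := (a :+ c) :+ (:- c)) refl a c d)
      (trans (cong (_+ (- c)) e) (solve 3 (λ b c d → (b :+ d) :+ (:- c) := b :+ (d :- c)) refl b c d))))

  +-pos : ∀ {a b} → 0# < a → 0# ≤ b → 0# < a + b
  +-pos {a} {b} p q = subst (_< a + b) (+-identityˡ 0#) (+-mono-<-≤ p q)

  *-cancel-0 : ∀ {a b} → a ≢ 0# → a * b ≡ 0# → b ≡ 0#
  *-cancel-0 {a} {b} n e = begin
    b                 ≡⟨ sym (*-identityˡ b) ⟩
    1# * b            ≡⟨ cong (_* b) (sym (⁻¹-inverse a n)) ⟩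
    a * a ⁻¹ * b      ≡⟨ solve 3 (λ a i b → a :* i :* b := a :* b :* i) refl a (a ⁻¹) b ⟩
    a * b * a ⁻¹      ≡⟨ cong (_* a ⁻¹) e ⟩
    0# * a ⁻¹         ≡⟨ zeroˡ _ ⟩
    0# ∎ where open ≡-Reasoning

  *-pos : ∀ {a b} → 0# < a → 0# < b → 0# < a * b
  *-pos p q = *-nonneg′ (proj₁ p) (proj₁ q) ,
    λ e → proj₂ q (sym (*-cancel-0 (λ z → proj₂ p (sym z)) (sym e)))

  pos⇒≢0 : ∀ {a} → 0# < a → a ≢ 0#
  pos⇒≢0 p e = proj₂ p (sym e)

  ⁻¹-pos : ∀ {a} → 0# < a → 0# < a ⁻¹
  ⁻¹-pos {a} p = ≰⇒< λ q → <⇒≱ 0<1 (subst₂ _≤_ (⁻¹-inverse a (pos⇒≢0 p)) (zeroʳ a) (*-monoˡ (proj₁ p) q))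

  *⁻¹-cancelʳ : ∀ {a} b → 0# < a → b * a * a ⁻¹ ≡ b
  *⁻¹-cancelʳ {a} b p = trans (*-assoc b a _) (trans (cong (b *_) (⁻¹-inverse a (pos⇒≢0 p))) (*-identityʳ b))

  *⁻¹-cancelʳ′ : ∀ {a} b → 0# < a → b * a ⁻¹ * a ≡ b
  *⁻¹-cancelʳ′ {a} b p = trans (solve 3 (λ a i b → b :* i :* a := b :* a :* i) refl a (a ⁻¹) b) (*⁻¹-cancelʳ b p)

  ⁻¹-* : ∀ {a b} → 0# < a → 0# < b → (a * b) ⁻¹ ≡ a ⁻¹ * b ⁻¹
  ⁻¹-* {a} {b} p q = begin
    (a * b) ⁻¹                               ≡⟨ sym (*-identityˡ _) ⟩
    1# * (a * b) ⁻¹                          ≡⟨ cong (_* (a * b) ⁻¹) (sym (trans (cong₂ _*_ (⁻¹-inverse a (pos⇒≢0 p)) (⁻¹-inverse b (pos⇒≢0 q))) (*-identityˡ 1#))) ⟩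
    a * a ⁻¹ * (b * b ⁻¹) * (a * b) ⁻¹       ≡⟨ solve 5 (λ a i b j x → a :* i :* (b :* j) :* x := i :* j :* (a :* b) :* x) refl a (a ⁻¹) b (b ⁻¹) ((a * b) ⁻¹) ⟩
    a ⁻¹ * b ⁻¹ * (a * b) * (a * b) ⁻¹       ≡⟨ *⁻¹-cancelʳ _ (*-pos p q) ⟩
    a ⁻¹ * b ⁻¹ ∎ where open ≡-Reasoning

  ≤-div : ∀ {a b c} → 0# < c → a * c ≤ b → a ≤ b * c ⁻¹
  ≤-div {a} {b} {c} p q = subst (_≤ b * c ⁻¹) (*⁻¹-cancelʳ a p) (*-monoʳ (proj₁ (⁻¹-pos p)) q)

  div-≤ : ∀ {a b c} → 0# < c → a ≤ b * c → a * c ⁻¹ ≤ b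
  div-≤ {a} {b} {c} p q = subst (a * c ⁻¹ ≤_) (*⁻¹-cancelʳ b p) (*-monoʳ (proj₁ (⁻¹-pos p)) q)

  *-cancelʳ-≤ : ∀ {a b c} → 0# < c → a * c ≤ b * c → a ≤ b
  *-cancelʳ-≤ {a} {b} {c} p q = subst (a ≤_) (*⁻¹-cancelʳ b p) (≤-div p q)

  *-monoʳ-< : ∀ {a b c} → 0# < c → a < b → a * c < b * c
  *-monoʳ-< {a} {b} {c} p q = ≰⇒< λ z → <⇒≱ q (*-cancelʳ-≤ p z)

  fromℕ-nonneg : ∀ n → 0# ≤ fromℕ n
  fromℕ-nonneg zero = ≤-refl
  fromℕ-nonneg (suc n) = +-nonneg 0≤1 (fromℕ-nonneg n)

  fromℕ-pos : ∀ {n} → 1 ℕ.≤ n → 0# < fromℕ n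
  fromℕ-pos {suc n} _ = +-pos 0<1 (fromℕ-nonneg n)

  fromℕ-mono : ∀ {m n} → m ℕ.≤ n → fromℕ m ≤ fromℕ n
  fromℕ-mono {n = n} ℕ.z≤n = fromℕ-nonneg n
  fromℕ-mono (ℕ.s≤s p) = +-mono ≤-refl (fromℕ-mono p)

  -- Absolute value

  x≤∣x∣ : ∀ x → x ≤ ∣ x ∣
  x≤∣x∣ x with x ≤? 0#
  ... | yes p = ≤-trans p (subst (_≤ - x) -0#≈0# (neg-mono p))
  ... | no  p = ≤-refl

  -x≤∣x∣ : ∀ x → - x ≤ ∣ x ∣
  -x≤∣x∣ x with x ≤? 0#
  ... | yes p = ≤-refl
  ... | no  p = ≤-trans (subst (- x ≤_) -0#≈0# (neg-mono (proj₁ (≰⇒< p)))) (proj₁ (≰⇒< p))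

  ∣x∣≤ : ∀ {x a} → x ≤ a → - x ≤ a → ∣ x ∣ ≤ a
  ∣x∣≤ {x} p q with x ≤? 0#
  ... | yes _ = q
  ... | no  _ = p

  ∣x∣-nonneg : ∀ x → 0# ≤ ∣ x ∣
  ∣x∣-nonneg x with ≤-total 0# x
  ... | inj₁ p = ≤-trans p (x≤∣x∣ x)
  ... | inj₂ p = ≤-trans (subst (_≤ - x) -0#≈0# (neg-mono p)) (-x≤∣x∣ x)

  ∣x-y∣-sym : ∀ x y → ∣ x - y ∣ ≤ ∣ y - x ∣
  ∣x-y∣-sym x y = ∣x∣≤
    (≤-trans (≤-reflexive (solve 2 (λ x y → x :- y := :- (y :- x)) refl x y)) (-x≤∣x∣ _))
    (≤-trans (≤-reflexive (solve 2 (λ x y → :- (x :- y) := y :- x) refl x y)) (x≤∣x∣ _))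

  diff≤ : ∀ {x y a} → ∣ x - y ∣ ≤ a → x ≤ y + a
  diff≤ {x} {y} {a} p = ≤-by (≤⇒0≤ (≤-trans (x≤∣x∣ _) p))
    (solve 3 (λ x y a → y :+ a := x :+ (a :- (x :- y))) refl x y a)

  diff≤′ : ∀ {x y a} → ∣ x - y ∣ ≤ a → y ≤ x + a
  diff≤′ {x} {y} p = diff≤ (≤-trans (∣x-y∣-sym y x) p)

  ∣-∣≤ : ∀ {x y a} → x ≤ y + a → y ≤ x + a → ∣ x - y ∣ ≤ a
  ∣-∣≤ {x} {y} {a} p q = ∣x∣≤
    (≤-by (≤⇒0≤ p) (solve 3 (λ x y a → a := (x :- y) :+ ((y :+ a) :- x)) refl x y a))
    (≤-by (≤⇒0≤ q) (solve 3 (λ x y a → a := (:- (x :- y)) :+ ((x :+ a) :- y)) refl x y a))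

  ∣-∣-trans : ∀ {x y z a b} → ∣ x - y ∣ ≤ a → ∣ y - z ∣ ≤ b → ∣ x - z ∣ ≤ a + b
  ∣-∣-trans {x} {y} {z} {a} {b} p q = ∣-∣≤
    (≤-trans (diff≤ p) (≤-trans (+-mono (diff≤ q) ≤-refl)
       (≤-reflexive (solve 3 (λ z a b → z :+ b :+ a := z :+ (a :+ b)) refl z a b))))
    (≤-trans (diff≤′ q) (≤-trans (+-mono (diff≤′ p) ≤-refl) (≤-reflexive (+-assoc _ _ _))))

  ≡⇒∣-∣≤0 : ∀ {x y} → x ≡ y → ∣ x - y ∣ ≤ 0#
  ≡⇒∣-∣≤0 {x} refl = ∣-∣≤ (≤-reflexive (sym (+-identityʳ x))) (≤-reflexive (sym (+-identityʳ x)))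

  -- After multiplication by `l` the case 0 ≤ x reads x l ≤ l² + x², and the difference of the sides
  -- is (x - l)² + x l. This stands in for the Cauchy-Schwarz inequality: first moments are bounded
  -- by second moments without square roots, and `l` is tuned at the end.
  amgm : ∀ x {l} → 0# < l → ∣ x ∣ ≤ l + x * x * l ⁻¹
  amgm x {l} p = ∣x∣≤ (go x) (subst (λ t → - x ≤ l + t * l ⁻¹)
      (solve 1 (λ x → (:- x) :* (:- x) := x :* x) refl x) (go (- x)))
    where
    go : ∀ x → x ≤ l + x * x * l ⁻¹
    go x with ≤-total 0# x
    ... | inj₁ q = *-cancelʳ-≤ p (≤-by
       (+-nonneg (sq-nonneg (x - l)) (*-nonneg′ q (proj₁ p)))
       (trans (distribʳ l l _) (trans (cong (l * l +_) (*⁻¹-cancelʳ′ (x * x) p))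
         (solve 2 (λ x l → l :* l :+ x :* x := x :* l :+ ((x :- l) :* (x :- l) :+ x :* l)) refl x l))))
    ... | inj₂ q = ≤-trans q (+-nonneg (proj₁ p) (*-nonneg′ (sq-nonneg x) (proj₁ (⁻¹-pos p))))

-- Expectations, conditioning and energy

module Distributions (ℝ : RealField) where
  open OrderedField ℝ public

  𝟙 : ∀ {P : Set} → Dec P → R
  𝟙 d = if does d then 1# else 0#

  𝟙-yes : ∀ {P : Set} (d : Dec P) → P → 𝟙 d ≡ 1#
  𝟙-yes (yes _) p = refl
  𝟙-yes (no n)  p = ⊥-elim (n p)

  𝟙-no : ∀ {P : Set} (d : Dec P) → ¬ P → 𝟙 d ≡ 0#
  𝟙-no (yes p) n = ⊥-elim (n p)
  𝟙-no (no _)  n = refl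

  𝟙-cong : ∀ {P Q : Set} (d : Dec P) (e : Dec Q) → (P → Q) → (Q → P) → 𝟙 d ≡ 𝟙 e
  𝟙-cong (yes p) e f g = sym (𝟙-yes e (f p))
  𝟙-cong (no n)  e f g = sym (𝟙-no e (λ q → n (g q)))

  𝟙-nonneg : ∀ {P : Set} (d : Dec P) → 0# ≤ 𝟙 d
  𝟙-nonneg (yes _) = 0≤1
  𝟙-nonneg (no _)  = ≤-refl

  𝟙≤1 : ∀ {P : Set} (d : Dec P) → 𝟙 d ≤ 1#
  𝟙≤1 (yes _) = ≤-refl
  𝟙≤1 (no _)  = 0≤1

  𝟙-subst : ∀ {P : Set} (d : Dec P) {a b} → (P → a ≡ b) → 𝟙 d * a ≡ 𝟙 d * b
  𝟙-subst (yes p) f = cong (1# *_) (f p)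
  𝟙-subst (no _) {a} {b} f = trans (zeroˡ a) (sym (zeroˡ b))

  𝟙-mono : ∀ {P : Set} (d : Dec P) {a b} → (P → a ≤ b) → 𝟙 d * a ≤ 𝟙 d * b
  𝟙-mono (yes p) f = *-monoˡ 0≤1 (f p)
  𝟙-mono (no _) {a} {b} f = ≤-reflexive (trans (zeroˡ a) (sym (zeroˡ b)))

  -- The functionals with which a finite expectation may be exchanged. Extensionality is a field
  -- because pointwise equal integrands need not be equal as functions.
  record Linear {B : Set} (N : (B → R) → R) : Set where
    field
      ext   : ∀ {f g} → (∀ b → f b ≡ g b) → N f ≡ N g
      add   : ∀ f g → N (λ b → f b + g b) ≡ N f + N g
      scale : ∀ c f → N (λ b → c * f b) ≡ c * N f

    scaleʳ : ∀ c f → N (λ b → f b * c) ≡ N f * c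
    scaleʳ c f = trans (ext (λ b → *-comm (f b) c)) (trans (scale c f) (*-comm c _))

    neg : ∀ f → N (λ b → - f b) ≡ - N f
    neg f = trans (ext (λ b → solve 1 (λ x → :- x := (:- :1) :* x) refl (f b)))
      (trans (scale _ f) (solve 1 (λ x → (:- :1) :* x := :- x) refl (N f)))

    sub : ∀ f g → N (λ b → f b - g b) ≡ N f - N g
    sub f g = trans (add f _) (cong (N f +_) (neg g))

    zero-on : N (λ _ → 0#) ≡ 0#
    zero-on = trans (ext (λ _ → sym (zeroˡ 0#))) (trans (scale 0# (λ _ → 0#)) (zeroˡ _))

  -- Finite sums

  ∑ : ∀ {A : Set} → List A → (A → R) → R
  ∑ []       f = 0#
  ∑ (x ∷ xs) f = f x + ∑ xs f

  ∑-linear : ∀ {A : Set} (xs : List A) → Linear (∑ xs)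
  ∑-linear xs = record { ext = ext xs ; add = add xs ; scale = scale xs }
    where
    ext : ∀ xs {f g} → (∀ b → f b ≡ g b) → ∑ xs f ≡ ∑ xs g
    ext [] e = refl
    ext (x ∷ xs) e = cong₂ _+_ (e x) (ext xs e)
    add : ∀ xs f g → ∑ xs (λ b → f b + g b) ≡ ∑ xs f + ∑ xs g
    add [] f g = sym (+-identityˡ 0#)
    add (x ∷ xs) f g = trans (cong (f x + g x +_) (add xs f g))
      (solve 4 (λ a b c d → a :+ b :+ (c :+ d) := a :+ c :+ (b :+ d)) refl (f x) (g x) (∑ xs f) (∑ xs g))
    scale : ∀ xs c f → ∑ xs (λ b → c * f b) ≡ c * ∑ xs f
    scale [] c f = sym (zeroʳ c)
    scale (x ∷ xs) c f = trans (cong (c * f x +_) (scale xs c f)) (sym (distribˡ c _ _))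

  ∑-mono : ∀ {A : Set} (xs : List A) {f g} → (∀ b → f b ≤ g b) → ∑ xs f ≤ ∑ xs g
  ∑-mono [] h = ≤-refl
  ∑-mono (x ∷ xs) h = +-mono (h x) (∑-mono xs h)

  ∑-swap : ∀ {A B : Set} (xs : List A) {N : (B → R) → R} → Linear N → (f : A → B → R) →
           ∑ xs (λ a → N (f a)) ≡ N (λ b → ∑ xs (λ a → f a b))
  ∑-swap [] L f = sym (Linear.zero-on L)
  ∑-swap (x ∷ xs) {N} L f = trans (cong (N (f x) +_) (∑-swap xs L f)) (sym (Linear.add L _ _))

  ∑-const : ∀ {A : Set} (xs : List A) c → ∑ xs (λ _ → c) ≡ fromℕ (length xs) * c
  ∑-const [] c = sym (zeroˡ c)
  ∑-const (x ∷ xs) c = trans (cong (c +_) (∑-const xs c))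
    (solve 2 (λ c n → c :+ n :* c := (:1 :+ n) :* c) refl c (fromℕ (length xs)))

  ∑-filter : ∀ {A : Set} {P : A → Set} (P? : ∀ a → Dec (P a)) xs f →
             ∑ (filter P? xs) f ≡ ∑ xs (λ a → 𝟙 (P? a) * f a)
  ∑-filter P? [] f = refl
  ∑-filter P? (x ∷ xs) f with P? x
  ... | yes _ = cong₂ _+_ (sym (*-identityˡ _)) (∑-filter P? xs f)
  ... | no  _ = trans (∑-filter P? xs f) (sym (trans (cong (_+ ∑ xs (λ a → 𝟙 (P? a) * f a)) (zeroˡ (f x))) (+-identityˡ _)))

  ∑-++ : ∀ {A : Set} (xs ys : List A) f → ∑ (xs ++ ys) f ≡ ∑ xs f + ∑ ys f
  ∑-++ [] ys f = sym (+-identityˡ _)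
  ∑-++ (x ∷ xs) ys f = trans (cong (f x +_) (∑-++ xs ys f)) (sym (+-assoc _ _ _))

  ∑-map : ∀ {A B : Set} (h : A → B) xs f → ∑ (List.map h xs) f ≡ ∑ xs (f ∘ h)
  ∑-map h [] f = refl
  ∑-map h (x ∷ xs) f = cong (f (h x) +_) (∑-map h xs f)

  ∑-cartesian : ∀ {A B : Set} (xs : List A) (ys : List B) f →
                ∑ (cartesianProduct xs ys) f ≡ ∑ xs (λ a → ∑ ys (λ b → f (a , b)))
  ∑-cartesian [] ys f = refl
  ∑-cartesian (x ∷ xs) ys f = trans (∑-++ (List.map (x ,_) ys) _ f)
    (cong₂ _+_ (∑-map (x ,_) ys f) (∑-cartesian xs ys f))

  ∑-tabulate : ∀ {A : Set} {n} (h : Fin n → A) f → ∑ (tabulate h) f ≡ ∑ (allFin n) (f ∘ h)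
  ∑-tabulate {n = zero} h f = refl
  ∑-tabulate {n = suc n} h f = cong (f (h zero) +_)
    (trans (∑-tabulate (h ∘ suc) f) (sym (∑-tabulate suc (f ∘ h))))

  ∑-allFin-suc : ∀ n (f : Fin (suc n) → R) → ∑ (allFin (suc n)) f ≡ f zero + ∑ (allFin n) (f ∘ suc)
  ∑-allFin-suc n f = cong (f zero +_) (∑-tabulate suc f)

  ∑-𝟙 : ∀ {n} (x : Fin n) (g : Fin n → R) → ∑ (allFin n) (λ k → 𝟙 (x Fin.≟ k) * g k) ≡ g x
  ∑-𝟙 {suc n} zero g = trans (∑-allFin-suc n _) (trans (cong₂ _+_ (*-identityˡ _)
    (trans (Linear.ext (∑-linear (allFin n)) (λ k → zeroˡ _)) (Linear.zero-on (∑-linear (allFin n))))) (+-identityʳ _))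
  ∑-𝟙 {suc n} (suc x) g = trans (∑-allFin-suc n _) (trans (cong₂ _+_ (zeroˡ _)
    (trans (Linear.ext (∑-linear (allFin n)) (λ k → cong (_* g (suc k)) (𝟙-cong (suc x Fin.≟ suc k) (x Fin.≟ k) Fin.suc-injective (cong suc)))) (∑-𝟙 x (g ∘ suc)))) (+-identityˡ _))

  length-tabulate′ : ∀ {A : Set} {n} (h : Fin n → A) → length (tabulate h) ≡ n
  length-tabulate′ {n = zero} h = refl
  length-tabulate′ {n = suc n} h = cong suc (length-tabulate′ (h ∘ suc))

  ∑-allFin-const : ∀ n c → ∑ (allFin n) (λ _ → c) ≡ fromℕ n * c
  ∑-allFin-const n c = trans (∑-const (allFin n) c) (cong (λ k → fromℕ k * c) (length-tabulate′ {n = n} id))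

  -- Finitely supported probability distributions, encoded by their expectation functionals

  record Dist (A : Set) : Set₁ where
    field
      E      : (A → R) → R
      mono   : ∀ {f g} → (∀ a → f a ≤ g a) → E f ≤ E g
      add    : ∀ f g → E (λ a → f a + g a) ≡ E f + E g
      scale  : ∀ c f → E (λ a → c * f a) ≡ c * E f
      one    : E (λ _ → 1#) ≡ 1#
      -- `attain` and `fubini` are what finite support is used for: the first turns an average into
      -- a witness, the second exchanges the expectation with any linear functional, be it a sum, a
      -- mean over tuples or another expectation.
      attain : ∀ f → ∃ λ a → E f ≤ f a
      fubini : ∀ {B : Set} {N : (B → R) → R} → Linear N → (f : A → B → R) →
               E (λ a → N (f a)) ≡ N (λ b → E (λ a → f a b))

    ext : ∀ {f g} → (∀ a → f a ≡ g a) → E f ≡ E g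
    ext e = ≤-antisym (mono (λ a → ≤-reflexive (e a))) (mono (λ a → ≤-reflexive (sym (e a))))

    linear : Linear E
    linear = record { ext = ext ; add = add ; scale = scale }

    open Linear linear public using (scaleʳ; neg; sub; zero-on)

    const : ∀ c → E (λ _ → c) ≡ c
    const c = trans (ext (λ _ → sym (*-identityʳ c))) (trans (scale c (λ _ → 1#)) (trans (cong (c *_) one) (*-identityʳ c)))

    ≤const : ∀ {f c} → (∀ a → f a ≤ c) → E f ≤ c
    ≤const {c = c} h = ≤-trans (mono h) (≤-reflexive (const c))

    const≤ : ∀ {f c} → (∀ a → c ≤ f a) → c ≤ E f
    const≤ {c = c} h = ≤-trans (≤-reflexive (sym (const c))) (mono h)

    attain-low : ∀ f → ∃ λ a → f a ≤ E f
    attain-low f with attain (λ a → - f a)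
    ... | a , p = a , ≤-by (≤⇒0≤ p) (trans (solve 2 (λ e x → e := x :+ (:- x :- (:- e))) refl (E f) (f a))
                    (cong (λ t → f a + (- f a - t)) (sym (neg f))))

    ∣E∣≤ : ∀ f → ∣ E f ∣ ≤ E (λ a → ∣ f a ∣)
    ∣E∣≤ f = ∣x∣≤ (mono (λ a → x≤∣x∣ (f a))) (≤-trans (≤-reflexive (sym (neg f))) (mono (λ a → -x≤∣x∣ (f a))))

    ∣E-E∣≤E : ∀ {f g c} → (∀ a → ∣ f a - g a ∣ ≤ c a) → ∣ E f - E g ∣ ≤ E c
    ∣E-E∣≤E {f} {g} h = ≤-trans (≤-reflexive (cong ∣_∣ (sym (sub f g)))) (≤-trans (∣E∣≤ _) (mono h))

  open Dist public using (E)

  abstract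
    uniform : ∀ {A : Set} → A → List A → Dist A
    uniform {A} x xs = record
      { E = λ f → ∑ L f * N ⁻¹
      ; mono = λ h → *-monoʳ (proj₁ (⁻¹-pos Npos)) (∑-mono L h)
      ; add = λ f g → trans (cong (_* N ⁻¹) (Linear.add (∑-linear L) f g)) (distribʳ _ _ _)
      ; scale = λ c f → trans (cong (_* N ⁻¹) (Linear.scale (∑-linear L) c f)) (*-assoc _ _ _)
      ; one = trans (cong (_* N ⁻¹) (trans (∑-const L 1#) (*-identityʳ N))) (⁻¹-inverse N (pos⇒≢0 Npos))
      ; attain = λ f → let a , p = big f x xs in a , div-≤ Npos (≤-trans p (≤-reflexive (*-comm N _)))
      ; fubini = λ L′ f → trans (cong (_* N ⁻¹) (∑-swap L L′ f)) (sym (Linear.scaleʳ L′ (N ⁻¹) _))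
      }
      where
      L : List A
      L = x ∷ xs
      N : R
      N = fromℕ (length L)
      Npos : 0# < N
      Npos = fromℕ-pos {length L} (ℕ.s≤s ℕ.z≤n)
      big : (f : A → R) (x : A) (xs : List A) → ∃ λ a → ∑ (x ∷ xs) f ≤ fromℕ (length (x ∷ xs)) * f a
      big f x [] = x , ≤-reflexive (solve 1 (λ a → a :+ :0 := (:1 :+ :0) :* a) refl (f x))
      big f x (y ∷ ys) with big f y ys
      ... | a , p with ≤-total (f x) (f a)
      ... | inj₁ q = a , ≤-trans (+-mono q p) (≤-reflexive (solve 2 (λ a n → a :+ n :* a := (:1 :+ n) :* a) refl (f a) (fromℕ (length (y ∷ ys)))))
      ... | inj₂ q = x , ≤-trans (+-mono ≤-refl (≤-trans p (*-monoˡ (fromℕ-nonneg (length (y ∷ ys))) q)))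
                     (≤-reflexive (solve 2 (λ a n → a :+ n :* a := (:1 :+ n) :* a) refl (f x) (fromℕ (length (y ∷ ys)))))

    uniform-E : ∀ {A : Set} (x : A) xs f → E (uniform x xs) f ≡ ∑ (x ∷ xs) f * fromℕ (suc (length xs)) ⁻¹
    uniform-E x xs f = refl

  dirac : ∀ {A : Set} → A → Dist A
  dirac a = record { E = λ f → f a ; mono = λ h → h a ; add = λ f g → refl ; scale = λ c f → refl
                   ; one = refl ; attain = λ f → a , ≤-refl ; fubini = λ L f → refl }

  bind : ∀ {A B C : Set} → Dist A → (A → Dist B) → (A → B → C) → Dist C
  bind μ ν h = record
    { E = λ f → E μ (λ a → E (ν a) (λ b → f (h a b)))
    ; mono = λ p → Dist.mono μ (λ a → Dist.mono (ν a) (λ b → p (h a b)))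
    ; add = λ f g → trans (Dist.ext μ (λ a → Dist.add (ν a) _ _)) (Dist.add μ _ _)
    ; scale = λ c f → trans (Dist.ext μ (λ a → Dist.scale (ν a) c _)) (Dist.scale μ c _)
    ; one = trans (Dist.ext μ (λ a → Dist.one (ν a))) (Dist.one μ)
    ; attain = λ f → let a , p = Dist.attain μ (λ a → E (ν a) (λ b → f (h a b)))
                         b , q = Dist.attain (ν a) (λ b → f (h a b)) in h a b , ≤-trans p q
    ; fubini = λ L f → trans (Dist.ext μ (λ a → Dist.fubini (ν a) L (λ b → f (h a b)))) (Dist.fubini μ L _)
    }

  product : ∀ {B : Set} {n} → (Fin n → Dist B) → Dist (Vec B n)
  product {n = zero}  K = dirac []
  product {n = suc n} K = bind (K zero) (λ _ → product (K ∘ suc)) _∷_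

  vec : ∀ {B : Set} → Dist B → ∀ t → Dist (Vec B t)
  vec μ t = product {n = t} (λ _ → μ)

  vec-++ : ∀ {B : Set} (μ : Dist B) m n F →
           E (vec μ (m ℕ.+ n)) F ≡ E (vec μ m) (λ x → E (vec μ n) (λ y → F (x Vec.++ y)))
  vec-++ μ zero n F = refl
  vec-++ μ (suc m) n F = Dist.ext μ (λ a → vec-++ μ m n (λ y → F (a ∷ y)))

  -- The draws are independent, so replacing one by a fresh draw of the same law changes no
  -- expectation. Each redrawing step isolates its vertex in this way.
  product-resample : ∀ {B : Set} {n} (K : Fin n → Dist B) (i : Fin n) F →
    E (product K) F ≡ E (product K) (λ β → E (K i) (λ b → F (β [ i ]≔ b)))
  product-resample K zero F = sym (trans (Dist.const (K zero) _)
    (Dist.fubini (product (K ∘ suc)) (Dist.linear (K zero)) _))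
  product-resample K (suc i) F = Dist.ext (K zero) (λ a → product-resample (K ∘ suc) i (λ y → F (a ∷ y)))

  -- Conditioning

  -- `expect` is the defining formula of a conditional expectation with the denominator multiplied
  -- out. It forces the law to be carried by `P`, which is what `local` extracts.
  record IsConditional {A : Set} {P : A → Set} (Ω : Dist A) (P? : ∀ a → Dec (P a)) (K : Dist A) : Set where
    field
      pos    : 0# < E Ω (λ b → 𝟙 (P? b))
      expect : ∀ f → E K f * E Ω (λ b → 𝟙 (P? b)) ≡ E Ω (λ b → 𝟙 (P? b) * f b)

    local : ∀ {f g} → (∀ b → P b → f b ≡ g b) → E K f ≡ E K g
    local {f} {g} h = trans (sym (*⁻¹-cancelʳ _ pos)) (trans (cong (_* E Ω (λ b → 𝟙 (P? b)) ⁻¹)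
      (trans (expect f) (trans (Dist.ext Ω (λ b → 𝟙-subst (P? b) (h b))) (sym (expect g))))) (*⁻¹-cancelʳ _ pos))

  abstract
    -- The kernels are later evaluated at codes read off the large graph, which need not occur in
    -- the sample. The uniform law is the fallback there; correctness is claimed for codes that
    -- occur.
    conditional : ∀ {A : Set} {P : A → Set} → A → List A → (∀ a → Dec (P a)) → Dist A
    conditional x xs P? with filter P? (x ∷ xs)
    ... | []     = uniform x xs
    ... | y ∷ ys = uniform y ys

    conditional-correct : ∀ {A : Set} {P : A → Set} x xs (P? : ∀ a → Dec (P a)) {a} → a ∈ (x ∷ xs) → P a →
                          IsConditional (uniform x xs) P? (conditional x xs P?)
    conditional-correct x xs P? {a} a∈ pa with filter P? (x ∷ xs) | ∈-filter⁺ P? a∈ pa | ∑-filter P? (x ∷ xs)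
    ... | y ∷ ys | _ | s = record
      { pos = subst (0# <_) (sym mass) (*-pos Mpos (⁻¹-pos Npos))
      ; expect = λ f → trans (cong (∑ (y ∷ ys) f * M ⁻¹ *_) mass)
          (trans (solve 4 (λ S m M n → S :* m :* (M :* n) := S :* n :* (M :* m)) refl (∑ (y ∷ ys) f) (M ⁻¹) M (N ⁻¹))
          (trans (cong (∑ (y ∷ ys) f * N ⁻¹ *_) (⁻¹-inverse M (pos⇒≢0 Mpos)))
          (trans (*-identityʳ _) (cong (_* N ⁻¹) (s f)))))
      }
      where
      N M : R
      N = fromℕ (length (x ∷ xs))
      M = fromℕ (length (y ∷ ys))
      Npos : 0# < N
      Npos = fromℕ-pos {length (x ∷ xs)} (ℕ.s≤s ℕ.z≤n)
      Mpos : 0# < M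
      Mpos = fromℕ-pos {length (y ∷ ys)} (ℕ.s≤s ℕ.z≤n)
      mass : ∑ (x ∷ xs) (λ b → 𝟙 (P? b)) * N ⁻¹ ≡ M * N ⁻¹
      mass = cong (_* N ⁻¹) (trans (Linear.ext (∑-linear (x ∷ xs)) (λ b → sym (*-identityʳ _)))
        (trans (sym (s (λ _ → 1#))) (trans (∑-const (y ∷ ys) 1#) (*-identityʳ M))))

  abstract
    conditional-empty : ∀ {A : Set} {P : A → Set} x xs (P? : ∀ a → Dec (P a)) → (∀ a → ¬ P a) →
                        conditional x xs P? ≡ uniform x xs
    conditional-empty x xs P? n with filter P? (x ∷ xs) | List.filter-none P? {xs = x ∷ xs} (All.universal n (x ∷ xs))
    ... | [] | _ = refl

  -- Conditional expectation with respect to the partition into fibres of `c`. The kernel takes a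
  -- code instead of a point, so that codes from another graph can drive the same draws.
  record Conditioning {A C : Set} (Ω : Dist A) (c : A → C) : Set₁ where
    field
      _≟C_ : DecidableEquality C
      K    : C → Dist A
      isConditional : ∀ a → IsConditional Ω (λ b → c b ≟C c a) (K (c a))

    cond : (A → R) → A → R
    cond f a = E (K (c a)) f

    cond-inv : (f : A → R) → ∀ {a b} → c a ≡ c b → cond f a ≡ cond f b
    cond-inv f e = cong (λ l → E (K l) f) e

    -- Conditional expectation is self-adjoint: once `cond` is expanded as an average over the fibre
    -- of `a`, exchanging `a` and `b` leaves the mass of the fibre of `b`, which cancels against its
    -- normalisation.
    projection : (f v : A → R) → (∀ a b → c a ≡ c b → v a ≡ v b) →
                 E Ω (λ a → cond f a * v a) ≡ E Ω (λ a → f a * v a)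
    projection f v inv = begin
      E Ω (λ a → cond f a * v a)
        ≡⟨ Dist.ext Ω (λ a → trans (cong (_* v a) (trans (sym (*⁻¹-cancelʳ _ (pos a))) (cong (_* m a ⁻¹) (expect a f))))
             (trans (*-assoc _ _ _) (trans (sym (Dist.scaleʳ Ω _ _)) (Dist.ext Ω (λ b →
               trans (*-assoc _ _ _) (𝟙-subst (c b ≟C c a) (λ e →
                 cong (f b *_) (cong₂ _*_ (cong _⁻¹ (m-inv e)) (inv a b (sym e)))))))))) ⟩
      E Ω (λ a → E Ω (λ b → 𝟙 (c b ≟C c a) * (f b * (m b ⁻¹ * v b))))
        ≡⟨ Dist.fubini Ω (Dist.linear Ω) _ ⟩
      E Ω (λ b → E Ω (λ a → 𝟙 (c b ≟C c a) * (f b * (m b ⁻¹ * v b))))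
        ≡⟨ Dist.ext Ω (λ b → trans (Dist.scaleʳ Ω _ _) (trans (cong (_* (f b * (m b ⁻¹ * v b))) (Dist.ext Ω (λ a →
             𝟙-cong (c b ≟C c a) (c a ≟C c b) sym sym)))
             (trans (solve 4 (λ m f i v → m :* (f :* (i :* v)) := (f :* v) :* m :* i) refl (m b) (f b) (m b ⁻¹) (v b))
               (*⁻¹-cancelʳ _ (pos b))))) ⟩
      E Ω (λ b → f b * v b) ∎
      where
      open ≡-Reasoning
      pos : ∀ a → 0# < E Ω (λ b → 𝟙 (c b ≟C c a))
      pos a = IsConditional.pos (isConditional a)
      expect : ∀ a f → cond f a * E Ω (λ b → 𝟙 (c b ≟C c a)) ≡ E Ω (λ b → 𝟙 (c b ≟C c a) * f b)
      expect a = IsConditional.expect (isConditional a)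
      m : A → R
      m a = E Ω (λ b → 𝟙 (c b ≟C c a))
      m-inv : ∀ {a b} → c b ≡ c a → m a ≡ m b
      m-inv {a} {b} e = cong (λ l → E Ω (λ d → 𝟙 (c d ≟C l))) (sym e)

  open Conditioning public using (cond)

  -- The mean square of the conditional label frequencies, the potential of regularity arguments: it
  -- is bounded, and its growth under refinement is the squared distance between the coarse and the
  -- fine prediction.
  energy : ∀ {A C : Set} {Ω : Dist A} {c : A → C} {T} → (A → Fin T) → Conditioning Ω c → R
  energy {Ω = Ω} {T = T} ℓ 𝒦 = ∑ (allFin T) (λ κ → E Ω (λ a → cond 𝒦 (λ b → 𝟙 (ℓ b Fin.≟ κ)) a * cond 𝒦 (λ b → 𝟙 (ℓ b Fin.≟ κ)) a))

  module Refinement {A C C′ : Set} {Ω : Dist A} {c : A → C} {c′ : A → C′}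
                    (𝒦 : Conditioning Ω c) (𝒦′ : Conditioning Ω c′)
                    (finer : ∀ a b → c′ a ≡ c′ b → c a ≡ c b) where

    -- The coarse prediction is constant on fine fibres, so by `projection` the cross term equals
    -- the coarse second moment.
    pythagoras : (f : A → R) → E Ω (λ a → (cond 𝒦 f a - cond 𝒦′ f a) * (cond 𝒦 f a - cond 𝒦′ f a)) ≡
      E Ω (λ a → cond 𝒦′ f a * cond 𝒦′ f a) - E Ω (λ a → cond 𝒦 f a * cond 𝒦 f a)
    pythagoras f = begin
      E Ω (λ a → (k a - k′ a) * (k a - k′ a))
        ≡⟨ Dist.ext Ω (λ a → solve 2 (λ x y → (x :- y) :* (x :- y) := (x :* x :+ y :* y) :- (y :* x :+ y :* x)) refl (k a) (k′ a)) ⟩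
      E Ω (λ a → (k a * k a + k′ a * k′ a) - (k′ a * k a + k′ a * k a))
        ≡⟨ trans (Dist.sub Ω _ _) (cong₂ _-_ (Dist.add Ω _ _) (Dist.add Ω _ _)) ⟩
      (E Ω (λ a → k a * k a) + E Ω (λ a → k′ a * k′ a)) - (E Ω (λ a → k′ a * k a) + E Ω (λ a → k′ a * k a))
        ≡⟨ cong (λ t → (E Ω (λ a → k a * k a) + E Ω (λ a → k′ a * k′ a)) - (t + t))
             (trans (Conditioning.projection 𝒦′ f k (λ a b e → Conditioning.cond-inv 𝒦 f (finer a b e)))
               (sym (Conditioning.projection 𝒦 f k (λ a b e → Conditioning.cond-inv 𝒦 f e)))) ⟩
      (E Ω (λ a → k a * k a) + E Ω (λ a → k′ a * k′ a)) - (E Ω (λ a → k a * k a) + E Ω (λ a → k a * k a))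
        ≡⟨ solve 2 (λ x y → (x :+ y) :- (x :+ x) := y :- x) refl _ _ ⟩
      E Ω (λ a → k′ a * k′ a) - E Ω (λ a → k a * k a) ∎
      where
      open ≡-Reasoning
      k = cond 𝒦 f
      k′ = cond 𝒦′ f

    -- Since `u` is constant on fine fibres, `f` may be exchanged for its fine prediction. What
    -- remains is the distance of the two predictions tested against `u`, which `amgm` reduces to
    -- `pythagoras`.
    test-bound : (f u : A → R) → (∀ a b → c′ a ≡ c′ b → u a ≡ u b) → (∀ a → 0# ≤ u a) → (∀ a → u a ≤ 1#) →
      ∀ {l} → 0# < l → ∣ E Ω (λ a → cond 𝒦 f a * u a) - E Ω (λ a → f a * u a) ∣ ≤
      l + (E Ω (λ a → cond 𝒦′ f a * cond 𝒦′ f a) - E Ω (λ a → cond 𝒦 f a * cond 𝒦 f a)) * l ⁻¹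
    test-bound f u inv u≥0 u≤1 {l} l>0 = ≤-trans (≤-reflexive (cong ∣_∣ (trans
        (cong (λ t → E Ω (λ a → cond 𝒦 f a * u a) - t) (sym (Conditioning.projection 𝒦′ f u inv))) (sym (Dist.sub Ω _ _)))))
      (≤-trans (Dist.∣E∣≤ Ω _) (≤-trans (Dist.mono Ω point) (≤-reflexive
        (trans (Dist.add Ω _ _) (cong₂ _+_ (Dist.const Ω l) (trans (Dist.scaleʳ Ω _ _) (cong (_* l ⁻¹) (pythagoras f))))))))
      where
      d : A → R
      d a = cond 𝒦 f a - cond 𝒦′ f a
      point : ∀ a → ∣ cond 𝒦 f a * u a - cond 𝒦′ f a * u a ∣ ≤ l + d a * d a * l ⁻¹
      point a = ≤-trans (amgm _ l>0) (+-mono ≤-refl (*-monoʳ (proj₁ (⁻¹-pos l>0))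
        (≤-trans (≤-reflexive (solve 3 (λ x y u → (x :* u :- y :* u) :* (x :* u :- y :* u) := ((x :- y) :* (x :- y)) :* (u :* u)) refl (cond 𝒦 f a) (cond 𝒦′ f a) (u a)))
          (≤-trans (*-monoˡ (sq-nonneg (d a)) (≤-trans (*-monoʳ (u≥0 a) (u≤1 a)) (≤-trans (≤-reflexive (*-identityˡ _)) (u≤1 a))))
            (≤-reflexive (*-identityʳ _))))))

    -- Replacing a label by an independent draw from its conditional law changes the expectation
    -- of a test function by an amount controlled by the energy gained in passing to a finer code
    -- which the test function sees.
    replacement : ∀ {T} (ℓ : A → Fin T) (u : Fin T → A → R) →
      (∀ κ a b → c′ a ≡ c′ b → u κ a ≡ u κ b) → (∀ κ a → 0# ≤ u κ a) → (∀ κ a → u κ a ≤ 1#) →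
      ∀ {l} → 0# < l →
      ∣ E Ω (λ a → cond 𝒦 (λ b → u (ℓ b) a) a) - E Ω (λ a → u (ℓ a) a) ∣ ≤
      fromℕ T * l + (energy ℓ 𝒦′ - energy ℓ 𝒦) * l ⁻¹
    replacement {T} ℓ u inv u≥0 u≤1 {l} l>0 = subst₂ (λ x y → ∣ x - y ∣ ≤ _) (sym lhs) (sym rhs)
        (≤-trans (bound (allFin T)) (≤-reflexive total))
      where
      f : Fin T → A → R
      f κ b = 𝟙 (ℓ b Fin.≟ κ)
      S = ∑-linear (allFin T)
      -- Split by the value `κ` of the label, drawn on one side and true on the other; each `κ` then
      -- contributes a fixed test function `u κ`.
      lhs : E Ω (λ a → cond 𝒦 (λ b → u (ℓ b) a) a) ≡ ∑ (allFin T) (λ κ → E Ω (λ a → cond 𝒦 (f κ) a * u κ a))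
      lhs = trans (Dist.ext Ω (λ a → trans (Dist.ext (Conditioning.K 𝒦 (c a)) (λ b → sym (∑-𝟙 (ℓ b) (λ κ → u κ a))))
              (trans (Dist.fubini (Conditioning.K 𝒦 (c a)) S _) (Linear.ext S (λ κ → Dist.scaleʳ (Conditioning.K 𝒦 (c a)) _ _)))))
              (Dist.fubini Ω S _)
      rhs : E Ω (λ a → u (ℓ a) a) ≡ ∑ (allFin T) (λ κ → E Ω (λ a → f κ a * u κ a))
      rhs = trans (Dist.ext Ω (λ a → sym (∑-𝟙 (ℓ a) (λ κ → u κ a)))) (Dist.fubini Ω S _)
      e e′ : Fin T → R
      e κ = E Ω (λ a → cond 𝒦 (f κ) a * cond 𝒦 (f κ) a)
      e′ κ = E Ω (λ a → cond 𝒦′ (f κ) a * cond 𝒦′ (f κ) a)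
      bound : ∀ κs → ∣ ∑ κs (λ κ → E Ω (λ a → cond 𝒦 (f κ) a * u κ a)) - ∑ κs (λ κ → E Ω (λ a → f κ a * u κ a)) ∣ ≤
              ∑ κs (λ κ → l + (e′ κ - e κ) * l ⁻¹)
      bound [] = ≡⇒∣-∣≤0 refl
      bound (κ ∷ κs) = ∣-∣≤
          (≤-trans (+-mono (diff≤ h) (diff≤ (bound κs))) (≤-reflexive (solve 4 (λ a b c d → a :+ b :+ (c :+ d) := a :+ c :+ (b :+ d)) refl _ _ _ _)))
          (≤-trans (+-mono (diff≤′ h) (diff≤′ (bound κs))) (≤-reflexive (solve 4 (λ a b c d → a :+ b :+ (c :+ d) := a :+ c :+ (b :+ d)) refl _ _ _ _)))
        where h = test-bound (f κ) (u κ) (inv κ) (u≥0 κ) (u≤1 κ) l>0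
      total : ∑ (allFin T) (λ κ → l + (e′ κ - e κ) * l ⁻¹) ≡ fromℕ T * l + (energy ℓ 𝒦′ - energy ℓ 𝒦) * l ⁻¹
      total = trans (Linear.add S _ _) (cong₂ _+_ (∑-allFin-const T l)
        (trans (Linear.scaleʳ S _ _) (cong (_* l ⁻¹) (Linear.sub S _ _))))

  energy-nonneg : ∀ {A C : Set} {Ω : Dist A} {c : A → C} {T} (ℓ : A → Fin T) (𝒦 : Conditioning Ω c) → 0# ≤ energy ℓ 𝒦
  energy-nonneg {Ω = Ω} {T = T} ℓ 𝒦 = ≤-trans (≤-reflexive (sym (Linear.zero-on (∑-linear (allFin T)))))
    (∑-mono (allFin T) (λ κ → Dist.const≤ Ω (λ a → sq-nonneg _)))

  energy≤ : ∀ {A C : Set} {Ω : Dist A} {c : A → C} {T} (ℓ : A → Fin T) (𝒦 : Conditioning Ω c) → energy ℓ 𝒦 ≤ fromℕ T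
  energy≤ {Ω = Ω} {c} {T = T} ℓ 𝒦 = ≤-trans (∑-mono (allFin T) (λ κ → Dist.≤const Ω (λ a →
      ≤-trans (*-monoˡ (lo κ a) (hi κ a)) (≤-trans (≤-reflexive (*-identityʳ _)) (hi κ a)))))
      (≤-reflexive (trans (∑-allFin-const T 1#) (*-identityʳ _)))
    where
    lo : ∀ κ a → 0# ≤ cond 𝒦 (λ b → 𝟙 (ℓ b Fin.≟ κ)) a
    lo κ a = Dist.const≤ (Conditioning.K 𝒦 (c a)) (λ b → 𝟙-nonneg (ℓ b Fin.≟ κ))
    hi : ∀ κ a → cond 𝒦 (λ b → 𝟙 (ℓ b Fin.≟ κ)) a ≤ 1#
    hi κ a = Dist.≤const (Conditioning.K 𝒦 (c a)) (λ b → 𝟙≤1 (ℓ b Fin.≟ κ))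

  pigeonhole-energy : ∀ (e : ℕ → R) {η} N → (∃ λ ℓ → ℓ ℕ.< N × e (suc ℓ) ≤ e ℓ + η) ⊎ e 0 + fromℕ N * η ≤ e N
  pigeonhole-energy e {η} zero = inj₂ (≤-reflexive (solve 2 (λ x y → x :+ :0 :* y := x) refl (e 0) η))
  pigeonhole-energy e {η} (suc N) with pigeonhole-energy e N
  ... | inj₁ (ℓ , p , q) = inj₁ (ℓ , ℕ.m<n⇒m<1+n p , q)
  ... | inj₂ h with e (suc N) ≤? (e N + η)
  ...   | yes q = inj₁ (N , ℕ.n<1+n N , q)
  ...   | no  q = inj₂ (≤-trans (≤-trans (≤-reflexive (solve 3 (λ x n y → x :+ (:1 :+ n) :* y := (x :+ n :* y) :+ y) refl (e 0) (fromℕ N) η))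
                    (+-mono h ≤-refl)) (proj₁ (≰⇒< q)))

  -- If every step exceeded `η`, the value after `N` steps would lie above the bound `T`.
  small-increment : ∀ (e : ℕ → R) {η T} N → (∀ ℓ → 0# ≤ e ℓ) → (∀ ℓ → e ℓ ≤ T) → T < fromℕ N * η →
                    ∃ λ ℓ → ℓ ℕ.< N × e (suc ℓ) ≤ e ℓ + η
  small-increment e {η} N lo hi big with pigeonhole-energy e N
  ... | inj₁ r = r
  ... | inj₂ h = ⊥-elim (<⇒≱ big (≤-trans (≤-by (lo 0) (+-comm _ _)) (≤-trans h (hi N))))

-- Tuples, adjacency types and adjacency matrices

vec-ext : ∀ {A : Set} {n} {xs ys : Vec A n} → (∀ i → lookup xs i ≡ lookup ys i) → xs ≡ ys
vec-ext {xs = xs} {ys} h = trans (sym (Vec.tabulate∘lookup xs)) (trans (Vec.tabulate-cong h) (Vec.tabulate∘lookup ys))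

map-≡⇒ : ∀ {A B : Set} {n} {f g : A → B} (xs : Vec A n) → Vec.map f xs ≡ Vec.map g xs →
         ∀ i → f (lookup xs i) ≡ g (lookup xs i)
map-≡⇒ {f = f} {g} xs e i = trans (sym (Vec.lookup-map i f xs)) (trans (cong (λ v → lookup v i) e) (Vec.lookup-map i g xs))

map-++-≡⇒ : ∀ {A B : Set} {m n} {f g : A → B} (xs : Vec A m) (ys : Vec A n) →
            Vec.map f (xs Vec.++ ys) ≡ Vec.map g (xs Vec.++ ys) →
            Vec.map f xs ≡ Vec.map g xs × Vec.map f ys ≡ Vec.map g ys
map-++-≡⇒ {f = f} {g} xs ys e = Vec.++-injective (Vec.map f xs) (Vec.map g xs)
  (trans (sym (Vec.map-++ f xs ys)) (trans e (Vec.map-++ g xs ys)))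

Matrix : ℕ → Set
Matrix r = Vec (Vec Bool r) r

types : ∀ {n q} → (Fin n → Fin n → Bool) → Vec (Fin n) q → Fin n → Vec Bool q
types A w v = Vec.map (A v) w

matrix : ∀ {n r} → (Fin n → Fin n → Bool) → Vec (Fin n) r → Matrix r
matrix A y = Vec.map (types A y) y

entry : ∀ {r} → Matrix r → Fin r → Fin r → Bool
entry M i j = lookup (lookup M i) j

entry-matrix : ∀ {n r} (A : Fin n → Fin n → Bool) (y : Vec (Fin n) r) i j →
               entry (matrix A y) i j ≡ A (lookup y i) (lookup y j)
entry-matrix A y i j = trans (cong (λ v → lookup v j) (Vec.lookup-map i (types A y) y)) (Vec.lookup-map j _ y)

matrix-cong : ∀ {n n′ r} (A : Fin n → Fin n → Bool) (A′ : Fin n′ → Fin n′ → Bool) (y : Vec (Fin n) r) y′ →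
              (∀ i j → A (lookup y i) (lookup y j) ≡ A′ (lookup y′ i) (lookup y′ j)) → matrix A y ≡ matrix A′ y′
matrix-cong A A′ y y′ h = vec-ext λ i → vec-ext λ j →
  trans (entry-matrix A y i j) (trans (h i j) (sym (entry-matrix A′ y′ i j)))

-- Redrawing labels one vertex at a time

module Resampling (ℝ : RealField) where
  open Distributions ℝ public

  -- A hybrid between the true and the fully redrawn state: listed positions are redrawn in turn,
  -- the others keep what `z` holds. Recursion over the list lets consecutive hybrids differ in a
  -- single draw.
  resample : ∀ {I B Z : Set} → (I → Dist B) → (I → B → Z → Z) → (Z → R) → List I → Z → R
  resample K upd val []       z = val z
  resample K upd val (i ∷ is) z = E (K i) (λ b → resample K upd val is (upd i b z))

  module _ {I B Z : Set} {K : I → Dist B} {upd : I → B → Z → Z} {val : Z → R} where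

    resample≥ : ∀ {c} → (∀ z → c ≤ val z) → ∀ is z → c ≤ resample K upd val is z
    resample≥ h [] z = h z
    resample≥ h (i ∷ is) z = Dist.const≤ (K i) (λ b → resample≥ h is (upd i b z))

    resample≤ : ∀ {c} → (∀ z → val z ≤ c) → ∀ is z → resample K upd val is z ≤ c
    resample≤ h [] z = h z
    resample≤ h (i ∷ is) z = Dist.≤const (K i) (λ b → resample≤ h is (upd i b z))

    -- The relation carries the list of draws still to come, so that states may differ where a later
    -- draw overwrites them.
    resample-rel : (_∼⟨_⟩_ : Z → List I → Z → Set) →
      (∀ {z z′ i is} → z ∼⟨ i ∷ is ⟩ z′ → ∀ b → upd i b z ∼⟨ is ⟩ upd i b z′) →
      (∀ {z z′} → z ∼⟨ [] ⟩ z′ → val z ≡ val z′) →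
      ∀ is {z z′} → z ∼⟨ is ⟩ z′ → resample K upd val is z ≡ resample K upd val is z′
    resample-rel _∼⟨_⟩_ step done [] h = done h
    resample-rel _∼⟨_⟩_ step done (i ∷ is) h = Dist.ext (K i) (λ b → resample-rel _∼⟨_⟩_ step done is (step h b))

    -- Successive independent draws can be read off a single random assignment.
    realize : {Bt : Set} (𝔅 : Dist Bt) (get : Bt → I → B) (set : Bt → I → B → Bt)
      (Valid : I → Set) (Apart : I → I → Set) →
      (∀ i → Valid i → ∀ F → E 𝔅 F ≡ E 𝔅 (λ β → E (K i) (λ b → F (set β i b)))) →
      (∀ β i b → get (set β i b) i ≡ b) →
      (∀ β i j b → Valid i → Valid j → Apart i j → get (set β i b) j ≡ get β j) →
      ∀ is → All Valid is → AllPairs Apart is → ∀ z →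
      E 𝔅 (λ β → val (foldl (λ z i → upd i (get β i) z) z is)) ≡ resample K upd val is z
    realize 𝔅 get set Valid Apart res same other [] _ _ z = Dist.const 𝔅 (val z)
    realize {Bt} 𝔅 get set Valid Apart res same other (i ∷ is) (v ∷ vs) (a ∷ as) z = begin
      E 𝔅 (λ β → val (fold β (upd i (get β i) z) is))
        -- The cell read now is redrawn. Later positions are apart from `i` and read other cells, so
        -- the fresh value is seen at this step only.
        ≡⟨ res i v _ ⟩
      E 𝔅 (λ β → E (K i) (λ b → val (fold (set β i b) (upd i (get (set β i b) i) z) is)))
        ≡⟨ Dist.ext 𝔅 (λ β → Dist.ext (K i) (λ b → cong val (trans
             (cong (λ c → fold (set β i b) (upd i c z) is) (same β i b)) (unchanged β b is vs a (upd i b z))))) ⟩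
      E 𝔅 (λ β → E (K i) (λ b → val (fold β (upd i b z) is)))
        ≡⟨ Dist.fubini 𝔅 (Dist.linear (K i)) _ ⟩
      E (K i) (λ b → E 𝔅 (λ β → val (fold β (upd i b z) is)))
        ≡⟨ Dist.ext (K i) (λ b → realize 𝔅 get set Valid Apart res same other is vs as (upd i b z)) ⟩
      E (K i) (λ b → resample K upd val is (upd i b z)) ∎
      where
      open ≡-Reasoning
      fold : Bt → Z → List I → Z
      fold β = foldl (λ z i → upd i (get β i) z)
      unchanged : ∀ β b js → All Valid js → All (Apart i) js → ∀ z → fold (set β i b) z js ≡ fold β z js
      unchanged β b [] _ _ z = refl
      unchanged β b (j ∷ js) (w ∷ ws) (p ∷ ps) z =
        trans (cong (λ c → fold (set β i b) (upd j c z) js) (other β i j b v w p)) (unchanged β b js ws ps _)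

  telescope : ∀ {I : Set} {P : I → Set} (F : List I → R) {c} →
    (∀ i is → P i → ∣ F (i ∷ is) - F is ∣ ≤ c) → ∀ is → All P is → ∣ F is - F [] ∣ ≤ fromℕ (length is) * c
  telescope F {c} h [] _ = ≤-trans (≡⇒∣-∣≤0 refl) (≤-reflexive (sym (zeroˡ c)))
  telescope F {c} h (i ∷ is) (p ∷ ps) = ≤-trans (∣-∣-trans (h i is p) (telescope F h is ps))
    (≤-reflexive (solve 2 (λ c n → c :+ n :* c := (:1 :+ n) :* c) refl c (fromℕ (length is))))

  uniformFin : ∀ n → Dist (Fin (suc n))
  uniformFin n = uniform zero (tabulate suc)

  module Labels {n : ℕ} (H : Graph (suc n)) {T : ℕ} (ℓ : Fin (suc n) → Fin T) (r : ℕ) where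

    U : Dist (Fin (suc n))
    U = uniformFin n

    typeKernel : ∀ {q} → Vec (Fin (suc n)) q → Vec Bool q → Dist (Fin (suc n))
    typeKernel w t = conditional zero (tabulate suc) (λ b → Vec.≡-dec Bool._≟_ (types (adj H) w b) t)

    typeConditioning : ∀ {q} (w : Vec (Fin (suc n)) q) → Conditioning U (types (adj H) w)
    typeConditioning w = record
      { _≟C_ = Vec.≡-dec Bool._≟_ ; K = typeKernel w
      ; isConditional = λ a → conditional-correct zero (tabulate suc) _ (∈-allFin a) refl }

    typeEnergy : ∀ {q} → Vec (Fin (suc n)) q → R
    typeEnergy w = energy ℓ (typeConditioning w)

    module _ (val : Vec (Fin T) r → Matrix r → R) (val≥0 : ∀ ζ M → 0# ≤ val ζ M) (val≤1 : ∀ ζ M → val ζ M ≤ 1#)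
             {q : ℕ} (w : Vec (Fin (suc n)) q) where

      relabel : List (Fin r) → Vec (Vec Bool q) r → Matrix r → Vec (Fin T) r → R
      relabel is τs M ζ = resample (λ i → typeKernel w (lookup τs i)) (λ i a ζ → ζ [ i ]≔ ℓ a) (λ ζ → val ζ M) is ζ

      relabelAt : List (Fin r) → Vec (Fin (suc n)) r → R
      relabelAt is y = relabel is (Vec.map (types (adj H) w) y) (matrix (adj H) y) (Vec.map ℓ y)

      -- The vertex at position `i` is isolated as `a`. With `ℓ a` split off as the label,
      -- everything else sees `a` through its adjacencies to the other entries of `y` and to `w`,
      -- hence through its type over `y ++ w`. So `replacement` applies with that refinement, and
      -- its cost is the energy gained from the pivots `y`.
      relabel-step : ∀ i is {l} → 0# < l →
        ∣ E (vec U r) (relabelAt (i ∷ is)) - E (vec U r) (relabelAt is) ∣ ≤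
        fromℕ T * l + (E (vec U r) (λ y → typeEnergy (y Vec.++ w)) - typeEnergy w) * l ⁻¹
      relabel-step i is {l} l>0 =
        subst₂ (λ x y → ∣ x - y ∣ ≤ _) (sym (product-resample (λ _ → U) i (relabelAt (i ∷ is))))
          (sym (product-resample (λ _ → U) i (relabelAt is)))
          (≤-trans (Dist.∣E-E∣≤E (vec U r) at)
            (≤-reflexive (trans (Dist.add (vec U r) _ _) (cong₂ _+_ (Dist.const (vec U r) _)
              (trans (Dist.scaleʳ (vec U r) _ _) (cong (_* l ⁻¹)
                (trans (Dist.sub (vec U r) _ _) (cong (λ t → E (vec U r) (λ y → typeEnergy (y Vec.++ w)) - t) (Dist.const (vec U r) _)))))))))
        where
        τ = types (adj H) w
        u : Vec (Fin (suc n)) r → Fin T → Fin (suc n) → R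
        u y κ a = relabel is (Vec.map τ (y [ i ]≔ a)) (matrix (adj H) (y [ i ]≔ a)) (Vec.map ℓ y [ i ]≔ κ)
        u-inv : ∀ y κ a b → types (adj H) (y Vec.++ w) a ≡ types (adj H) (y Vec.++ w) b → u y κ a ≡ u y κ b
        u-inv y κ a b e = cong₂ (λ τs M → relabel is τs M (Vec.map ℓ y [ i ]≔ κ))
            (trans (Vec.map-[]≔ τ y i) (trans (cong (Vec.map τ y [ i ]≔_) ew) (sym (Vec.map-[]≔ τ y i))))
            (matrix-cong (adj H) (adj H) (y [ i ]≔ a) (y [ i ]≔ b) ent)
          where
          ey = map-≡⇒ y (proj₁ (map-++-≡⇒ y w e))
          ew = proj₂ (map-++-≡⇒ y w e)
          ent : ∀ p q → adj H (lookup (y [ i ]≔ a) p) (lookup (y [ i ]≔ a) q) ≡ adj H (lookup (y [ i ]≔ b) p) (lookup (y [ i ]≔ b) q)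
          ent p q with p Fin.≟ i | q Fin.≟ i
          ... | yes refl | yes refl rewrite Vec.lookup∘update i y a | Vec.lookup∘update i y b =
            trans (Graph.irrefl H a) (sym (Graph.irrefl H b))
          ... | yes refl | no q≢ rewrite Vec.lookup∘update i y a | Vec.lookup∘update i y b
                | Vec.lookup∘update′ q≢ y a | Vec.lookup∘update′ q≢ y b = ey q
          ... | no p≢ | yes refl rewrite Vec.lookup∘update i y a | Vec.lookup∘update i y b
                | Vec.lookup∘update′ p≢ y a | Vec.lookup∘update′ p≢ y b =
            trans (Graph.sym H _ a) (trans (ey p) (Graph.sym H b _))
          ... | no p≢ | no q≢ rewrite Vec.lookup∘update′ p≢ y a | Vec.lookup∘update′ p≢ y b
                | Vec.lookup∘update′ q≢ y a | Vec.lookup∘update′ q≢ y b = refl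
        before : ∀ y a → relabelAt (i ∷ is) (y [ i ]≔ a) ≡ cond (typeConditioning w) (λ b → u y (ℓ b) a) a
        before y a = trans
          (cong (λ t → E (typeKernel w t) (λ b → relabel is (Vec.map τ (y [ i ]≔ a)) (matrix (adj H) (y [ i ]≔ a)) (Vec.map ℓ (y [ i ]≔ a) [ i ]≔ ℓ b)))
            (trans (Vec.lookup-map i τ (y [ i ]≔ a)) (cong τ (Vec.lookup∘update i y a))))
          (Dist.ext (typeKernel w (τ a)) (λ b → cong (relabel is (Vec.map τ (y [ i ]≔ a)) (matrix (adj H) (y [ i ]≔ a)))
            (trans (cong (_[ i ]≔ ℓ b) (Vec.map-[]≔ ℓ y i)) (Vec.[]≔-idempotent (Vec.map ℓ y) i))))
        after : ∀ y a → relabelAt is (y [ i ]≔ a) ≡ u y (ℓ a) a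
        after y a = cong (relabel is (Vec.map τ (y [ i ]≔ a)) (matrix (adj H) (y [ i ]≔ a))) (Vec.map-[]≔ ℓ y i)
        at : ∀ y → ∣ E U (λ a → relabelAt (i ∷ is) (y [ i ]≔ a)) - E U (λ a → relabelAt is (y [ i ]≔ a)) ∣ ≤
             fromℕ T * l + (typeEnergy (y Vec.++ w) - typeEnergy w) * l ⁻¹
        at y = subst₂ (λ x z → ∣ x - z ∣ ≤ _) (sym (Dist.ext U (before y))) (sym (Dist.ext U (after y)))
          (Refinement.replacement (typeConditioning w) (typeConditioning (y Vec.++ w))
            (λ a b e → proj₂ (map-++-≡⇒ y w e)) ℓ (u y) (u-inv y)
            (λ κ a → resample≥ (λ ζ → val≥0 ζ _) is _) (λ κ a → resample≤ (λ ζ → val≤1 ζ _) is _) l>0)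

      relabel-bound : ∀ is {l} → 0# < l →
        ∣ E (vec U r) (relabelAt is) - E (vec U r) (relabelAt []) ∣ ≤
        fromℕ (length is) * (fromℕ T * l + (E (vec U r) (λ y → typeEnergy (y Vec.++ w)) - typeEnergy w) * l ⁻¹)
      relabel-bound is l>0 = telescope {P = λ _ → ℕ} (λ is → E (vec U r) (relabelAt is)) (λ i is _ → relabel-step i is l>0) is (All.universal (λ _ → 0) is)

-- Updating two coordinates of a tuple or the two colours of a pair

_[_,_]≔₂_ : ∀ {A : Set} {r} → Vec A r → Fin r → Fin r → A × A → Vec A r
y [ i , j ]≔₂ (a , b) = (y [ i ]≔ a) [ j ]≔ b

lookup-≔₂ : ∀ {A : Set} {r} (y : Vec A r) i j a b p → lookup (y [ i , j ]≔₂ (a , b)) p ≡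
            (if does (p Fin.≟ j) then b else if does (p Fin.≟ i) then a else lookup y p)
lookup-≔₂ y i j a b p with p Fin.≟ j
... | yes refl = Vec.lookup∘update j (y [ i ]≔ a) b
... | no p≢j with p Fin.≟ i
...   | yes refl = trans (Vec.lookup∘update′ p≢j (y [ i ]≔ a) b) (Vec.lookup∘update i y a)
...   | no p≢i = trans (Vec.lookup∘update′ p≢j (y [ i ]≔ a) b) (Vec.lookup∘update′ p≢i y a)

map-≔₂ : ∀ {A B : Set} {r} (f : A → B) (y : Vec A r) i j a b →
         Vec.map f (y [ i , j ]≔₂ (a , b)) ≡ Vec.map f y [ i , j ]≔₂ (f a , f b)
map-≔₂ f y i j a b = trans (Vec.map-[]≔ f (y [ i ]≔ a) j) (cong (_[ j ]≔ f b) (Vec.map-[]≔ f y i))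

-- The hypotheses on the pair itself are guarded by its positions: for adjacencies the value is
-- known to agree there, for colours these positions are excluded because the pair is overwritten.
≔₂-cong : ∀ {A V : Set} {r} (D : A → A → V) (y : Vec A r) {i j : Fin r} {a b a′ b′} → i ≢ j →
  (∀ x y → D x x ≡ D y y) →
  (∀ l → D a (lookup y l) ≡ D a′ (lookup y l)) → (∀ l → D (lookup y l) a ≡ D (lookup y l) a′) →
  (∀ l → D b (lookup y l) ≡ D b′ (lookup y l)) → (∀ l → D (lookup y l) b ≡ D (lookup y l) b′) →
  ∀ p q → (p ≡ i → q ≡ j → D a b ≡ D a′ b′) → (p ≡ j → q ≡ i → D b a ≡ D b′ a′) →
  D (lookup (y [ i , j ]≔₂ (a , b)) p) (lookup (y [ i , j ]≔₂ (a , b)) q) ≡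
  D (lookup (y [ i , j ]≔₂ (a′ , b′)) p) (lookup (y [ i , j ]≔₂ (a′ , b′)) q)
≔₂-cong D y {i} {j} {a} {b} {a′} {b′} i≢j diag al ar bl br p q eij eji
  rewrite lookup-≔₂ y i j a b p | lookup-≔₂ y i j a b q | lookup-≔₂ y i j a′ b′ p | lookup-≔₂ y i j a′ b′ q
  with p Fin.≟ j | q Fin.≟ j
... | yes _ | yes _ = diag b b′
... | yes p≡j | no _ with q Fin.≟ i
...   | yes q≡i = eji p≡j q≡i
...   | no _ = bl q
≔₂-cong D y {i} {j} i≢j diag al ar bl br p q eij eji | no _ | yes q≡j with p Fin.≟ i
...   | yes p≡i = eij p≡i q≡j
...   | no _ = br p
≔₂-cong D y {i} {j} {a} {b} {a′} {b′} i≢j diag al ar bl br p q eij eji | no _ | no _ with p Fin.≟ i | q Fin.≟ i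
...   | yes _ | yes _ = diag a a′
...   | yes _ | no _ = al q
...   | no _ | yes _ = ar p
...   | no _ | no _ = refl

setPair : ∀ {A : Set} {r} → Fin r × Fin r → A × A → (Fin r → Fin r → A) → Fin r → Fin r → A
setPair (i , j) (c , c′) C p q =
  if does (Product.≡-dec Fin._≟_ Fin._≟_ (p , q) (i , j)) then c
  else if does (Product.≡-dec Fin._≟_ Fin._≟_ (p , q) (j , i)) then c′ else C p q

data SetPairView {A : Set} {r} (i j : Fin r) (c : A × A) (p q : Fin r) : Set where
  forward  : p ≡ i → q ≡ j → (∀ C → setPair (i , j) c C p q ≡ proj₁ c) → SetPairView i j c p q
  backward : p ≡ j → q ≡ i → (∀ C → setPair (i , j) c C p q ≡ proj₂ c) → SetPairView i j c p q
  outside  : (p , q) ≢ (i , j) → (p , q) ≢ (j , i) → (∀ C → setPair (i , j) c C p q ≡ C p q) → SetPairView i j c p q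

setPair-view : ∀ {A : Set} {r} (i j : Fin r) (c : A × A) p q → SetPairView i j c p q
setPair-view i j c p q with Product.≡-dec Fin._≟_ Fin._≟_ (p , q) (i , j) in e₁
... | yes refl = forward refl refl λ C → lem C
  where lem : ∀ C → setPair (i , j) c C i j ≡ proj₁ c
        lem C rewrite e₁ = refl
... | no n₁ with Product.≡-dec Fin._≟_ Fin._≟_ (p , q) (j , i) in e₂
...   | yes refl = backward refl refl λ C → lem C
  where lem : ∀ C → setPair (i , j) c C j i ≡ proj₂ c
        lem C rewrite e₁ | e₂ = refl
...   | no n₂ = outside n₁ n₂ λ C → lem C
  where lem : ∀ C → setPair (i , j) c C p q ≡ C p q
        lem C rewrite e₁ | e₂ = refl

-- Equality of digraphs proper: the diagonal holds no edge, and an invariant parameter respects this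
-- relation by way of the identity permutation.
_≈_ : ∀ {A : Set} {r} → (Fin r → Fin r → A) → (Fin r → Fin r → A) → Set
C ≈ C′ = ∀ p q → p ≢ q → C p q ≡ C′ p q

setPair-cong : ∀ {A : Set} {r} (ij : Fin r × Fin r) (c : A × A) {C C′} →
  (∀ p q → p ≢ q → (p , q) ≢ ij → (q , p) ≢ ij → C p q ≡ C′ p q) → setPair ij c C ≈ setPair ij c C′
setPair-cong (i , j) c {C} {C′} h p q p≢q with setPair-view i j c p q
... | forward _ _ e = trans (e C) (sym (e C′))
... | backward _ _ e = trans (e C) (sym (e C′))
... | outside n₁ n₂ e = trans (e C) (trans (h p q p≢q n₁ (λ { refl → n₂ refl })) (sym (e C′)))

setPair-self : ∀ {A : Set} {r} (i j : Fin r) (C : Fin r → Fin r → A) → setPair (i , j) (C i j , C j i) C ≈ C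
setPair-self i j C p q _ with setPair-view i j (C i j , C j i) p q
... | forward refl refl e = e C
... | backward refl refl e = e C
... | outside _ _ e = e C

-- Redrawing colours one pair at a time

module PairColours (ℝ : RealField) where
  open Resampling ℝ public

  abstract
    -- The list is `cartesianProduct` of `allFin` with itself, its head split off as `uniform`
    -- expects.
    uniformPair : ∀ n → Dist (Fin (suc n) × Fin (suc n))
    uniformPair n = uniform (zero , zero) (List.map (zero ,_) (tabulate suc) List.++ cartesianProduct (tabulate suc) (allFin (suc n)))

    conditionalPair : ∀ n {P : Fin (suc n) × Fin (suc n) → Set} → (∀ ab → Dec (P ab)) → Dist (Fin (suc n) × Fin (suc n))
    conditionalPair n P? = conditional (zero , zero) (List.map (zero ,_) (tabulate suc) List.++ cartesianProduct (tabulate suc) (allFin (suc n))) P?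

    conditionalPair-correct : ∀ n {P : Fin (suc n) × Fin (suc n) → Set} (P? : ∀ ab → Dec (P ab)) {ab} → P ab →
      IsConditional (uniformPair n) P? (conditionalPair n P?)
    conditionalPair-correct n P? {a , b} p =
      conditional-correct (zero , zero) _ P? (∈-cartesianProduct⁺ (∈-allFin a) (∈-allFin b)) p

    conditionalPair-empty : ∀ n {P : Fin (suc n) × Fin (suc n) → Set} (P? : ∀ ab → Dec (P ab)) → (∀ ab → ¬ P ab) →
      conditionalPair n P? ≡ uniformPair n
    conditionalPair-empty n P? = conditional-empty (zero , zero) _ P?

    uniformPair-E : ∀ n f → E (uniformPair n) f ≡ E (uniformFin n) (λ a → E (uniformFin n) (λ b → f (a , b)))
    uniformPair-E n f = begin
      E (uniformPair n) f
        ≡⟨ uniform-E _ _ f ⟩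
      ∑ (cartesianProduct (allFin (suc n)) (allFin (suc n))) f * fromℕ (length (cartesianProduct (allFin (suc n)) (allFin (suc n)))) ⁻¹
        ≡⟨ cong₂ _*_ (∑-cartesian (allFin (suc n)) (allFin (suc n)) f)
             (cong _⁻¹ len) ⟩
      S * (fromℕ N * fromℕ N) ⁻¹
        ≡⟨ cong (S *_) (⁻¹-* Npos Npos) ⟩
      S * (fromℕ N ⁻¹ * fromℕ N ⁻¹)
        ≡⟨ sym (*-assoc _ _ _) ⟩
      S * fromℕ N ⁻¹ * fromℕ N ⁻¹
        ≡⟨ cong (_* fromℕ N ⁻¹) (sym (Linear.scaleʳ (∑-linear (allFin (suc n))) (fromℕ N ⁻¹) _)) ⟩
      ∑ (allFin (suc n)) (λ a → ∑ (allFin (suc n)) (λ b → f (a , b)) * fromℕ N ⁻¹) * fromℕ N ⁻¹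
        ≡⟨ sym (trans (uniform-E _ _ _) (cong (_* fromℕ N ⁻¹) (Linear.ext (∑-linear (allFin (suc n))) (λ a → uniform-E _ _ _)))) ⟩
      E (uniformFin n) (λ a → E (uniformFin n) (λ b → f (a , b))) ∎
      where
      open ≡-Reasoning
      N : ℕ
      N = length (allFin (suc n))
      S : R
      S = ∑ (allFin (suc n)) (λ a → ∑ (allFin (suc n)) (λ b → f (a , b)))
      Npos : 0# < fromℕ N
      Npos = fromℕ-pos {N} (ℕ.s≤s ℕ.z≤n)
      P : List (Fin (suc n) × Fin (suc n))
      P = cartesianProduct (allFin (suc n)) (allFin (suc n))
      len : fromℕ (length P) ≡ fromℕ N * fromℕ N
      len = begin
        fromℕ (length P)          ≡⟨ sym (trans (∑-const P 1#) (*-identityʳ _)) ⟩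
        ∑ P (λ _ → 1#)            ≡⟨ ∑-cartesian (allFin (suc n)) (allFin (suc n)) (λ _ → 1#) ⟩
        ∑ (allFin (suc n)) (λ _ → ∑ (allFin (suc n)) (λ _ → 1#))
          ≡⟨ trans (∑-const (allFin (suc n)) _) (cong (fromℕ N *_) (trans (∑-const (allFin (suc n)) 1#) (*-identityʳ _))) ⟩
        fromℕ N * fromℕ N ∎

  uniformPair-swap : ∀ n f → E (uniformPair n) f ≡ E (uniformPair n) (f ∘ swap)
  uniformPair-swap n f = trans (uniformPair-E n f) (trans (Dist.fubini (uniformFin n) (Dist.linear (uniformFin n)) _)
    (sym (uniformPair-E n (f ∘ swap))))

  -- The uniform law on pairs is symmetric, so conditioning on mirrored events gives mirrored laws.
  -- The fallback for an empty event has to be checked separately. Later one draw serves both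
  -- orientations of a pair, and this makes the choice of orientation immaterial.
  conditionalPair-swap : ∀ n {P Q : Fin (suc n) × Fin (suc n) → Set} (P? : ∀ ab → Dec (P ab)) (Q? : ∀ ab → Dec (Q ab)) →
    (∀ ab → P ab → Q (swap ab)) → (∀ ab → Q ab → P (swap ab)) →
    ∀ f → E (conditionalPair n P?) f ≡ E (conditionalPair n Q?) (f ∘ swap)
  conditionalPair-swap n P? Q? pq qp f with Fin.any? (λ a → Fin.any? (λ b → P? (a , b)))
  ... | no none = trans (cong (λ K → E K f) (conditionalPair-empty n P? (λ (a , b) p → none (a , b , p))))
          (trans (uniformPair-swap n f)
            (cong (λ K → E K (f ∘ swap)) (sym (conditionalPair-empty n Q? (λ (a , b) q → none (b , a , qp (a , b) q))))))
  ... | yes (a , b , p) = trans (sym (*⁻¹-cancelʳ _ C.pos)) (trans (cong₂ (λ x y → x * y ⁻¹)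
          (trans (C.expect f) (trans (uniformPair-swap n _) (trans (Dist.ext Ω (λ ab → cong (_* f (swap ab)) (ind ab))) (sym (D.expect (f ∘ swap))))))
          (trans (uniformPair-swap n _) (Dist.ext Ω ind))) (*⁻¹-cancelʳ _ D.pos))
    where
    Ω = uniformPair n
    module C = IsConditional (conditionalPair-correct n P? p)
    module D = IsConditional (conditionalPair-correct n Q? (pq (a , b) p))
    ind : ∀ ab → 𝟙 (P? (swap ab)) ≡ 𝟙 (Q? ab)
    ind ab = 𝟙-cong (P? (swap ab)) (Q? ab) (pq (swap ab)) (qp ab)

  module Recolour {n k : ℕ} (m : ℕ) (H : Graph (suc n)) (J : ColDigraph k (suc n)) (low high : Fin k)
    (shadow : ∀ a b → (isLow m (J a b) ∨ isLow m (J b a)) ≡ adj H a b) (J-diag : ∀ a b → J a a ≡ J b b) (r : ℕ) where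

    U = uniformFin n

    colours : Fin (suc n) → Fin (suc n) → Fin k × Fin k
    colours a b = J a b , J b a

    label : ∀ {q} → Vec (Fin (suc n)) q → Fin (suc n) → Vec (Fin k × Fin k) q
    label z a = Vec.map (colours a) z

    PairCode : ℕ → Set
    PairCode q = Vec (Fin k × Fin k) q × Vec (Fin k × Fin k) q × Bool

    code : ∀ {q} → Vec (Fin (suc n)) q → Fin (suc n) × Fin (suc n) → PairCode q
    code z (a , b) = label z a , label z b , adj H a b

    _≟Pair_ : ∀ {q} → DecidableEquality (PairCode q)
    _≟Pair_ = Product.≡-dec ≟V (Product.≡-dec ≟V Bool._≟_)
      where ≟V = Vec.≡-dec (Product.≡-dec Fin._≟_ Fin._≟_)

    pairKernel : ∀ {q} → Vec (Fin (suc n)) q → PairCode q → Dist (Fin (suc n) × Fin (suc n))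
    pairKernel z c = conditionalPair n (λ ab → code z ab ≟Pair c)

    pairConditioning : ∀ {q} (z : Vec (Fin (suc n)) q) → Conditioning (uniformPair n) (code z)
    pairConditioning z = record { _≟C_ = _≟Pair_ ; K = pairKernel z
      ; isConditional = λ ab → conditionalPair-correct n _ {ab} refl }

    colourIndex : Fin (suc n) × Fin (suc n) → Fin (k ℕ.* k)
    colourIndex (a , b) = Fin.combine (J a b) (J b a)

    pairEnergy : ∀ {q} → Vec (Fin (suc n)) q → R
    pairEnergy z = energy colourIndex (pairConditioning z)

    default : Bool → Fin k × Fin k
    default true  = low , low
    default false = high , high

    -- Corrected so that every draw, even from a fallback distribution, has shadow e.
    colour : Bool → Fin (suc n) × Fin (suc n) → Fin k × Fin k
    colour e (a , b) = if does (adj H a b Bool.≟ e) then colours a b else default e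

    module _ (g : ColDigraph k r → R) (g-cong : ∀ {C C′} → C ≈ C′ → g C ≡ g C′)
             (g≥0 : ∀ C → 0# ≤ g C) (g≤1 : ∀ C → g C ≤ 1#) {q : ℕ} (z : Vec (Fin (suc n)) q) where

      recolour : List (Fin r × Fin r) → Vec (Vec (Fin k × Fin k) q) r → Matrix r → ColDigraph k r → R
      recolour is ζ M C = resample (λ (i , j) → pairKernel z (lookup ζ i , lookup ζ j , entry M i j))
        (λ (i , j) ab C → setPair (i , j) (colour (entry M i j) ab) C) g is C

      recolour-cong : ∀ is ζ M {C C′} → C ≈ C′ → recolour is ζ M C ≡ recolour is ζ M C′
      recolour-cong is ζ M = resample-rel (λ C _ C′ → C ≈ C′)
        (λ {_} {_} {ij} h ab → setPair-cong ij _ (λ p q p≢q _ _ → h p q p≢q)) g-cong is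

      -- Listed pairs are overwritten before `g` is evaluated, so the starting colours count only at
      -- uncovered pairs. With all pairs listed the process can start from any colouring.
      recolour-cover : ∀ is ζ M {C C′} → (∀ p q → p ≢ q → (p , q) ∈ is ⊎ (q , p) ∈ is ⊎ C p q ≡ C′ p q) →
                       recolour is ζ M C ≡ recolour is ζ M C′
      recolour-cover is ζ M = resample-rel
        (λ C is C′ → ∀ p q → p ≢ q → (p , q) ∈ is ⊎ (q , p) ∈ is ⊎ C p q ≡ C′ p q) step
        (λ h → g-cong (λ p q p≢q → done (h p q p≢q))) is
        where
        done : ∀ {p q : Fin r} {X : Set} → (p , q) ∈ [] ⊎ (q , p) ∈ [] ⊎ X → X
        done (inj₂ (inj₂ x)) = x
        step : ∀ {C C′ : ColDigraph k r} {ij is} →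
          (∀ p q → p ≢ q → (p , q) ∈ (ij ∷ is) ⊎ (q , p) ∈ (ij ∷ is) ⊎ C p q ≡ C′ p q) →
          ∀ ab p q → p ≢ q → (p , q) ∈ is ⊎ (q , p) ∈ is ⊎
            setPair ij (colour (entry M (proj₁ ij) (proj₂ ij)) ab) C p q ≡ setPair ij (colour (entry M (proj₁ ij) (proj₂ ij)) ab) C′ p q
        step {C} {C′} {i , j} h ab p q p≢q with setPair-view i j (colour (entry M i j) ab) p q
        ... | forward _ _ e = inj₂ (inj₂ (trans (e C) (sym (e C′))))
        ... | backward _ _ e = inj₂ (inj₂ (trans (e C) (sym (e C′))))
        ... | outside n₁ n₂ e with h p q p≢q
        ...   | inj₁ (here refl) = ⊥-elim (n₁ refl)
        ...   | inj₁ (there x) = inj₁ x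
        ...   | inj₂ (inj₁ (here refl)) = ⊥-elim (n₂ refl)
        ...   | inj₂ (inj₁ (there x)) = inj₂ (inj₁ x)
        ...   | inj₂ (inj₂ x) = inj₂ (inj₂ (trans (e C) (trans x (sym (e C′)))))

      restrict : Vec (Fin (suc n)) r → ColDigraph k r
      restrict y i j = J (lookup y i) (lookup y j)

      recolourAt : List (Fin r × Fin r) → Vec (Fin (suc n)) r → R
      recolourAt is y = recolour is (Vec.map (label z) y) (matrix (adj H) y) (restrict y)

      module _ (i j : Fin r) (i≢j : i ≢ j) (is : List (Fin r × Fin r)) where

        private
          u : Vec (Fin (suc n)) r → Fin (k ℕ.* k) → Fin (suc n) × Fin (suc n) → R
          u y κ ab = recolour is (Vec.map (label z) y′) (matrix (adj H) y′) (setPair (i , j) (Fin.remQuot k κ) (restrict y′))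
            where y′ = y [ i , j ]≔₂ ab

          -- The shadow is a function of the two colours of a pair, so labels towards `y` determine
          -- the adjacencies to `y` as well.
          H-from-colours : ∀ {a b a′ b′} → colours a b ≡ colours a′ b′ → adj H a b ≡ adj H a′ b′
          H-from-colours {a} {b} {a′} {b′} e = trans (sym (shadow a b)) (trans
            (cong (λ c → isLow m (proj₁ c) ∨ isLow m (proj₂ c)) e) (shadow a′ b′))

          u-inv : ∀ y κ ab ab′ → code (y Vec.++ z) ab ≡ code (y Vec.++ z) ab′ → u y κ ab ≡ u y κ ab′
          u-inv y κ (a , b) (a′ , b′) e = trans
              (cong₂ (λ ζ M → recolour is ζ M (setPair (i , j) (Fin.remQuot k κ) (restrict (y [ i , j ]≔₂ (a , b)))))
                (trans (map-≔₂ (label z) y i j a b) (trans (cong₂ (λ s t → Vec.map (label z) y [ i , j ]≔₂ (s , t)) (proj₂ ea) (proj₂ eb))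
                  (sym (map-≔₂ (label z) y i j a′ b′))))
                (matrix-cong (adj H) (adj H) (y [ i , j ]≔₂ (a , b)) (y [ i , j ]≔₂ (a′ , b′)) (λ p q →
                  ≔₂-cong (adj H) y i≢j (λ x y → trans (Graph.irrefl H x) (sym (Graph.irrefl H y)))
                    (λ l → H-from-colours (la l)) (λ l → H-from-colours (flip (la l)))
                    (λ l → H-from-colours (lb l)) (λ l → H-from-colours (flip (lb l)))
                    p q (λ _ _ → eH) (λ _ _ → trans (Graph.sym H b a) (trans eH (Graph.sym H a′ b′))))))
              (recolour-cong is (Vec.map (label z) (y [ i , j ]≔₂ (a′ , b′))) (matrix (adj H) (y [ i , j ]≔₂ (a′ , b′))) (setPair-cong (i , j) (Fin.remQuot k κ) (λ p q p≢q n₁ n₂ →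
                ≔₂-cong J y i≢j J-diag
                    (λ l → cong proj₁ (la l)) (λ l → cong proj₂ (la l))
                    (λ l → cong proj₁ (lb l)) (λ l → cong proj₂ (lb l))
                    p q (λ { refl refl → ⊥-elim (n₁ refl) }) (λ { refl refl → ⊥-elim (n₂ refl) }))))
            where
            flip : ∀ {a b a′ b′} → colours a b ≡ colours a′ b′ → colours b a ≡ colours b′ a′
            flip e = cong₂ _,_ (cong proj₂ e) (cong proj₁ e)
            ea = map-++-≡⇒ y z (cong proj₁ e)
            eb = map-++-≡⇒ y z (cong (λ t → proj₁ (proj₂ t)) e)
            eH = cong (λ t → proj₂ (proj₂ t)) e
            la = map-≡⇒ y (proj₁ ea)
            lb = map-≡⇒ y (proj₁ eb)

          lookup-i : ∀ (y : Vec (Fin (suc n)) r) a b → lookup (y [ i , j ]≔₂ (a , b)) i ≡ a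
          lookup-i y a b = trans (Vec.lookup∘update′ i≢j (y [ i ]≔ a) b) (Vec.lookup∘update i y a)

          lookup-j : ∀ (y : Vec (Fin (suc n)) r) a b → lookup (y [ i , j ]≔₂ (a , b)) j ≡ b
          lookup-j y a b = Vec.lookup∘update j (y [ i ]≔ a) b

          colour-same : ∀ e ab → proj₂ (proj₂ (code z ab)) ≡ e → colour e ab ≡ Fin.remQuot k (colourIndex ab)
          colour-same e (a , b) h with adj H a b Bool.≟ e
          ... | yes _ = sym (Fin.remQuot-combine (J a b) (J b a))
          ... | no n = ⊥-elim (n h)

          before : ∀ y ab → recolourAt ((i , j) ∷ is) (y [ i , j ]≔₂ ab) ≡ cond (pairConditioning z) (λ ab′ → u y (colourIndex ab′) ab) ab
          before y (a , b) = trans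
            (cong (λ c → E (pairKernel z c) (λ ab′ → recolour is ζ M (setPair (i , j) (colour (proj₂ (proj₂ c)) ab′) (restrict y′)))) codes)
            -- This code occurs, so its conditional law is carried by pairs of the same adjacency,
            -- on which `colour` corrects nothing.
            (IsConditional.local (Conditioning.isConditional (pairConditioning z) (a , b)) (λ ab′ e →
              cong (λ c → recolour is ζ M (setPair (i , j) c (restrict y′))) (colour-same (adj H a b) ab′ (cong (λ t → proj₂ (proj₂ t)) e))))
            where
            y′ = y [ i , j ]≔₂ (a , b)
            ζ = Vec.map (label z) y′
            M = matrix (adj H) y′
            codes : (lookup ζ i , lookup ζ j , entry M i j) ≡ code z (a , b)
            codes = cong₂ _,_ (trans (Vec.lookup-map i (label z) y′) (cong (label z) (lookup-i y a b)))
              (cong₂ _,_ (trans (Vec.lookup-map j (label z) y′) (cong (label z) (lookup-j y a b)))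
                (trans (entry-matrix (adj H) y′ i j) (cong₂ (adj H) (lookup-i y a b) (lookup-j y a b))))

          after : ∀ y ab → recolourAt is (y [ i , j ]≔₂ ab) ≡ u y (colourIndex ab) ab
          after y (a , b) = recolour-cong is (Vec.map (label z) y′) (matrix (adj H) y′) (λ p q p≢q → sym (trans
            (cong (λ c → setPair (i , j) c (restrict y′) p q) (trans (Fin.remQuot-combine (J a b) (J b a))
              (cong₂ _,_ (sym (cong₂ J (lookup-i y a b) (lookup-j y a b))) (sym (cong₂ J (lookup-j y a b) (lookup-i y a b))))))
            (setPair-self i j (restrict y′) p q p≢q)))
            where y′ = y [ i , j ]≔₂ (a , b)

          resample₂ : ∀ F → E (vec U r) F ≡ E (vec U r) (λ y → E (uniformPair n) (λ ab → F (y [ i , j ]≔₂ ab)))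
          resample₂ F = trans (product-resample (λ _ → U) j F) (trans (product-resample (λ _ → U) i (λ y → E U (λ b → F (y [ j ]≔ b))))
            (Dist.ext (vec U r) (λ y → sym (uniformPair-E n (λ ab → F (y [ i , j ]≔₂ ab))))))

        -- The pair at positions `i` and `j` is isolated as `(a , b)`. Its own colours are the label
        -- to be redrawn; all else depends on the colours of either end towards `y` and `z` and on
        -- the adjacency of the pair, which the code over `y ++ z` records.
        recolour-step : ∀ {l} → 0# < l →
          ∣ E (vec U r) (recolourAt ((i , j) ∷ is)) - E (vec U r) (recolourAt is) ∣ ≤
          fromℕ (k ℕ.* k) * l + (E (vec U r) (λ y → pairEnergy (y Vec.++ z)) - pairEnergy z) * l ⁻¹
        recolour-step {l} l>0 =
          subst₂ (λ x y → ∣ x - y ∣ ≤ _) (sym (resample₂ (recolourAt ((i , j) ∷ is)))) (sym (resample₂ (recolourAt is)))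
            (≤-trans (Dist.∣E-E∣≤E (vec U r) at)
              (≤-reflexive (trans (Dist.add (vec U r) _ _) (cong₂ _+_ (Dist.const (vec U r) _)
                (trans (Dist.scaleʳ (vec U r) _ _) (cong (_* l ⁻¹)
                  (trans (Dist.sub (vec U r) _ _) (cong (λ t → E (vec U r) (λ y → pairEnergy (y Vec.++ z)) - t) (Dist.const (vec U r) _)))))))))
          where
          at : ∀ y → ∣ E (uniformPair n) (λ ab → recolourAt ((i , j) ∷ is) (y [ i , j ]≔₂ ab)) - E (uniformPair n) (λ ab → recolourAt is (y [ i , j ]≔₂ ab)) ∣ ≤
               fromℕ (k ℕ.* k) * l + (pairEnergy (y Vec.++ z) - pairEnergy z) * l ⁻¹
          at y = subst₂ (λ x w → ∣ x - w ∣ ≤ _) (sym (Dist.ext (uniformPair n) (before y))) (sym (Dist.ext (uniformPair n) (after y)))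
            (Refinement.replacement (pairConditioning z) (pairConditioning (y Vec.++ z))
              (λ (a , b) (a′ , b′) e → cong₂ _,_ (proj₂ (map-++-≡⇒ y z (cong proj₁ e)))
                 (cong₂ _,_ (proj₂ (map-++-≡⇒ y z (cong (λ t → proj₁ (proj₂ t)) e))) (cong (λ t → proj₂ (proj₂ t)) e)))
              colourIndex (u y) (u-inv y) (λ κ ab → resample≥ g≥0 is _) (λ κ ab → resample≤ g≤1 is _) l>0)

      recolour-bound : ∀ is → All (λ (i , j) → i ≢ j) is → ∀ {l} → 0# < l →
        ∣ E (vec U r) (recolourAt is) - E (vec U r) (recolourAt []) ∣ ≤
        fromℕ (length is) * (fromℕ (k ℕ.* k) * l + (E (vec U r) (λ y → pairEnergy (y Vec.++ z)) - pairEnergy z) * l ⁻¹)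
      recolour-bound is distinct l>0 = telescope (λ is → E (vec U r) (recolourAt is)) (λ (i , j) is i≢j → recolour-step i j i≢j is l>0) is distinct

-- Distinct tuples and unordered pairs of positions

unique? : ∀ {n t} (y : Vec (Fin n) t) → Dec (Unique y)
unique? = allPairs? (λ i j → ¬? (i Fin.≟ j))

pairs : ∀ r → List (Fin r × Fin r)
pairs r = filter (uncurry Fin._<?_) (cartesianProduct (allFin r) (allFin r))

pairs-< : ∀ r → All (λ (i , j) → i Fin.< j) (pairs r)
pairs-< r = all-filter (uncurry Fin._<?_) (cartesianProduct (allFin r) (allFin r))

pairs-unique : ∀ r → List.Unique (pairs r)
pairs-unique r = Unique.filter⁺ _ (Unique.cartesianProduct⁺ (Unique.allFin⁺ r) (Unique.allFin⁺ r))

pairs-cover : ∀ r (i j : Fin r) → i ≢ j → (i , j) ∈ pairs r ⊎ (j , i) ∈ pairs r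
pairs-cover r i j i≢j with Fin.<-cmp i j
... | tri< i<j _ _ = inj₁ (∈-filter⁺ (uncurry Fin._<?_) (∈-cartesianProduct⁺ (∈-allFin i) (∈-allFin j)) i<j)
... | tri≈ _ i≡j _ = ⊥-elim (i≢j i≡j)
... | tri> _ _ j<i = inj₂ (∈-filter⁺ (uncurry Fin._<?_) (∈-cartesianProduct⁺ (∈-allFin j) (∈-allFin i)) j<i)

foldl-≔ : ∀ {A : Set} {r} (f : Fin r → A) is (ζ : Vec A r) i → i ∈ is ⊎ lookup ζ i ≡ f i →
          lookup (foldl (λ ζ i → ζ [ i ]≔ f i) ζ is) i ≡ f i
foldl-≔ f [] ζ i (inj₂ e) = e
foldl-≔ f (j ∷ is) ζ i h with i Fin.≟ j
... | yes refl = foldl-≔ f is _ i (inj₂ (Vec.lookup∘update i ζ (f i)))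
... | no i≢j = foldl-≔ f is _ i (next h)
  where
  next : i ∈ (j ∷ is) ⊎ lookup ζ i ≡ f i → i ∈ is ⊎ lookup (ζ [ j ]≔ f j) i ≡ f i
  next (inj₁ (here e)) = ⊥-elim (i≢j e)
  next (inj₁ (there x)) = inj₁ x
  next (inj₂ e) = inj₂ (trans (Vec.lookup∘update′ i≢j ζ (f j)) e)

foldl-setPair : ∀ {A : Set} {r} (D : Fin r → Fin r → A) (c : Fin r × Fin r → A × A) →
  (∀ i j → i Fin.< j → c (i , j) ≡ (D i j , D j i)) → ∀ is → All (λ (i , j) → i Fin.< j) is → ∀ C p q →
  (p , q) ∈ is ⊎ (q , p) ∈ is ⊎ C p q ≡ D p q → foldl (λ C ij → setPair ij (c ij) C) C is p q ≡ D p q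
foldl-setPair D c h [] _ C p q (inj₂ (inj₂ e)) = e
foldl-setPair D c h ((i , j) ∷ is) (i<j ∷ <s) C p q x =
  foldl-setPair D c h is <s (setPair (i , j) (c (i , j)) C) p q (next x)
  where
  next : (p , q) ∈ ((i , j) ∷ is) ⊎ (q , p) ∈ ((i , j) ∷ is) ⊎ C p q ≡ D p q →
         (p , q) ∈ is ⊎ (q , p) ∈ is ⊎ setPair (i , j) (c (i , j)) C p q ≡ D p q
  next x with setPair-view i j (c (i , j)) p q
  ... | forward refl refl e = inj₂ (inj₂ (trans (e C) (cong proj₁ (h i j i<j))))
  ... | backward refl refl e = inj₂ (inj₂ (trans (e C) (cong proj₂ (h i j i<j))))
  ... | outside n₁ n₂ e with x
  ...   | inj₁ (here refl) = ⊥-elim (n₁ refl)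
  ...   | inj₁ (there y) = inj₁ y
  ...   | inj₂ (inj₁ (here refl)) = ⊥-elim (n₂ refl)
  ...   | inj₂ (inj₁ (there y)) = inj₂ (inj₁ y)
  ...   | inj₂ (inj₂ y) = inj₂ (inj₂ (trans (e C) y))

-- From random draws to one colouring of the large graph

module Lifting (ℝ : RealField) where
  open PairColours ℝ public

  collision : ∀ {N r} → Dist (Vec (Fin N) r) → R
  collision μ = E μ (λ v → 1# - 𝟙 (unique? v))

  -- Exchange the expectations over assignments and tuples, and keep an assignment at least as good
  -- as the average. A tuple with a repeated vertex would read the same draw twice, so nothing is
  -- claimed there and the full range of `f` is charged.
  derandomise : ∀ {Bt : Set} {N r} (𝔅 : Dist Bt) (μ : Dist (Vec (Fin N) r)) (F : Bt → Vec (Fin N) r → R) f →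
    (∀ β v → 0# ≤ F β v) → (∀ v → f v ≤ 1#) → (∀ v → Unique v → E 𝔅 (λ β → F β v) ≡ f v) →
    ∃ λ β → E μ f ≤ E μ (F β) + collision μ
  derandomise 𝔅 μ F f F≥0 f≤1 h with Dist.attain 𝔅 (λ β → E μ (F β))
  ... | β , p = β , ≤-trans (Dist.mono μ at) (≤-trans (≤-reflexive (Dist.add μ _ _))
          (+-mono (≤-trans (≤-reflexive (sym (Dist.fubini 𝔅 (Dist.linear μ) F))) p) ≤-refl))
    where
    at : ∀ v → f v ≤ E 𝔅 (λ β → F β v) + (1# - 𝟙 (unique? v))
    at v with unique? v
    ... | yes u = ≤-reflexive (trans (sym (h v u)) (solve 1 (λ x → x := x :+ (:1 :- :1)) refl _))
    ... | no _ = ≤-trans (f≤1 v) (≤-by (Dist.const≤ 𝔅 (λ β → F≥0 β v)) (solve 1 (λ x → x :+ (:1 :- :0) := :1 :+ x) refl _))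

  module LiftLabels {n} (H : Graph (suc n)) {T} (ℓ : Fin (suc n) → Fin T) {r}
    (val : Vec (Fin T) r → Matrix r → R) (val≥0 : ∀ ζ M → 0# ≤ val ζ M) (val≤1 : ∀ ζ M → val ζ M ≤ 1#)
    {q} (w : Vec (Fin (suc n)) q) {N} (G : Graph N) (τ : Fin N → Vec Bool q) where

    open Labels H ℓ r

    -- Every vertex of `G` receives one draw of a vertex of `H`, from the kernel selected by its
    -- type `τ`. Distinct vertices read distinct draws, so `realize` recovers the relabelling
    -- process, and the labels of the best assignment form `ρ`.
    lift-labels : (μ : Dist (Vec (Fin N) r)) (ζ₀ : Vec (Fin T) r) → ∃ λ (ρ : Fin N → Fin T) →
      E μ (λ v → relabel val val≥0 val≤1 w (allFin r) (Vec.map τ v) (matrix (adj G) v) ζ₀) ≤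
      E μ (λ v → val (Vec.map ρ v) (matrix (adj G) v)) + collision μ
    lift-labels μ ζ₀ with derandomise (product (λ v → typeKernel w (τ v))) μ
        (λ β v → val (Vec.map (ℓ ∘ lookup β) v) (matrix (adj G) v)) _
        (λ β v → val≥0 _ _) (λ v → resample≤ (λ ζ → val≤1 ζ (matrix (adj G) v)) (allFin r) ζ₀) unbiased
      where
      unbiased : ∀ v → Unique v → E (product (λ v → typeKernel w (τ v))) (λ β → val (Vec.map (ℓ ∘ lookup β) v) (matrix (adj G) v)) ≡
        relabel val val≥0 val≤1 w (allFin r) (Vec.map τ v) (matrix (adj G) v) ζ₀
      unbiased v u = trans (Dist.ext (product K) (λ β → cong (λ ζ → val ζ (matrix (adj G) v)) (vec-ext (λ i →
          trans (Vec.lookup-map i (ℓ ∘ lookup β) v) (sym (foldl-≔ (λ i → ℓ (lookup β (lookup v i))) (allFin r) ζ₀ i (inj₁ (∈-allFin i))))))))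
        (realize (product K) (λ β i → lookup β (lookup v i)) (λ β i b → β [ lookup v i ]≔ b) (λ _ → ℕ) _≢_
          (λ i _ F → trans (product-resample K (lookup v i) F) (Dist.ext (product K) (λ β →
             cong (λ t → E (typeKernel w t) (λ b → F (β [ lookup v i ]≔ b))) (sym (Vec.lookup-map i τ v)))))
          (λ β i b → Vec.lookup∘update (lookup v i) β b)
          (λ β i j b _ _ i≢j → Vec.lookup∘update′ (λ e → i≢j (VecUnique.lookup-injective u i j (sym e))) β b)
          (allFin r) (All.universal (λ _ → 0) (allFin r)) (Unique.allFin⁺ r) ζ₀)
        where
        K : Fin N → Dist (Fin (suc n))
        K v = typeKernel w (τ v)
    ... | β , p = ℓ ∘ lookup β , p

  module LiftColours {n k : ℕ} (m : ℕ) (H : Graph (suc n)) (J : ColDigraph k (suc n)) (low high : Fin k)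
    (shadow : ∀ a b → (isLow m (J a b) ∨ isLow m (J b a)) ≡ adj H a b) (J-diag : ∀ a b → J a a ≡ J b b)
    (low-low : isLow m low ≡ true) (high-high : isLow m high ≡ false) {r : ℕ}
    (g : ColDigraph k r → R) (g-cong : ∀ {C C′} → C ≈ C′ → g C ≡ g C′)
    (g≥0 : ∀ C → 0# ≤ g C) (g≤1 : ∀ C → g C ≤ 1#) {q} (z : Vec (Fin (suc n)) q)
    {N} (G : Graph N) (ρ : Fin N → Vec (Fin k × Fin k) q) where

    open Recolour m H J low high shadow J-diag r

    private
      B : Set
      B = Fin (suc n) × Fin (suc n)

    colour-swap : ∀ e ab → colour e (swap ab) ≡ swap (colour e ab)
    colour-swap e (a , b) rewrite Graph.sym H b a with adj H a b Bool.≟ e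
    ... | yes _ = refl
    colour-swap true (a , b) | no _ = refl
    colour-swap false (a , b) | no _ = refl

    colour-shadow : ∀ e ab → (isLow m (proj₁ (colour e ab)) ∨ isLow m (proj₂ (colour e ab))) ≡ e
    colour-shadow e (a , b) with adj H a b Bool.≟ e
    ... | yes h = trans (shadow a b) h
    colour-shadow true (a , b) | no _ rewrite low-low = refl
    colour-shadow false (a , b) | no _ rewrite high-high = refl

    pairKernel-swap : ∀ s t e f → E (pairKernel z (s , t , e)) f ≡ E (pairKernel z (t , s , e)) (f ∘ swap)
    pairKernel-swap s t e = conditionalPair-swap n _ _
      (λ (a , b) h → flip a b h) (λ (a , b) h → flip a b h)
      where
      flip : ∀ a b {s t e} → code z (a , b) ≡ (s , t , e) → code z (b , a) ≡ (t , s , e)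
      flip a b refl = cong (λ x → label z b , label z a , x) (Graph.sym H b a)

    kernel : Fin N × Fin N → Dist B
    kernel (u , v) = pairKernel z (ρ u , ρ v , adj G u v)

    𝔅 : Dist (Vec B (N ℕ.* N))
    𝔅 = product (λ x → kernel (Fin.remQuot N x))

    -- One draw per unordered pair, read in both directions.
    draw : Vec B (N ℕ.* N) → Fin N → Fin N → B
    draw β u v with u Fin.<? v
    ... | yes _ = lookup β (Fin.combine u v)
    ... | no _  = swap (lookup β (Fin.combine v u))

    redraw : Vec B (N ℕ.* N) → Fin N → Fin N → B → Vec B (N ℕ.* N)
    redraw β u v b with u Fin.<? v
    ... | yes _ = β [ Fin.combine u v ]≔ b
    ... | no _  = β [ Fin.combine v u ]≔ swap b

    draw-swap : ∀ β u v → u ≢ v → draw β v u ≡ swap (draw β u v)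
    draw-swap β u v u≢v with u Fin.<? v | v Fin.<? u
    ... | yes p | yes q = ⊥-elim (Fin.<-asym p q)
    ... | yes _ | no _ = refl
    ... | no _ | yes _ = refl
    ... | no p | no q with Fin.<-cmp u v
    ...   | tri< a _ _ = ⊥-elim (p a)
    ...   | tri≈ _ e _ = ⊥-elim (u≢v e)
    ...   | tri> _ _ c = ⊥-elim (q c)

    draw-redraw : ∀ β u v b → draw (redraw β u v b) u v ≡ b
    draw-redraw β u v b with u Fin.<? v
    ... | yes _ = Vec.lookup∘update (Fin.combine u v) β b
    ... | no _ = cong swap (Vec.lookup∘update (Fin.combine v u) β (swap b))

    draw-redraw′ : ∀ β u v u′ v′ b → (u′ , v′) ≢ (u , v) → (v′ , u′) ≢ (u , v) → draw (redraw β u v b) u′ v′ ≡ draw β u′ v′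
    draw-redraw′ β u v u′ v′ b n₁ n₂ with u Fin.<? v | u′ Fin.<? v′
    ... | yes _ | yes _ = Vec.lookup∘update′ (λ e → n₁ (uncurry (cong₂ _,_) (Fin.combine-injective _ _ _ _ e))) β b
    ... | yes _ | no _ = cong swap (Vec.lookup∘update′ (λ e → n₂ (uncurry (cong₂ _,_) (Fin.combine-injective _ _ _ _ e))) β b)
    ... | no _ | yes _ = Vec.lookup∘update′ (λ e → n₂ (cong swap (uncurry (cong₂ _,_) (Fin.combine-injective _ _ _ _ e)))) β (swap b)
    ... | no _ | no _ = cong swap (Vec.lookup∘update′ (λ e → n₁ (cong swap (uncurry (cong₂ _,_) (Fin.combine-injective _ _ _ _ e)))) β (swap b))

    -- If `u` does not precede `v`, the cell belongs to the reversed pair and holds a draw from the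
    -- mirrored law; `pairKernel-swap` and the symmetry of adjacency turn it back.
    redraw-law : ∀ u v F → E 𝔅 F ≡ E 𝔅 (λ β → E (kernel (u , v)) (λ b → F (redraw β u v b)))
    redraw-law u v F with u Fin.<? v
    ... | yes _ = trans (product-resample _ (Fin.combine u v) F) (Dist.ext 𝔅 (λ β →
            cong (λ uv → E (kernel uv) (λ b → F (β [ Fin.combine u v ]≔ b))) (Fin.remQuot-combine u v)))
    ... | no _ = trans (product-resample _ (Fin.combine v u) F) (Dist.ext 𝔅 (λ β → trans
            (cong (λ uv → E (kernel uv) (λ b → F (β [ Fin.combine v u ]≔ b))) (Fin.remQuot-combine v u))
            (trans (pairKernel-swap _ _ _ _) (cong (λ e → E (pairKernel z (ρ u , ρ v , e)) (λ b → F (β [ Fin.combine v u ]≔ swap b))) (Graph.sym G v u)))))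

    lifted : Vec B (N ℕ.* N) → ColDigraph k N
    lifted β u v with u Fin.≟ v
    ... | yes _ = high
    ... | no _ = proj₁ (colour (adj G u v) (draw β u v))

    -- The two orientations are coloured separately but consistently, because both the draw and its
    -- correction commute with `swap`.
    lifted-pair : ∀ β u v → u ≢ v → colour (adj G u v) (draw β u v) ≡ (lifted β u v , lifted β v u)
    lifted-pair β u v u≢v with u Fin.≟ v | v Fin.≟ u
    ... | yes e | _ = ⊥-elim (u≢v e)
    ... | no _ | yes e = ⊥-elim (u≢v (sym e))
    ... | no _ | no _ = cong (proj₁ (colour (adj G u v) (draw β u v)) ,_) (sym (trans
      (cong₂ (λ e d → proj₁ (colour e d)) (Graph.sym G v u) (draw-swap β u v u≢v)) (cong proj₁ (colour-swap (adj G u v) (draw β u v)))))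

    -- The correction in `colour` makes this hold for each assignment, so any good assignment may be
    -- kept.
    lifted-shadow : ∀ β → HasShadow m (lifted β) G
    lifted-shadow β u v with u Fin.≟ v in eq
    ... | yes refl = sym (Graph.irrefl G u)
    ... | no u≢v = trans (cong (λ c → isLow m (proj₁ (colour (adj G u v) (draw β u v))) ∨ isLow m c) (sym (cong proj₂ (lifted-pair β u v u≢v))))
                     (colour-shadow (adj G u v) (draw β u v))

    lift-colours : (μ : Dist (Vec (Fin N) r)) (C₀ : ColDigraph k r) → ∃ λ (L : ColDigraph k N) → HasShadow m L G ×
      E μ (λ v → recolour g g-cong g≥0 g≤1 z (pairs r) (Vec.map ρ v) (matrix (adj G) v) C₀) ≤
      E μ (λ v → g (λ i j → L (lookup v i) (lookup v j))) + collision μ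
    lift-colours μ C₀ with derandomise 𝔅 μ (λ β v → g (λ i j → lifted β (lookup v i) (lookup v j))) _
        (λ β v → g≥0 _) (λ v → resample≤ g≤1 (pairs r) C₀) unbiased
      where
      unbiased : ∀ v → Unique v → E 𝔅 (λ β → g (λ i j → lifted β (lookup v i) (lookup v j))) ≡
                 recolour g g-cong g≥0 g≤1 z (pairs r) (Vec.map ρ v) (matrix (adj G) v) C₀
      unbiased v u = trans (Dist.ext 𝔅 (λ β → g-cong (λ p p′ p≢p′ → sym (foldl-setPair
            (λ i j → lifted β (lookup v i) (lookup v j)) (λ (i , j) → colour (entry (matrix (adj G) v) i j) (draw β (lookup v i) (lookup v j)))
            (λ i j i<j → trans (cong (λ e → colour e (draw β (lookup v i) (lookup v j))) (entry-matrix (adj G) v i j))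
               (lifted-pair β _ _ (λ e → Fin.<⇒≢ i<j (inj i j e))))
            (pairs r) (pairs-< r) C₀ p p′ (cover β p p′ p≢p′)))))
        (realize 𝔅 (λ β (i , j) → draw β (lookup v i) (lookup v j)) (λ β (i , j) b → redraw β (lookup v i) (lookup v j) b)
          (λ (i , j) → i Fin.< j) _≢_
          (λ (i , j) _ F → trans (redraw-law (lookup v i) (lookup v j) F) (Dist.ext 𝔅 (λ β →
             cong (λ c → E (pairKernel z c) (λ b → F (redraw β (lookup v i) (lookup v j) b)))
               (sym (cong₂ _,_ (Vec.lookup-map i ρ v) (cong₂ _,_ (Vec.lookup-map j ρ v) (entry-matrix (adj G) v i j)))))))
          (λ β (i , j) b → draw-redraw β (lookup v i) (lookup v j) b)
          -- Both pairs of positions are increasing, so different ones cannot coincide after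
          -- reversal either and use different cells.
          (λ β (i , j) (i′ , j′) b i<j i′<j′ ≢ → draw-redraw′ β (lookup v i) (lookup v j) (lookup v i′) (lookup v j′) b
             (λ e → ≢ (sym (cong₂ _,_ (inj i′ i (cong proj₁ e)) (inj j′ j (cong proj₂ e)))))
             (λ e → Fin.<-asym i<j (subst₂ Fin._<_ (inj i′ j (cong proj₂ e)) (inj j′ i (cong proj₁ e)) i′<j′)))
          (pairs r) (pairs-< r) (pairs-unique r) C₀)
        where
        inj = VecUnique.lookup-injective u
        cover : ∀ β p p′ → p ≢ p′ → (p , p′) ∈ pairs r ⊎ (p′ , p) ∈ pairs r ⊎ C₀ p p′ ≡ lifted β (lookup v p) (lookup v p′)
        cover β p p′ n with pairs-cover r p p′ n
        ... | inj₁ x = inj₁ x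
        ... | inj₂ x = inj₂ (inj₁ x)
    ... | β , p = lifted β , lifted-shadow β , p

-- Binomial coefficients and subsets

nC0≡1 : ∀ n → n choose 0 ≡ 1
nC0≡1 n = trans (nCk≡nC[n∸k] {n = n} ℕ.z≤n) (nCn≡1 n)

absorption : ∀ a b → suc b ℕ.* (suc a choose suc b) ≡ suc a ℕ.* (a choose b)
absorption zero zero = refl
absorption zero (suc b) = trans (cong (suc (suc b) ℕ.*_) (k>n⇒nCk≡0 {1} {suc (suc b)} (ℕ.s≤s (ℕ.s≤s ℕ.z≤n))))
  (trans (ℕ.*-zeroʳ (suc (suc b))) (sym (cong (1 ℕ.*_) (k>n⇒nCk≡0 {0} {suc b} (ℕ.s≤s ℕ.z≤n)))))
absorption (suc a) zero = trans (ℕ.*-identityˡ _) (trans (nC1≡n (suc (suc a))) (sym (trans (cong (suc (suc a) ℕ.*_) (nC0≡1 (suc a))) (ℕ.*-identityʳ _))))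
absorption (suc a) (suc b) = begin
  suc (suc b) ℕ.* (suc (suc a) choose suc (suc b))
    ≡⟨ cong (suc (suc b) ℕ.*_) (sym (nCk+nC[k+1]≡[n+1]C[k+1] (suc a) (suc b))) ⟩
  suc (suc b) ℕ.* (x ℕ.+ (suc a choose suc (suc b)))
    ≡⟨ lem b x _ ⟩
  x ℕ.+ (suc b ℕ.* x ℕ.+ suc (suc b) ℕ.* (suc a choose suc (suc b)))
    ≡⟨ cong (x ℕ.+_) (cong₂ ℕ._+_ (absorption a b) (absorption a (suc b))) ⟩
  x ℕ.+ (suc a ℕ.* (a choose b) ℕ.+ suc a ℕ.* (a choose suc b))
    ≡⟨ cong (x ℕ.+_) (sym (ℕ.*-distribˡ-+ (suc a) (a choose b) (a choose suc b))) ⟩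
  x ℕ.+ suc a ℕ.* ((a choose b) ℕ.+ (a choose suc b))
    ≡⟨ cong (λ y → x ℕ.+ suc a ℕ.* y) (nCk+nC[k+1]≡[n+1]C[k+1] a b) ⟩
  x ℕ.+ suc a ℕ.* x ∎
  where
  open ≡-Reasoning
  x = suc a choose suc b
  lem : ∀ b x y → suc (suc b) ℕ.* (x ℕ.+ y) ≡ x ℕ.+ (suc b ℕ.* x ℕ.+ suc (suc b) ℕ.* y)
  lem = solve-∀

-- The probability that a random s-set contains t given points is the product of (s - i)/(n - i)
-- over i < t, and each factor is at most s/n.
falling-ratio : ∀ {n s} t → t ℕ.≤ s → s ℕ.≤ n → n ^ t ℕ.* ((n ∸ t) choose (s ∸ t)) ℕ.≤ s ^ t ℕ.* (n choose s)
falling-ratio zero _ _ = ℕ.≤-refl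
falling-ratio {n} {s} (suc t) t<s s≤n = ℕ.*-cancelˡ-≤ (suc a) (begin
  suc a ℕ.* (n ^ suc t ℕ.* (a choose b))            ≡⟨ l₁ (suc a) n (n ^ t) (a choose b) ⟩
  n ℕ.* (n ^ t ℕ.* (suc a ℕ.* (a choose b)))        ≡⟨ cong (λ y → n ℕ.* (n ^ t ℕ.* y)) (sym (absorption a b)) ⟩
  n ℕ.* (n ^ t ℕ.* (suc b ℕ.* (suc a choose suc b))) ≡⟨ l₂ n (n ^ t) (suc b) _ ⟩
  n ℕ.* suc b ℕ.* (n ^ t ℕ.* (suc a choose suc b))  ≤⟨ ℕ.*-mono-≤ key (subst₂ (λ x y → n ^ t ℕ.* (x choose y) ℕ.≤ s ^ t ℕ.* (n choose s)) ea eb (falling-ratio t (ℕ.<⇒≤ t<s) s≤n)) ⟩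
  s ℕ.* suc a ℕ.* (s ^ t ℕ.* (n choose s))          ≡⟨ l₃ s (suc a) (s ^ t) (n choose s) ⟩
  suc a ℕ.* (s ^ suc t ℕ.* (n choose s)) ∎)
  where
  open ℕ.≤-Reasoning
  a = n ∸ suc t
  b = s ∸ suc t
  ea : n ∸ t ≡ suc a
  ea = ℕ.+-∸-assoc 1 {n} {suc t} (ℕ.≤-trans t<s s≤n)
  eb : s ∸ t ≡ suc b
  eb = ℕ.+-∸-assoc 1 {s} {suc t} t<s
  l₁ : ∀ a n p c → a ℕ.* (n ℕ.* p ℕ.* c) ≡ n ℕ.* (p ℕ.* (a ℕ.* c))
  l₁ = solve-∀
  l₂ : ∀ n p b c → n ℕ.* (p ℕ.* (b ℕ.* c)) ≡ n ℕ.* b ℕ.* (p ℕ.* c)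
  l₂ = solve-∀
  l₃ : ∀ s a p c → s ℕ.* a ℕ.* (p ℕ.* c) ≡ a ℕ.* (s ℕ.* p ℕ.* c)
  l₃ = solve-∀
  key : n ℕ.* suc b ℕ.≤ s ℕ.* suc a
  key = begin
    n ℕ.* suc b          ≡⟨ cong (n ℕ.*_) (sym eb) ⟩
    n ℕ.* (s ∸ t)        ≡⟨ ℕ.*-distribˡ-∸ n s t ⟩
    n ℕ.* s ∸ n ℕ.* t    ≤⟨ ℕ.∸-monoʳ-≤ (n ℕ.* s) (ℕ.*-monoˡ-≤ t s≤n) ⟩
    n ℕ.* s ∸ s ℕ.* t    ≡⟨ cong (_∸ s ℕ.* t) (ℕ.*-comm n s) ⟩
    s ℕ.* n ∸ s ℕ.* t    ≡⟨ sym (ℕ.*-distribˡ-∸ s n t) ⟩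
    s ℕ.* (n ∸ t)        ≡⟨ cong (s ℕ.*_) ea ⟩
    s ℕ.* suc a ∎

size≤ : ∀ {n} (W : Subset n) → size W ℕ.≤ n
size≤ []          = ℕ.z≤n
size≤ (true ∷ W)  = ℕ.s≤s (size≤ W)
size≤ (false ∷ W) = ℕ.m≤n⇒m≤1+n (size≤ W)

emb-injective : ∀ {n} (X : Subset n) {a b} → emb X a ≡ emb X b → a ≡ b
emb-injective (true ∷ X) {zero} {zero} e = refl
emb-injective (true ∷ X) {suc a} {suc b} e = cong suc (emb-injective X (Fin.suc-injective e))
emb-injective (false ∷ X) e = emb-injective X (Fin.suc-injective e)

size-insert : ∀ {n} (W : Subset n) a → lookup W a ≡ false → size (W [ a ]≔ true) ≡ suc (size W)
size-insert (false ∷ W) zero e = refl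
size-insert (true ∷ W) (suc a) e = cong suc (size-insert W a e)
size-insert (false ∷ W) (suc a) e = size-insert W a e

image : ∀ {n t} → Vec (Fin n) t → Subset n
image []      = Vec.replicate _ false
image (a ∷ v) = image v [ a ]≔ true

image-∉ : ∀ {n t} (v : Vec (Fin n) t) {a} → VecAll.All (a ≢_) v → lookup (image v) a ≡ false
image-∉ [] {a} _ = Vec.lookup-replicate a false
image-∉ (b ∷ v) {a} (n ∷ ns) = trans (Vec.lookup∘update′ n (image v) true) (image-∉ v ns)

size-replicate : ∀ n → size (Vec.replicate n false) ≡ 0
size-replicate zero = refl
size-replicate (suc n) = size-replicate n

size-image : ∀ {n t} (v : Vec (Fin n) t) → Unique v → size (image v) ≡ t
size-image {n} [] _ = size-replicate n
size-image (a ∷ v) (n ∷ u) = trans (size-insert (image v) a (image-∉ v n)) (cong suc (size-image v u))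

-- Counting tuples inside subsets of a given size

module Sampling (ℝ : RealField) where
  open Lifting ℝ public

  indicator : Bool → R
  indicator b = if b then 1# else 0#

  indicator≥0 : ∀ b → 0# ≤ indicator b
  indicator≥0 true  = 0≤1
  indicator≥0 false = ≤-refl

  -- Tuples

  ∑Vec : ∀ N t → (Vec (Fin N) t → R) → R
  ∑Vec N zero    F = F []
  ∑Vec N (suc t) F = ∑ (allFin N) (λ a → ∑Vec N t (λ y → F (a ∷ y)))

  ∑Vec-linear : ∀ N t → Linear (∑Vec N t)
  ∑Vec-linear N zero = record { ext = λ e → e [] ; add = λ f g → refl ; scale = λ c f → refl }
  ∑Vec-linear N (suc t) = record
    { ext = λ e → O.ext (λ a → I.ext (λ y → e (a ∷ y)))
    ; add = λ f g → trans (O.ext (λ a → I.add _ _)) (O.add _ _)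
    ; scale = λ c f → trans (O.ext (λ a → I.scale c _)) (O.scale c _) }
    where
    module O = Linear (∑-linear (allFin N))
    module I = Linear (∑Vec-linear N t)

  ∑Vec-mono : ∀ N t {f g} → (∀ v → f v ≤ g v) → ∑Vec N t f ≤ ∑Vec N t g
  ∑Vec-mono N zero h = h []
  ∑Vec-mono N (suc t) h = ∑-mono (allFin N) (λ a → ∑Vec-mono N t (λ y → h (a ∷ y)))

  ∑Vec-const : ∀ N t c → ∑Vec N t (λ _ → c) ≡ fromℕ (N ^ t) * c
  ∑Vec-const N zero c = solve 1 (λ c → c := (:1 :+ :0) :* c) refl c
  ∑Vec-const N (suc t) c = trans (Linear.ext (∑-linear (allFin N)) (λ a → ∑Vec-const N t c))
    (trans (∑-allFin-const N _) (trans (sym (*-assoc _ _ _)) (cong (_* c) (sym (fromℕ-* N (N ^ t))))))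

  -- Defined for every `N`, since the size of a subset is not visibly a successor; `mean-E`
  -- identifies it with the expectation over `vec` when it is.
  mean : ∀ N t → (Vec (Fin N) t → R) → R
  mean N t F = ∑Vec N t F * fromℕ (N ^ t) ⁻¹

  fromℕ-^-pos : ∀ {N} t → 1 ℕ.≤ N → 0# < fromℕ (N ^ t)
  fromℕ-^-pos {suc N} t _ = fromℕ-pos (ℕ.m^n>0 (suc N) t)

  uniformFin-E : ∀ n f → E (uniformFin n) f ≡ ∑ (allFin (suc n)) f * fromℕ (suc n) ⁻¹
  uniformFin-E n f = trans (uniform-E zero (tabulate suc) f) (cong (λ l → ∑ (allFin (suc n)) f * fromℕ (suc l) ⁻¹) (length-tabulate′ {n = n} Fin.suc))

  mean-E : ∀ n t F → E (vec (uniformFin n) t) F ≡ mean (suc n) t F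
  mean-E n zero F = sym (trans (cong (λ x → F [] * x ⁻¹) (+-identityʳ 1#)) (trans (cong (F [] *_)
    (trans (sym (*-identityˡ _)) (⁻¹-inverse 1# (pos⇒≢0 0<1)))) (*-identityʳ _)))
  mean-E n (suc t) F = trans (Dist.ext (uniformFin n) (λ a → mean-E n t (λ y → F (a ∷ y)))) (trans (uniformFin-E n _)
    (trans (cong (_* fromℕ (suc n) ⁻¹) (Linear.scaleʳ (∑-linear (allFin (suc n))) _ _)) (trans (*-assoc _ _ _)
      (cong (∑Vec (suc n) (suc t) F *_) (trans (*-comm _ _) (trans (sym (⁻¹-* (fromℕ-pos {suc n} (ℕ.s≤s ℕ.z≤n)) (fromℕ-^-pos t (ℕ.s≤s ℕ.z≤n))))
        (cong _⁻¹ (sym (fromℕ-* (suc n) (suc n ^ t))))))))))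

  ≤∑ : ∀ {n} (f : Fin n → R) → (∀ i → 0# ≤ f i) → ∀ i → f i ≤ ∑ (allFin n) f
  ≤∑ {n} f f≥0 i = ≤-trans (≤-reflexive (sym (∑-𝟙 i f))) (∑-mono (allFin n) (λ k →
    ≤-trans (*-monoʳ (f≥0 k) (𝟙≤1 (i Fin.≟ k))) (≤-reflexive (*-identityˡ _))))

  -- Union bound: a new entry hits one of t given entries with probability at most t/N, and t² + t ≤
  -- (t + 1)².
  collision-bound : ∀ n t → collision (vec (uniformFin n) t) ≤ fromℕ (t ℕ.* t) * fromℕ (suc n) ⁻¹
  collision-bound n zero = ≤-trans (≤-reflexive (-‿inverseʳ 1#)) (≤-reflexive (sym (zeroˡ _)))
  collision-bound n (suc t) = ≤-trans (Dist.mono U (λ a → Dist.mono V (at a))) (≤-trans (≤-reflexive split)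
      (≤-trans (+-mono (collision-bound n t) ≤-refl) (≤-trans (≤-reflexive (trans (sym (distribʳ _ _ _)) (cong (_* N⁻¹) (sym (fromℕ-+ (t ℕ.* t) t)))))
        (*-monoʳ (proj₁ (⁻¹-pos (fromℕ-pos {suc n} (ℕ.s≤s ℕ.z≤n)))) (fromℕ-mono (arith t))))))
    where
    U = uniformFin n
    V = vec U t
    N⁻¹ = fromℕ (suc n) ⁻¹
    arith : ∀ t → t ℕ.* t ℕ.+ t ℕ.≤ suc t ℕ.* suc t
    arith t = ℕ.≤-trans (ℕ.m≤m+n (t ℕ.* t ℕ.+ t) (suc t)) (ℕ.≤-reflexive (lem t))
      where lem : ∀ t → t ℕ.* t ℕ.+ t ℕ.+ suc t ≡ suc t ℕ.* suc t
            lem = solve-∀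
    hits : Fin (suc n) → Vec (Fin (suc n)) t → R
    hits a y = ∑ (allFin t) (λ i → 𝟙 (lookup y i Fin.≟ a))
    hits≥0 : ∀ a y → 0# ≤ hits a y
    hits≥0 a y = ≤-trans (≤-reflexive (sym (Linear.zero-on (∑-linear (allFin t))))) (∑-mono (allFin t) (λ i → 𝟙-nonneg (lookup y i Fin.≟ a)))
    at : ∀ a y → 1# - 𝟙 (unique? (a ∷ y)) ≤ (1# - 𝟙 (unique? y)) + hits a y
    at a y = go (unique? y) (unique? (a ∷ y))
      where
      go : (d : Dec (Unique y)) (e : Dec (Unique (a ∷ y))) → 1# - 𝟙 e ≤ (1# - 𝟙 d) + hits a y
      go d (yes _) = ≤-trans (≤-reflexive (-‿inverseʳ 1#)) (+-nonneg (≤⇒0≤ (𝟙≤1 d)) (hits≥0 a y))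
      go (no _) (no _) = ≤-by (hits≥0 a y) refl
      go (yes u) (no ¬u) with Fin.any? (λ i → lookup y i Fin.≟ a)
      ... | yes (i , e) = ≤-by (≤⇒0≤ (≤-trans (≤-reflexive (sym (𝟙-yes (lookup y i Fin.≟ a) e)))
                (≤∑ (λ i → 𝟙 (lookup y i Fin.≟ a)) (λ i → 𝟙-nonneg (lookup y i Fin.≟ a)) i)))
                (solve 1 (λ h → (:1 :- :1) :+ h := (:1 :- :0) :+ (h :- :1)) refl (hits a y))
      ... | no none = ⊥-elim (¬u (VecAll.lookup⁻ (λ i e → none (i , sym e)) ∷ u))
    hit : ∀ x → E U (λ a → 𝟙 (x Fin.≟ a)) ≡ N⁻¹
    hit x = trans (uniformFin-E n _) (trans (cong (_* N⁻¹) (trans (Linear.ext (∑-linear (allFin (suc n))) (λ a → sym (*-identityʳ _))) (∑-𝟙 x (λ _ → 1#)))) (*-identityˡ _))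
    split : E U (λ a → E V (λ y → (1# - 𝟙 (unique? y)) + hits a y)) ≡ collision V + fromℕ t * N⁻¹
    split = trans (Dist.ext U (λ a → Dist.add V _ _)) (trans (Dist.add U _ _) (cong₂ _+_ (Dist.const U _)
      (trans (Dist.fubini U (Dist.linear V) _) (trans (Dist.ext V (λ y → trans (Dist.fubini U (∑-linear (allFin t)) _)
        (trans (Linear.ext (∑-linear (allFin t)) (λ i → hit (lookup y i))) (∑-allFin-const t N⁻¹)))) (Dist.const V _)))))

  -- Subsets of a given size

  -- The indicator of the inclusion of `W` in `X`.
  within : ∀ {n} → Subset n → Subset n → R
  within []          []      = 1#
  within (true ∷ W)  (x ∷ X) = indicator x * within W X
  within (false ∷ W) (x ∷ X) = within W X

  ∑Sub : ∀ n s → (Subset n → R) → R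
  ∑Sub n s φ = ∑ (allSubsets n) (λ X → 𝟙 (size X ℕ.≟ s) * φ X)

  ∑Sub-linear : ∀ n s → Linear (∑Sub n s)
  ∑Sub-linear n s = record
    { ext = λ e → S.ext (λ X → cong (𝟙 (size X ℕ.≟ s) *_) (e X))
    ; add = λ f g → trans (S.ext (λ X → distribˡ _ _ _)) (S.add _ _)
    ; scale = λ c f → trans (S.ext (λ X → solve 3 (λ i c f → i :* (c :* f) := c :* (i :* f)) refl (𝟙 (size X ℕ.≟ s)) c (f X))) (S.scale c _) }
    where module S = Linear (∑-linear (allSubsets n))

  ∑Sub-local : ∀ n s {f g} → (∀ X → size X ≡ s → f X ≡ g X) → ∑Sub n s f ≡ ∑Sub n s g
  ∑Sub-local n s h = Linear.ext (∑-linear (allSubsets n)) (λ X → 𝟙-subst (size X ℕ.≟ s) (h X))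

  ∑Sub-mono : ∀ n s {f g} → (∀ X → size X ≡ s → f X ≤ g X) → ∑Sub n s f ≤ ∑Sub n s g
  ∑Sub-mono n s h = ∑-mono (allSubsets n) (λ X → 𝟙-mono (size X ℕ.≟ s) (h X))

  ∑Sub-suc : ∀ n s φ → ∑Sub (suc n) (suc s) φ ≡ ∑Sub n s (λ X → φ (true ∷ X)) + ∑Sub n (suc s) (λ X → φ (false ∷ X))
  ∑Sub-suc n s φ = trans (∑-++ (List.map (true ∷_) (allSubsets n)) _ _) (cong₂ _+_
    (trans (∑-map (true ∷_) (allSubsets n) _) (Linear.ext (∑-linear (allSubsets n)) (λ X →
      cong (_* φ (true ∷ X)) (𝟙-cong (suc (size X) ℕ.≟ suc s) (size X ℕ.≟ s) ℕ.suc-injective (cong suc)))))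
    (∑-map (false ∷_) (allSubsets n) _))

  ∑Sub-zero : ∀ n φ → ∑Sub (suc n) 0 φ ≡ ∑Sub n 0 (λ X → φ (false ∷ X))
  ∑Sub-zero n φ = trans (∑-++ (List.map (true ∷_) (allSubsets n)) _ _) (trans (cong₂ _+_
    (trans (∑-map (true ∷_) (allSubsets n) _) (trans (Linear.ext (∑-linear (allSubsets n)) (λ X → zeroˡ _)) (Linear.zero-on (∑-linear (allSubsets n)))))
    (∑-map (false ∷_) (allSubsets n) _)) (+-identityˡ _))

  within-small : ∀ {n} (W X : Subset n) → size X ℕ.< size W → within W X ≡ 0#
  within-small (true ∷ W) (true ∷ X) (ℕ.s≤s p) = trans (*-identityˡ _) (within-small W X p)
  within-small (true ∷ W) (false ∷ X) p = zeroˡ _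
  within-small (false ∷ W) (true ∷ X) p = within-small W X (ℕ.<-trans (ℕ.n<1+n _) p)
  within-small (false ∷ W) (false ∷ X) p = within-small W X p

  count-supersets : ∀ {n} (W : Subset n) s → size W ℕ.≤ s → ∑Sub n s (within W) ≡ fromℕ ((n ∸ size W) choose (s ∸ size W))
  count-supersets [] zero _ = trans (+-identityʳ _) (trans (*-identityˡ _) (sym (+-identityʳ 1#)))
  count-supersets [] (suc s) _ = trans (+-identityʳ _) (trans (zeroˡ _) (cong fromℕ (sym (k>n⇒nCk≡0 {0} {suc s} (ℕ.s≤s ℕ.z≤n)))))
  count-supersets {suc n} (true ∷ W) (suc s) (ℕ.s≤s p) = trans (∑Sub-suc n s (within (true ∷ W))) (trans (cong₂ _+_
    (trans (Linear.ext (∑Sub-linear n s) (λ X → *-identityˡ _)) (count-supersets W s p))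
    (trans (Linear.ext (∑Sub-linear n (suc s)) (λ X → zeroˡ _)) (Linear.zero-on (∑Sub-linear n (suc s))))) (+-identityʳ _))
  count-supersets {suc n} (false ∷ W) zero p = trans (∑Sub-zero n (within (false ∷ W))) (trans (count-supersets W 0 p)
    (cong fromℕ (trans (cong ((n ∸ size W) choose_) (ℕ.0∸n≡0 (size W))) (trans (nC0≡1 (n ∸ size W)) (sym (trans (cong ((suc n ∸ size W) choose_) (ℕ.0∸n≡0 (size W))) (nC0≡1 (suc n ∸ size W))))))))
  count-supersets {suc n} (false ∷ W) (suc s) p with size W ℕ.≤? s
  ... | yes q = trans (∑Sub-suc n s (within (false ∷ W))) (trans (cong₂ _+_ (count-supersets W s q) (count-supersets W (suc s) p))
          (trans (sym (fromℕ-+ ((n ∸ size W) choose (s ∸ size W)) ((n ∸ size W) choose (suc s ∸ size W)))) (cong fromℕ (trans (cong (λ x → (n ∸ size W) choose (s ∸ size W) ℕ.+ (n ∸ size W) choose x) (ℕ.+-∸-assoc 1 q))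
            (trans (nCk+nC[k+1]≡[n+1]C[k+1] (n ∸ size W) (s ∸ size W)) (sym (cong₂ _choose_ (ℕ.+-∸-assoc 1 (size≤ W)) (ℕ.+-∸-assoc 1 q))))))))
  -- Here `W` has exactly `suc s` elements. Truncated subtraction would count one superset of size
  -- `s` where there is none, so the first summand is shown to vanish directly.
  ... | no q = trans (∑Sub-suc n s (within (false ∷ W))) (trans (cong₂ _+_
          (trans (∑Sub-local n s {g = λ _ → 0#} (λ { X refl → within-small W X (ℕ.≰⇒> q) })) (Linear.zero-on (∑Sub-linear n s)))
          (count-supersets W (suc s) p)) (trans (+-identityˡ _) (cong fromℕ (trans (cong ((n ∸ size W) choose_) e) (trans (nC0≡1 (n ∸ size W)) (sym (trans (cong ((suc n ∸ size W) choose_) e) (nC0≡1 (suc n ∸ size W)))))))))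
    where
    e : suc s ∸ size W ≡ 0
    e = ℕ.m≤n⇒m∸n≡0 (ℕ.≰⇒> q)

  containing : ∀ {n t} → Vec (Fin n) t → Subset n → R
  containing []      X = 1#
  containing (a ∷ v) X = indicator (lookup X a) * containing v X

  within-insert : ∀ {n} (W X : Subset n) a → lookup W a ≡ false → within (W [ a ]≔ true) X ≡ indicator (lookup X a) * within W X
  within-insert (false ∷ W) (x ∷ X) zero e = refl
  within-insert (true ∷ W) (x ∷ X) (suc a) e = trans (cong (indicator x *_) (within-insert W X a e))
    (solve 3 (λ x y z → x :* (y :* z) := y :* (x :* z)) refl (indicator x) (indicator (lookup X a)) (within W X))
  within-insert (false ∷ W) (x ∷ X) (suc a) e = within-insert W X a e

  within-replicate : ∀ {n} (X : Subset n) → within (Vec.replicate n false) X ≡ 1#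
  within-replicate [] = refl
  within-replicate (x ∷ X) = within-replicate X

  within-image : ∀ {n t} (v : Vec (Fin n) t) X → Unique v → within (image v) X ≡ containing v X
  within-image [] X u = within-replicate X
  within-image (a ∷ v) X (n ∷ u) = trans (within-insert (image v) X a (image-∉ v n)) (cong (indicator (lookup X a) *_) (within-image v X u))

  ∑-emb : ∀ {n} (X : Subset n) (φ : Fin n → R) → ∑ (allFin (size X)) (λ a → φ (emb X a)) ≡ ∑ (allFin n) (λ v → indicator (lookup X v) * φ v)
  ∑-emb [] φ = refl
  ∑-emb {suc n} (true ∷ X) φ = trans (∑-allFin-suc (size X) _) (trans (cong₂ _+_ (sym (*-identityˡ _)) (∑-emb X (φ ∘ suc))) (sym (∑-allFin-suc n _)))
  ∑-emb {suc n} (false ∷ X) φ = trans (∑-emb X (φ ∘ suc)) (sym (trans (∑-allFin-suc n _) (trans (cong (_+ rest) (zeroˡ _)) (+-identityˡ _))))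
    where rest = ∑ (allFin n) (λ v → indicator (lookup X v) * φ (suc v))

  ∑Vec-emb : ∀ {n} (X : Subset n) t F → ∑Vec (size X) t (λ y → F (Vec.map (emb X) y)) ≡ ∑Vec n t (λ v → containing v X * F v)
  ∑Vec-emb X zero F = sym (*-identityˡ _)
  ∑Vec-emb {n} X (suc t) F = trans (Linear.ext (∑-linear (allFin (size X))) (λ a → ∑Vec-emb X t (λ y → F (emb X a ∷ y))))
    (trans (∑-emb X (λ a → ∑Vec n t (λ v → containing v X * F (a ∷ v)))) (Linear.ext (∑-linear (allFin n)) (λ a →
      trans (sym (Linear.scale (∑Vec-linear n t) _ _)) (Linear.ext (∑Vec-linear n t) (λ v → sym (*-assoc _ _ _))))))

  Unique-emb : ∀ {n} (X : Subset n) {t} (y : Vec (Fin (size X)) t) → 𝟙 (unique? y) ≡ 𝟙 (unique? (Vec.map (emb X) y))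
  Unique-emb X y = 𝟙-cong (unique? y) (unique? (Vec.map (emb X) y)) (VecUnique.map⁺ (emb-injective X)) (back y)
    where
    back : ∀ {t} (y : Vec (Fin (size X)) t) → Unique (Vec.map (emb X) y) → Unique y
    back [] _ = []
    back (a ∷ y) (n ∷ u) = VecAll.lookup⁻ (λ i e → VecAll.lookup⁺ (VecAll.map⁻ n) i (cong (emb X) e)) ∷ back y u

  -- After exchanging the sums, a tuple of distinct entries is weighted by the number of s-sets
  -- containing its image, which has t elements.
  double-count : ∀ n s t → t ℕ.≤ s → (F : Vec (Fin n) t → R) →
    ∑Sub n s (λ X → ∑Vec (size X) t (λ y → 𝟙 (unique? y) * F (Vec.map (emb X) y))) ≡
    fromℕ ((n ∸ t) choose (s ∸ t)) * ∑Vec n t (λ v → 𝟙 (unique? v) * F v)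
  double-count n s t t≤s F = begin
    ∑Sub n s (λ X → ∑Vec (size X) t (λ y → 𝟙 (unique? y) * F (Vec.map (emb X) y)))
      ≡⟨ Linear.ext S (λ X → trans (Linear.ext (∑Vec-linear (size X) t) (λ y → cong (_* F (Vec.map (emb X) y)) (Unique-emb X y)))
           (∑Vec-emb X t (λ v → 𝟙 (unique? v) * F v))) ⟩
    ∑Sub n s (λ X → ∑Vec n t (λ v → containing v X * (𝟙 (unique? v) * F v)))
      ≡⟨ exchange ⟩
    ∑Vec n t (λ v → ∑Sub n s (λ X → containing v X * (𝟙 (unique? v) * F v)))
      ≡⟨ Linear.ext V (λ v → trans (Linear.scaleʳ S _ _) (trans (solve 3 (λ c u f → c :* (u :* f) := u :* (c :* f)) refl _ (𝟙 (unique? v)) (F v))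
           (trans (𝟙-subst (unique? v) (λ u → cong (_* F v) (count v u))) (solve 3 (λ c u f → u :* (c :* f) := c :* (u :* f)) refl _ (𝟙 (unique? v)) (F v))))) ⟩
    ∑Vec n t (λ v → fromℕ ((n ∸ t) choose (s ∸ t)) * (𝟙 (unique? v) * F v))
      ≡⟨ Linear.scale V _ _ ⟩
    fromℕ ((n ∸ t) choose (s ∸ t)) * ∑Vec n t (λ v → 𝟙 (unique? v) * F v) ∎
    where
    open ≡-Reasoning
    S = ∑Sub-linear n s
    V = ∑Vec-linear n t
    exchange : ∀ {f : Subset n → Vec (Fin n) t → R} → ∑Sub n s (λ X → ∑Vec n t (f X)) ≡ ∑Vec n t (λ v → ∑Sub n s (λ X → f X v))
    exchange {f} = trans (Linear.ext (∑-linear (allSubsets n)) (λ X → sym (Linear.scale V _ _))) (∑-swap (allSubsets n) V _)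
    count : ∀ v → Unique v → ∑Sub n s (containing v) ≡ fromℕ ((n ∸ t) choose (s ∸ t))
    count v u = trans (Linear.ext S (λ X → sym (within-image v X u))) (trans (count-supersets (image v) s (ℕ.≤-trans (ℕ.≤-reflexive (size-image v u)) t≤s))
      (cong (λ d → fromℕ ((n ∸ d) choose (s ∸ d))) (size-image v u)))

  ∑Sub-one : ∀ n s → ∑Sub n s (λ _ → 1#) ≡ fromℕ (n choose s)
  ∑Sub-one n s = trans (Linear.ext (∑Sub-linear n s) (λ X → sym (within-replicate X)))
    (trans (count-supersets (Vec.replicate n false) s (ℕ.≤-trans (ℕ.≤-reflexive (size-replicate n)) ℕ.z≤n))
      (cong (λ d → fromℕ ((n ∸ d) choose (s ∸ d))) (size-replicate n)))

-- By `falling-ratio` with t = s the coefficient times s^s is at least n^s.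
choose-pos : ∀ {n s} → s ℕ.≤ n → 1 ℕ.≤ n choose s
choose-pos {n} {zero} _ = ℕ.≤-reflexive (sym (nC0≡1 n))
choose-pos {n} {suc s} s<n with n choose suc s in e
... | suc _ = ℕ.s≤s ℕ.z≤n
... | zero = ⊥-elim (ℕ.<⇒≱ pos (ℕ.≤-trans ratio (ℕ.≤-reflexive (trans (cong (suc s ^ suc s ℕ.*_) e) (ℕ.*-zeroʳ (suc s ^ suc s))))))
  where
  ratio = falling-ratio {n} {suc s} (suc s) ℕ.≤-refl s<n
  pos : 0 ℕ.< n ^ suc s ℕ.* ((n ∸ suc s) choose (suc s ∸ suc s))
  pos = ℕ.*-mono-≤ {1} {_} {1} (npos n s<n) (ℕ.≤-reflexive (sym (trans (cong ((n ∸ suc s) choose_) (ℕ.n∸n≡0 (suc s))) (nC0≡1 (n ∸ suc s)))))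
    where npos : ∀ n → suc s ℕ.≤ n → 1 ℕ.≤ n ^ suc s
          npos (suc n) _ = ℕ.m^n>0 (suc n) (suc s)

module _ {n} (f : Fin n → Fin n) (inj : ∀ i j → f i ≡ f j → i ≡ j) where

  endo-surjective : ∀ x → ∃ λ i → f i ≡ x
  endo-surjective x with Fin.any? (λ i → f i Fin.≟ x)
  ... | yes p = p
  ... | no none = ⊥-elim (avoid f inj x (λ i e → none (i , e)))
    where
    avoid : ∀ {n} (f : Fin n → Fin n) → (∀ i j → f i ≡ f j → i ≡ j) → ∀ x → (∀ i → f i ≢ x) → ⊥
    avoid {suc n} f inj x n≢ = ℕ.1+n≰n (Fin.injective⇒≤ {f = λ i → Fin.punchOut (λ e → n≢ i (sym e))}
      (λ {i} {j} e → inj i j (Fin.punchOut-injective (λ e → n≢ i (sym e)) (λ e → n≢ j (sym e)) e)))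

  endo-permutation : Permutation′ n
  endo-permutation = permutation f (λ x → proj₁ (endo-surjective x)) (λ x → proj₂ (endo-surjective x))
    (λ i → inj _ i (proj₂ (endo-surjective (f i))))

-- Comparing random subsets with random tuples

module SubsetSampling (ℝ : RealField) where
  open Sampling ℝ public

  mean-linear : ∀ N t → Linear (mean N t)
  mean-linear N t = record
    { ext = λ e → cong (_* fromℕ (N ^ t) ⁻¹) (ext e)
    ; add = λ f g → trans (cong (_* fromℕ (N ^ t) ⁻¹) (add f g)) (distribʳ _ _ _)
    ; scale = λ c f → trans (cong (_* fromℕ (N ^ t) ⁻¹) (scale c f)) (*-assoc _ _ _) }
    where open Linear (∑Vec-linear N t)

  mean-mono : ∀ {N} t → 1 ℕ.≤ N → ∀ {f g} → (∀ v → f v ≤ g v) → mean N t f ≤ mean N t g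
  mean-mono {N} t N≥1 h = *-monoʳ (proj₁ (⁻¹-pos (fromℕ-^-pos t N≥1))) (∑Vec-mono N t h)

  mean-const : ∀ {N} t → 1 ℕ.≤ N → ∀ c → mean N t (λ _ → c) ≡ c
  mean-const {N} t N≥1 c = trans (cong (_* fromℕ (N ^ t) ⁻¹) (trans (∑Vec-const N t c) (*-comm _ _))) (*⁻¹-cancelʳ c (fromℕ-^-pos t N≥1))

  mean-collision : ∀ {N} t → 1 ℕ.≤ N → mean N t (λ v → 1# - 𝟙 (unique? v)) ≤ fromℕ (t ℕ.* t) * fromℕ N ⁻¹
  mean-collision {suc n} t _ = subst (_≤ fromℕ (t ℕ.* t) * fromℕ (suc n) ⁻¹) (mean-E n t (λ v → 1# - 𝟙 (unique? v))) (collision-bound n t)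

  avgSub : ∀ n s → (Subset n → R) → R
  avgSub n s φ = ∑Sub n s φ * fromℕ (n choose s) ⁻¹

  choose>0 : ∀ {n s} → s ℕ.≤ n → 0# < fromℕ (n choose s)
  choose>0 s≤n = fromℕ-pos (choose-pos s≤n)

  avgSub-linear : ∀ n s → Linear (avgSub n s)
  avgSub-linear n s = record
    { ext = λ e → cong (_* fromℕ (n choose s) ⁻¹) (ext e)
    ; add = λ f g → trans (cong (_* fromℕ (n choose s) ⁻¹) (add f g)) (distribʳ _ _ _)
    ; scale = λ c f → trans (cong (_* fromℕ (n choose s) ⁻¹) (scale c f)) (*-assoc _ _ _) }
    where open Linear (∑Sub-linear n s)

  avgSub-mono : ∀ {n s} → s ℕ.≤ n → ∀ {f g} → (∀ X → size X ≡ s → f X ≤ g X) → avgSub n s f ≤ avgSub n s g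
  avgSub-mono {n} {s} s≤n h = *-monoʳ (proj₁ (⁻¹-pos (choose>0 s≤n))) (∑Sub-mono n s h)

  avgSub-const : ∀ {n s} → s ℕ.≤ n → ∀ c → avgSub n s (λ _ → c) ≡ c
  avgSub-const {n} {s} s≤n c = trans (cong (_* fromℕ (n choose s) ⁻¹) (trans (Linear.ext (∑Sub-linear n s) (λ _ → sym (*-identityʳ c)))
    (trans (Linear.scale (∑Sub-linear n s) c (λ _ → 1#)) (cong (c *_) (∑Sub-one n s))))) (*⁻¹-cancelʳ c (choose>0 s≤n))

  -- By `double-count` and `falling-ratio` a tuple of distinct entries arises with probability at
  -- most n^-t, its probability among all tuples. Tuples with a repetition inside `X` have frequency
  -- at most t²/s and contribute at most `c`.
  sampling : ∀ {n s} t → 1 ℕ.≤ s → t ℕ.≤ s → s ℕ.≤ n → (F : Vec (Fin n) t → R) → ∀ {c} →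
    (∀ v → 0# ≤ F v) → (∀ v → F v ≤ c) →
    avgSub n s (λ X → mean (size X) t (λ y → F (Vec.map (emb X) y))) ≤ mean n t F + c * (fromℕ (t ℕ.* t) * fromℕ s ⁻¹)
  sampling {n} {s} t s≥1 t≤s s≤n F {c} F≥0 F≤c = ≤-trans (avgSub-mono s≤n pointwise) (≤-trans
      (≤-reflexive (trans (Linear.add (avgSub-linear n s) _ _) (cong₂ _+_ refl (avgSub-const s≤n _)))) (+-mono main ≤-refl))
    where
    n≥1 = ℕ.≤-trans s≥1 s≤n
    inj : Subset n → R
    inj X = ∑Vec (size X) t (λ y → 𝟙 (unique? y) * F (Vec.map (emb X) y))
    S⁻¹ = fromℕ (s ^ t) ⁻¹
    c≥0 : Vec (Fin n) t → 0# ≤ c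
    c≥0 v = ≤-trans (F≥0 v) (F≤c v)
    pointwise : ∀ X → size X ≡ s → mean (size X) t (λ y → F (Vec.map (emb X) y)) ≤ inj X * S⁻¹ + c * (fromℕ (t ℕ.* t) * fromℕ s ⁻¹)
    pointwise X refl = ≤-trans (mean-mono t s≥1 at) (≤-trans (≤-reflexive (trans (Linear.add (mean-linear s t) _ _)
        (cong (mean s t (λ y → 𝟙 (unique? y) * F (Vec.map (emb X) y)) +_) (Linear.scale (mean-linear s t) c _)))) (+-mono ≤-refl (*-monoˡ c≥0′ (mean-collision t s≥1))))
      where
      at : ∀ y → F (Vec.map (emb X) y) ≤ 𝟙 (unique? y) * F (Vec.map (emb X) y) + c * (1# - 𝟙 (unique? y))
      at y with unique? y
      ... | yes _ = ≤-reflexive (solve 2 (λ f c → f := :1 :* f :+ c :* (:1 :- :1)) refl _ c)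
      ... | no _ = ≤-trans (F≤c _) (≤-reflexive (solve 2 (λ f c → c := :0 :* f :+ c :* (:1 :- :0)) refl (F (Vec.map (emb X) y)) c))
      some : ∀ {N} t → 1 ℕ.≤ N → Vec (Fin N) t
      some {suc N} t _ = Vec.replicate t zero
      c≥0′ = c≥0 (some t n≥1)
    T = fromℕ ((n ∸ t) choose (s ∸ t))
    V = ∑Vec n t (λ v → 𝟙 (unique? v) * F v)
    Spos = fromℕ-^-pos {s} t s≥1
    Npos = fromℕ-^-pos {n} t n≥1
    Cpos = choose>0 s≤n
    main : avgSub n s (λ X → inj X * S⁻¹) ≤ mean n t F
    main = ≤-trans (≤-reflexive (trans (Linear.scaleʳ (avgSub-linear n s) S⁻¹ inj)
        (trans (cong (λ x → x * fromℕ (n choose s) ⁻¹ * S⁻¹) (double-count n s t t≤s F))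
        (trans (solve 4 (λ T V c s → T :* V :* c :* s := V :* (T :* (s :* c))) refl T V (fromℕ (n choose s) ⁻¹) S⁻¹) (cong (λ x → V * (T * x)) (sym (⁻¹-* Spos Cpos)))))))
      (≤-trans (*-monoˡ (≤-trans (≤-reflexive (sym (Linear.zero-on (∑Vec-linear n t)))) (∑Vec-mono n t (λ v → *-nonneg′ (𝟙-nonneg (unique? v)) (F≥0 v)))) ratio)
        (*-monoʳ (proj₁ (⁻¹-pos Npos)) (∑Vec-mono n t (λ v → ≤-trans (*-monoʳ (F≥0 v) (𝟙≤1 (unique? v))) (≤-reflexive (*-identityˡ _))))))
      where
      ratio : T * (fromℕ (s ^ t) * fromℕ (n choose s)) ⁻¹ ≤ fromℕ (n ^ t) ⁻¹
      ratio = div-≤ (*-pos Spos Cpos) (*-cancelʳ-≤ Npos (≤-trans (≤-reflexive (trans (*-comm _ _) (sym (fromℕ-* (n ^ t) ((n ∸ t) choose (s ∸ t))))))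
        (≤-trans (fromℕ-mono (falling-ratio t t≤s s≤n)) (≤-reflexive (trans (fromℕ-* (s ^ t) (n choose s))
          (sym (trans (solve 3 (λ i x n → i :* x :* n := x :* i :* n) refl _ _ (fromℕ (n ^ t))) (*⁻¹-cancelʳ′ _ Npos))))))))

  -- Each r-set is the image of the same number `orders` of distinct tuples, and all r-sets together
  -- account for at most n^r of them.
  unique-tuples : ∀ {n r} → 1 ℕ.≤ r → r ℕ.≤ n → (F : Vec (Fin n) r → R) (φ : Subset n → R) →
    (∀ X → 0# ≤ φ X) → (∀ X → size X ≡ r → ∀ y → Unique y → F (Vec.map (emb X) y) ≡ φ X) →
    mean n r (λ v → 𝟙 (unique? v) * F v) ≤ avgSub n r φ
  unique-tuples {n} {r} r≥1 r≤n F φ φ≥0 same = div-≤ Npos (≤-trans (≤-reflexive (trans (count F) reduce))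
      (≤-trans (≤-reflexive regroup) (*-monoˡ avg≥0 tuples)))
    where
    n≥1 = ℕ.≤-trans r≥1 r≤n
    Npos = fromℕ-^-pos {n} r n≥1
    Cpos = choose>0 r≤n
    orders : R
    orders = ∑Vec r r (λ y → 𝟙 (unique? y))
    avg≥0 : 0# ≤ avgSub n r φ
    avg≥0 = ≤-trans (≤-reflexive (sym (avgSub-const r≤n 0#))) (avgSub-mono r≤n (λ X _ → φ≥0 X))
    count : ∀ F → ∑Vec n r (λ v → 𝟙 (unique? v) * F v) ≡ ∑Sub n r (λ X → ∑Vec (size X) r (λ y → 𝟙 (unique? y) * F (Vec.map (emb X) y)))
    count F = sym (trans (double-count n r r ℕ.≤-refl F) (trans (cong (_* V) (trans (cong (λ d → fromℕ ((n ∸ r) choose d)) (ℕ.n∸n≡0 r))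
      (trans (cong fromℕ (nC0≡1 (n ∸ r))) (+-identityʳ 1#)))) (*-identityˡ V)))
      where V = ∑Vec n r (λ v → 𝟙 (unique? v) * F v)
    reduce : ∑Sub n r (λ X → ∑Vec (size X) r (λ y → 𝟙 (unique? y) * F (Vec.map (emb X) y))) ≡ ∑Sub n r φ * orders
    reduce = trans (∑Sub-local n r (λ { X refl → trans (Linear.ext (∑Vec-linear r r) (λ y → 𝟙-subst (unique? y) (same X refl y)))
        (trans (Linear.scaleʳ (∑Vec-linear r r) (φ X) _) (*-comm _ _)) })) (Linear.scaleʳ (∑Sub-linear n r) orders φ)
    regroup : ∑Sub n r φ * orders ≡ avgSub n r φ * (fromℕ (n choose r) * orders)
    regroup = trans (cong (_* orders) (sym (*⁻¹-cancelʳ′ (∑Sub n r φ) Cpos))) (*-assoc _ _ _)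
    tuples : fromℕ (n choose r) * orders ≤ fromℕ (n ^ r)
    tuples = ≤-trans (≤-reflexive (trans (cong (_* orders) (sym (∑Sub-one n r))) (trans (sym (Linear.scaleʳ (∑Sub-linear n r) orders (λ _ → 1#)))
      (trans (∑Sub-local n r (λ { X refl → trans (*-identityˡ _) (Linear.ext (∑Vec-linear r r) (λ y → sym (*-identityʳ _))) })) (sym (count (λ _ → 1#)))))))
      (≤-trans (∑Vec-mono n r (λ v → ≤-trans (≤-reflexive (*-identityʳ _)) (𝟙≤1 (unique? v)))) (≤-reflexive (trans (∑Vec-const n r 1#) (*-identityʳ _))))

  indicator-∧ : ∀ a b → indicator (a ∧ b) ≡ indicator a * indicator b
  indicator-∧ true b = sym (*-identityˡ _)
  indicator-∧ false b = sym (zeroˡ _)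

  indicator-⌊⌋ : ∀ {P : Set} (d : Dec P) → indicator ⌊ d ⌋ ≡ 𝟙 d
  indicator-⌊⌋ (yes _) = refl
  indicator-⌊⌋ (no _)  = refl

  length-filter-T? : ∀ {A : Set} (b : A → Bool) xs → fromℕ (length (filter (λ x → T? (b x)) xs)) ≡ ∑ xs (λ x → indicator (b x))
  length-filter-T? b [] = refl
  length-filter-T? b (x ∷ xs) with b x
  ... | true = cong (1# +_) (length-filter-T? b xs)
  ... | false = trans (length-filter-T? b xs) (sym (+-identityˡ _))

  prBad≡ : ∀ (S : ℕ → Set) (restrict : ∀ {n} (X : Subset n) → S n → S (size X)) (f : ∀ {n} → S n → R) {n} r ε (A : S n) →
    prBad ℝ S restrict f r ε A ≡ avgSub n r (λ X → indicator (farOff ℝ S restrict f ε A X))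
  prBad≡ S restrict f {n} r ε A = cong (_* fromℕ (n choose r) ⁻¹) (trans (length-filter-T? _ (allSubsets n))
    (Linear.ext (∑-linear (allSubsets n)) (λ X → trans (indicator-∧ ⌊ size X ℕ.≟ r ⌋ (farOff ℝ S restrict f ε A X))
      (cong (_* indicator (farOff ℝ S restrict f ε A X)) (indicator-⌊⌋ (size X ℕ.≟ r))))))

  module Digraphs {k : ℕ} (g : DigraphParam ℝ k) (invariant : IsInvariantDigraphParam ℝ g) where

    along : ∀ {n t} → ColDigraph k n → Vec (Fin n) t → ColDigraph k t
    along L v i j = L (lookup v i) (lookup v j)

    g-cong : ∀ {n} {L L′ : ColDigraph k n} → L ≈ L′ → g L ≡ g L′
    g-cong {L = L} {L′} h = sym (invariant (permutation id id (λ _ → refl) (λ _ → refl)) L L′ (λ i j i≢j → sym (h i j i≢j)))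

    g-reorder : ∀ {N r} → N ≡ r → (L : ColDigraph k N) (y : Vec (Fin N) r) → Unique y → g (along L y) ≡ g L
    g-reorder refl L y u = invariant (endo-permutation (lookup y) (VecUnique.lookup-injective u)) L (along L y) (λ i j _ → refl)

    module _ (g≥0 : ∀ {n} (L : ColDigraph k n) → 0# ≤ g L) (g≤1 : ∀ {n} (L : ColDigraph k n) → g L ≤ 1#) where

      diff≤1 : ∀ {m n} (L : ColDigraph k m) (L′ : ColDigraph k n) → ∣ g L - g L′ ∣ ≤ 1#
      diff≤1 L L′ = ∣-∣≤ (≤-trans (g≤1 L) (≤-by (g≥0 L′) (+-comm _ _))) (≤-trans (g≤1 L′) (≤-by (g≥0 L) (+-comm _ _)))

      -- A distinct tuple deviates by more than `ε` only if its image is a bad subset; bad images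
      -- and repetitions are charged the full range 1. This trades the subsets of the definition for
      -- independent coordinates.
      tuple-estimate : ∀ {r ε δ} → 0# ≤ ε → 1 ℕ.≤ r → (∀ {n} (L : ColDigraph k n) → r ℕ.≤ n → prBad ℝ (ColDigraph k) inducedDigraph g r ε L < δ) →
        ∀ {n} (L : ColDigraph k n) → r ℕ.≤ n →
        mean n r (λ v → ∣ g L - g (along L v) ∣) ≤ ε + δ + fromℕ (r ℕ.* r) * fromℕ n ⁻¹
      tuple-estimate {r} {ε} {δ} ε≥0 r≥1 est {n} L r≤n = ≤-trans (mean-mono r n≥1 at) (≤-trans (≤-reflexive (trans (Linear.add M _ _)
          (cong (_+ mean n r (λ v → 1# - 𝟙 (unique? v))) (trans (Linear.add M _ _) (cong (_+ mean n r (λ v → 𝟙 (unique? v) * bad v)) (mean-const r n≥1 ε))))))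
        (+-mono (+-mono ≤-refl (≤-trans (unique-tuples r≥1 r≤n bad badSet (λ X → indicator≥0 (farOff ℝ (ColDigraph k) inducedDigraph g ε L X)) same)
            (≤-trans (≤-reflexive (sym (prBad≡ (ColDigraph k) inducedDigraph g r ε L))) (proj₁ (est L r≤n)))))
          (mean-collision r n≥1)))
        where
        M = mean-linear n r
        n≥1 = ℕ.≤-trans r≥1 r≤n
        bad : Vec (Fin n) r → R
        bad v = indicator (not ⌊ ∣ g L - g (along L v) ∣ ≤? ε ⌋)
        badSet : Subset n → R
        badSet X = indicator (farOff ℝ (ColDigraph k) inducedDigraph g ε L X)
        same : ∀ X → size X ≡ r → ∀ y → Unique y → bad (Vec.map (emb X) y) ≡ badSet X
        same X e y u = cong (λ x → indicator (not ⌊ ∣ g L - x ∣ ≤? ε ⌋)) (trans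
          (g-cong (λ i j _ → cong₂ L (Vec.lookup-map i (emb X) y) (Vec.lookup-map j (emb X) y))) (g-reorder e (inducedDigraph X L) y u))
        at : ∀ v → ∣ g L - g (along L v) ∣ ≤ ε + 𝟙 (unique? v) * bad v + (1# - 𝟙 (unique? v))
        at v with ∣ g L - g (along L v) ∣ ≤? ε | unique? v
        ... | yes p | d = ≤-trans p (≤-by (≤⇒0≤ (𝟙≤1 d)) (solve 2 (λ e u → e :+ u :* :0 :+ (:1 :- u) := e :+ (:1 :- u)) refl ε (𝟙 d)))
        ... | no _ | yes _ = ≤-trans (diff≤1 L (along L v)) (≤-by ε≥0 (solve 1 (λ e → e :+ :1 :* :1 :+ (:1 :- :1) := :1 :+ e) refl ε))
        ... | no _ | no _ = ≤-trans (diff≤1 L (along L v)) (≤-by ε≥0 (solve 1 (λ e → e :+ :0 :* :1 :+ (:1 :- :0) := :1 :+ e) refl ε))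

-- Finite encodings of labels and patterns

take-++ : ∀ {A : Set} {m n} (xs : Vec A m) (ys : Vec A n) → take m (xs Vec.++ ys) ≡ xs
take-++ [] ys = refl
take-++ (x ∷ xs) ys = cong (x ∷_) (take-++ xs ys)

drop-++ : ∀ {A : Set} {m n} (xs : Vec A m) (ys : Vec A n) → drop m (xs Vec.++ ys) ≡ ys
drop-++ [] ys = refl
drop-++ (x ∷ xs) ys = drop-++ xs ys

-- Energies and sums over patterns range over `Fin`, so labels and patterns are numbered. A left
-- inverse suffices; numbers outside the image may decode to anything.
record Code (A : Set) : Set where
  field
    codeSize : ℕ
    enc      : A → Fin codeSize
    dec      : Fin codeSize → A
    dec-enc  : ∀ a → dec (enc a) ≡ a

code-Bool : Code Bool
code-Bool = record { codeSize = 2 ; enc = λ { true → suc zero ; false → zero } ; dec = λ { zero → false ; (suc _) → true }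
                   ; dec-enc = λ { true → refl ; false → refl } }

code-Fin : ∀ n → Code (Fin n)
code-Fin n = record { codeSize = n ; enc = id ; dec = id ; dec-enc = λ _ → refl }

code-× : ∀ {A B : Set} → Code A → Code B → Code (A × B)
code-× {A} {B} c d = record { codeSize = C.codeSize ℕ.* D.codeSize ; enc = λ (a , b) → Fin.combine (C.enc a) (D.enc b)
    ; dec = λ x → decode (Fin.remQuot D.codeSize x)
    ; dec-enc = λ (a , b) → trans (cong decode (Fin.remQuot-combine (C.enc a) (D.enc b))) (cong₂ _,_ (C.dec-enc a) (D.dec-enc b)) }
  where
  module C = Code c
  module D = Code d
  decode : Fin C.codeSize × Fin D.codeSize → A × B
  decode (i , j) = C.dec i , D.dec j

code-Vec : ∀ {A : Set} → Code A → ∀ q → Code (Vec A q)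
code-Vec {A} c q = record { codeSize = C.codeSize ^ q ; enc = encode ; dec = decode q ; dec-enc = correct }
  where
  module C = Code c
  encode : ∀ {q} → Vec A q → Fin (C.codeSize ^ q)
  encode [] = zero
  encode (a ∷ v) = Fin.combine (C.enc a) (encode v)
  decode : ∀ q → Fin (C.codeSize ^ q) → Vec A q
  decode zero x = []
  decode (suc q) x = C.dec (proj₁ (Fin.remQuot (C.codeSize ^ q) x)) ∷ decode q (proj₂ (Fin.remQuot {C.codeSize} (C.codeSize ^ q) x))
  correct : ∀ {q} (v : Vec A q) → decode q (encode v) ≡ v
  correct [] = refl
  correct (a ∷ v) = trans (cong (λ p → C.dec (proj₁ p) ∷ decode _ (proj₂ p)) (Fin.remQuot-combine (C.enc a) (encode v)))
    (cong₂ _∷_ (C.dec-enc a) (correct v))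

patternCode : ∀ q r → Code (Vec (Vec Bool q) r × Matrix r)
patternCode q r = code-× (code-Vec (code-Vec code-Bool q) r) (code-Vec (code-Vec code-Bool r) r)

patterns : ℕ → ℕ → ℕ
patterns q r = (2 ^ q) ^ r ℕ.* (2 ^ r) ^ r

-- Pattern frequencies in a random sample: the variance bound

module Direction (ℝ : RealField) where
  open SubsetSampling ℝ public

  module Deviation {n} (G : Graph n) (r : ℕ) where

    pattern′ : ∀ {q} → Vec (Fin n) q → Vec (Fin n) r → Fin (patterns q r)
    pattern′ {q} p u = Code.enc (patternCode q r) (Vec.map (types (adj G) p) u , matrix (adj G) u)

    hit : ∀ {q} → Fin (patterns q r) → Vec (Fin n) q → Vec (Fin n) r → R
    hit π p u = 𝟙 (pattern′ p u Fin.≟ π)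

    frequency : ∀ {q} → Fin (patterns q r) → Vec (Fin n) q → R
    frequency π p = mean n r (hit π p)

    covariance : ∀ {q} → Fin (patterns q r) → Vec (Fin n) q → Vec (Fin n) r → Vec (Fin n) r → R
    covariance π p u u′ = (hit π p u - frequency π p) * (hit π p u′ - frequency π p)

    -- Pivots and both test tuples form one tuple of length q + 2r, to which `sampling` applies.
    flatCovariance : ∀ {q} → Fin (patterns q r) → Vec (Fin n) (q ℕ.+ (r ℕ.+ r)) → R
    flatCovariance {q} π x = covariance π (take q x) (take r (drop q x)) (drop r (drop q x))

    flatCovariance-++ : ∀ {q} π (p : Vec (Fin n) q) u u′ → flatCovariance {q} π (p Vec.++ (u Vec.++ u′)) ≡ covariance π p u u′
    flatCovariance-++ π p u u′ rewrite take-++ p (u Vec.++ u′) | drop-++ p (u Vec.++ u′) | take-++ u u′ | drop-++ u u′ = refl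

    -- The mean square difference between the pattern frequencies along tuples from the image of e and along all tuples,
    -- with the square expanded over two independent tuples.
    deviation : ∀ N → (Fin N → Fin n) → ℕ → R
    deviation N e q = ∑ (allFin (patterns q r)) (λ π → mean N (q ℕ.+ (r ℕ.+ r)) (λ x → flatCovariance {q} π (Vec.map e x)))

    localDeviation : ∀ {s q} → (Fin (suc s) → Fin n) → Vec (Fin (suc s)) q → R
    localDeviation {s} {q} e w = ∑ (allFin (patterns q r)) (λ π → d π * d π)
      where
      d : Fin (patterns q r) → R
      d π = E (vec (uniformFin s) r) (λ y → hit π (Vec.map e w) (Vec.map e y)) - frequency π (Vec.map e w)

    -- For fixed pivots the two test tuples are independent, so the expected covariance factors into
    -- a square. This form is visibly nonnegative and can be charged to individual pivots.
    deviation-E : ∀ {s} (e : Fin (suc s) → Fin n) q → deviation (suc s) e q ≡ E (vec (uniformFin s) q) (localDeviation e)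
    deviation-E {s} e q = trans (Linear.ext S per) (sym (Dist.fubini W S _))
      where
      S = ∑-linear (allFin (patterns q r))
      W = vec (uniformFin s) q
      Y = vec (uniformFin s) r
      per : ∀ π → mean (suc s) (q ℕ.+ (r ℕ.+ r)) (λ x → flatCovariance {q} π (Vec.map e x)) ≡
        E W (λ w → (E Y (λ y → hit π (Vec.map e w) (Vec.map e y)) - frequency π (Vec.map e w)) * (E Y (λ y → hit π (Vec.map e w) (Vec.map e y)) - frequency π (Vec.map e w)))
      per π = trans (sym (mean-E s (q ℕ.+ (r ℕ.+ r)) _)) (trans (vec-++ (uniformFin s) q (r ℕ.+ r) _) (Dist.ext W (λ w →
        trans (vec-++ (uniformFin s) r r _) (trans (Dist.ext Y (λ y → Dist.ext Y (λ y′ →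
          trans (cong (flatCovariance {q} π) (trans (Vec.map-++ e w (y Vec.++ y′)) (cong (Vec.map e w Vec.++_) (Vec.map-++ e y y′))))
            (flatCovariance-++ π (Vec.map e w) (Vec.map e y) (Vec.map e y′)))))
        (trans (Dist.ext Y (λ y → Dist.scale Y _ _)) (trans (Dist.scaleʳ Y _ _)
          (cong₂ _*_ (centre w) (centre w))))))))
        where
        centre : ∀ w → E Y (λ y → hit π (Vec.map e w) (Vec.map e y) - frequency π (Vec.map e w)) ≡ E Y (λ y → hit π (Vec.map e w) (Vec.map e y)) - frequency π (Vec.map e w)
        centre w = trans (Dist.sub Y _ _) (cong (λ x → E Y (λ y → hit π (Vec.map e w) (Vec.map e y)) - x) (Dist.const Y _))

    -- Both sides average `Φ` over pattern frequencies. As `Φ` lies between 0 and 1, the excess is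
    -- at most the sum of the frequency differences, each of which `amgm` bounds by its square.
    transfer : ∀ {s q} (e : Fin (suc s) → Fin n) (w : Vec (Fin (suc s)) q) (Φ : Fin (patterns q r) → R) →
      (∀ π → 0# ≤ Φ π) → (∀ π → Φ π ≤ 1#) → ∀ {l} → 0# < l →
      E (vec (uniformFin s) r) (λ y → Φ (pattern′ (Vec.map e w) (Vec.map e y))) ≤
      mean n r (λ v → Φ (pattern′ (Vec.map e w) v)) + (fromℕ (patterns q r) * l + localDeviation e w * l ⁻¹)
    transfer {s} {q} e w Φ Φ≥0 Φ≤1 {l} l>0 = ≤-trans (≤-reflexive lhs) (≤-trans (∑-mono (allFin (patterns q r)) at)
        (≤-reflexive (trans (Linear.add S _ _) (cong₂ _+_ (sym rhs) (trans (Linear.add S _ _)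
          (cong₂ _+_ (∑-allFin-const (patterns q r) l) (Linear.scaleʳ S _ _)))))))
      where
      S = ∑-linear (allFin (patterns q r))
      Y = vec (uniformFin s) r
      p = Vec.map e w
      x : Fin (patterns q r) → R
      x π = E Y (λ y → hit π p (Vec.map e y))
      lhs : E Y (λ y → Φ (pattern′ p (Vec.map e y))) ≡ ∑ (allFin (patterns q r)) (λ π → x π * Φ π)
      lhs = trans (Dist.ext Y (λ y → sym (∑-𝟙 (pattern′ p (Vec.map e y)) Φ))) (trans (Dist.fubini Y S _) (Linear.ext S (λ π → Dist.scaleʳ Y _ _)))
      rhs : mean n r (λ v → Φ (pattern′ p v)) ≡ ∑ (allFin (patterns q r)) (λ π → frequency π p * Φ π)
      rhs = trans (Linear.ext (mean-linear n r) (λ v → sym (∑-𝟙 (pattern′ p v) Φ)))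
        (trans (sym (∑-swap (allFin (patterns q r)) (mean-linear n r) _)) (Linear.ext S (λ π → Linear.scaleʳ (mean-linear n r) _ _)))
      at : ∀ π → x π * Φ π ≤ frequency π p * Φ π + (l + (x π - frequency π p) * (x π - frequency π p) * l ⁻¹)
      at π = ≤-trans (≤-reflexive (solve 3 (λ x f t → x :* t := f :* t :+ (x :- f) :* t) refl (x π) (frequency π p) (Φ π)))
        (+-mono ≤-refl (≤-trans (*-monoʳ (Φ≥0 π) (≤-trans (x≤∣x∣ _) (amgm _ l>0)))
          (≤-trans (*-monoˡ (≤-trans (∣x∣-nonneg _) (amgm (x π - frequency π p) l>0)) (Φ≤1 π)) (≤-reflexive (*-identityʳ _)))))

    module _ (n≥1 : 1 ℕ.≤ n) where

      hit≥0 : ∀ {q} π (p : Vec (Fin n) q) u → 0# ≤ hit π p u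
      hit≥0 π p u = 𝟙-nonneg (pattern′ p u Fin.≟ π)

      hit≤1 : ∀ {q} π (p : Vec (Fin n) q) u → hit π p u ≤ 1#
      hit≤1 π p u = 𝟙≤1 (pattern′ p u Fin.≟ π)

      frequency≥0 : ∀ {q} π (p : Vec (Fin n) q) → 0# ≤ frequency π p
      frequency≥0 π p = ≤-trans (≤-reflexive (sym (mean-const r n≥1 0#))) (mean-mono r n≥1 (hit≥0 π p))

      frequency≤1 : ∀ {q} π (p : Vec (Fin n) q) → frequency π p ≤ 1#
      frequency≤1 π p = ≤-trans (mean-mono r n≥1 (hit≤1 π p)) (≤-reflexive (mean-const r n≥1 1#))

      product≤1 : ∀ {x y} → ∣ x ∣ ≤ 1# → ∣ y ∣ ≤ 1# → x * y ≤ 1#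
      product≤1 {x} {y} p q with ≤-total 0# y
      ... | inj₁ y≥0 = ≤-trans (*-monoʳ y≥0 (≤-trans (x≤∣x∣ x) p)) (≤-trans (≤-reflexive (*-identityˡ y)) (≤-trans (x≤∣x∣ y) q))
      ... | inj₂ y≤0 = ≤-trans (≤-reflexive (solve 2 (λ x y → x :* y := (:- x) :* (:- y)) refl x y))
              (≤-trans (*-monoʳ (≤-trans (≤-reflexive (sym -0#≈0#)) (neg-mono y≤0)) (≤-trans (-x≤∣x∣ x) p))
                (≤-trans (≤-reflexive (*-identityˡ _)) (≤-trans (-x≤∣x∣ y) q)))

      centred : ∀ {q} π (p : Vec (Fin n) q) u → ∣ hit π p u - frequency π p ∣ ≤ 1#
      centred π p u = ∣-∣≤ (≤-trans (hit≤1 π p u) (≤-by (frequency≥0 π p) (+-comm _ _))) (≤-trans (frequency≤1 π p) (≤-by (hit≥0 π p u) (+-comm _ _)))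

      covariance≤1 : ∀ {q} π (p : Vec (Fin n) q) u u′ → covariance π p u u′ ≤ 1#
      covariance≤1 π p u u′ = product≤1 (centred π p u) (centred π p u′)

      -1≤covariance : ∀ {q} π (p : Vec (Fin n) q) u u′ → 0# ≤ covariance π p u u′ + 1#
      -1≤covariance π p u u′ = ≤-trans (≤⇒0≤ (product≤1 {frequency π p - hit π p u} {hit π p u′ - frequency π p} (≤-trans (∣x-y∣-sym _ _) (centred π p u)) (centred π p u′)))
        (≤-reflexive (solve 3 (λ a f b → :1 :- (f :- a) :* (b :- f) := (a :- f) :* (b :- f) :+ :1) refl (hit π p u) (frequency π p) (hit π p u′)))

    -- Over tuples from the whole vertex set the two factors are independent and centred at their
    -- true mean.
    mean-covariance : 1 ℕ.≤ n → ∀ q π → mean n (q ℕ.+ (r ℕ.+ r)) (flatCovariance {q} π) ≡ 0#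
    mean-covariance n≥1 q π = zeroMean n≥1 refl
      where
      -- The order is generalised in order to expose it as a successor, over which `vec` can draw.
      zeroMean : ∀ {n′} → 1 ℕ.≤ n′ → (e : n′ ≡ n) → mean n′ (q ℕ.+ (r ℕ.+ r)) (λ x → flatCovariance {q} π (subst (λ N → Vec (Fin N) (q ℕ.+ (r ℕ.+ r))) e x)) ≡ 0#
      zeroMean {suc n′} _ refl = trans (sym (mean-E n′ (q ℕ.+ (r ℕ.+ r)) _)) (trans (vec-++ U q (r ℕ.+ r) _)
        (trans (Dist.ext W inner) (Dist.const W 0#)))
        where
        U = uniformFin n′
        W = vec U q
        Y = vec U r
        inner : ∀ p → E (vec U (r ℕ.+ r)) (λ x → flatCovariance {q} π (p Vec.++ x)) ≡ 0#
        inner p = trans (vec-++ U r r _) (trans (Dist.ext Y (λ u → Dist.ext Y (λ u′ → flatCovariance-++ π p u u′)))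
          (trans (Dist.ext Y (λ u → Dist.scale Y _ _)) (trans (Dist.scaleʳ Y _ _)
            (trans (cong (_* E Y (λ u′ → hit π p u′ - frequency π p)) centre) (zeroˡ _)))))
          where
          centre : E Y (λ u → hit π p u - frequency π p) ≡ 0#
          centre = trans (Dist.sub Y _ _) (trans (cong₂ _-_ (mean-E n′ r (hit π p)) (Dist.const Y _)) (-‿inverseʳ _))

    -- A covariance lies between -1 and 1. Raised by 1 it fits `sampling` with upper bound 2, the
    -- factor in the result; its mean over all tuples is then 1 by `mean-covariance`, and the shift
    -- cancels.
    deviation-average : ∀ {s q} → 1 ℕ.≤ s → q ℕ.+ (r ℕ.+ r) ℕ.≤ s → s ℕ.≤ n →
      avgSub n s (λ X → deviation (size X) (emb X) q) ≤
      fromℕ (patterns q r) * ((1# + 1#) * (fromℕ ((q ℕ.+ (r ℕ.+ r)) ℕ.* (q ℕ.+ (r ℕ.+ r))) * fromℕ s ⁻¹))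
    deviation-average {s} {q} s≥1 t≤s s≤n = ≤-trans (≤-reflexive (sym (∑-swap (allFin (patterns q r)) (avgSub-linear n s) _)))
        (≤-trans (∑-mono (allFin (patterns q r)) per) (≤-reflexive (∑-allFin-const (patterns q r) _)))
      where
      t = q ℕ.+ (r ℕ.+ r)
      err = (1# + 1#) * (fromℕ (t ℕ.* t) * fromℕ s ⁻¹)
      n≥1 = ℕ.≤-trans s≥1 s≤n
      per : ∀ π → avgSub n s (λ X → mean (size X) t (λ x → flatCovariance {q} π (Vec.map (emb X) x))) ≤ err
      per π = ≤-trans (≤-reflexive (solve 1 (λ x → x := (x :+ :1) :- :1) refl _))
        (≤-trans (+-mono (≤-trans (≤-reflexive shift) (≤-trans (sampling t s≥1 t≤s s≤n (λ x → flatCovariance {q} π x + 1#)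
              (λ x → -1≤covariance n≥1 π (take q x) (take r (drop q x)) (drop r (drop q x))) (λ x → +-mono (covariance≤1 n≥1 π (take q x) (take r (drop q x)) (drop r (drop q x))) ≤-refl))
            (≤-reflexive (cong (_+ err) (trans (Linear.add (mean-linear n t) _ _) (cong₂ _+_ (mean-covariance n≥1 q π) (mean-const t n≥1 1#))))))) ≤-refl)
          (≤-reflexive (solve 1 (λ e → :0 :+ :1 :+ e :- :1 := e) refl err)))
        where
        shift : avgSub n s (λ X → mean (size X) t (λ x → flatCovariance {q} π (Vec.map (emb X) x))) + 1# ≡
                avgSub n s (λ X → mean (size X) t (λ x → flatCovariance {q} π (Vec.map (emb X) x) + 1#))
        shift = trans (cong (avgSub n s (λ X → mean (size X) t (λ x → flatCovariance {q} π (Vec.map (emb X) x))) +_) (sym (avgSub-const s≤n 1#))) (trans (sym (Linear.add (avgSub-linear n s) _ _))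
          (cong (_* fromℕ (n choose s) ⁻¹) (∑Sub-local n s (λ { X refl → sym (trans (Linear.add (mean-linear (size X) t) _ _)
            (cong (mean (size X) t (λ x → flatCovariance {q} π (Vec.map (emb X) x)) +_) (mean-const t s≥1 1#))) }))))

  -- The choices run `l₁`, `η₁`, `N₁`, `l₂`, `η₂`, `N₂`, `l₃`, `ξ`: fewer than `N₁` blocks of r
  -- pivots bound the number of labels, and fewer than `N₂` further blocks the number of patterns.
  -- The five errors are at most `a` each.
  record Constants (k r : ℕ) (a : R) : Set where
    field
      l₁ η₁ l₂ η₂ l₃ ξ : R
      N₁ N₂ : ℕ
      l₁>0 : 0# < l₁
      l₂>0 : 0# < l₂
      l₃>0 : 0# < l₃
      ξ>0  : 0# < ξ
      pair-error  : fromℕ (length (pairs r)) * (fromℕ (k ℕ.* k) * l₁ + η₁ * l₁ ⁻¹) ≤ a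
      pair-steps  : fromℕ (k ℕ.* k) < fromℕ N₁ * η₁
      label-error : fromℕ (length (allFin r)) * (fromℕ ((k ℕ.* k) ^ (N₁ ℕ.* r)) * l₂) ≤ a
      label-gain  : fromℕ (length (allFin r)) * (η₂ * l₂ ⁻¹) ≤ a
      label-steps : fromℕ ((k ℕ.* k) ^ (N₁ ℕ.* r)) < fromℕ N₂ * η₂
      pattern-error : fromℕ (patterns (N₂ ℕ.* r) r) * l₃ ≤ a
      pattern-gain  : ξ * l₃ ⁻¹ ≤ a

-- Transporting a colouring from a sample to the graph

module Transport (ℝ : RealField) where
  open Direction ℝ public

  -- Adjoining a random r-tuple to ℓ blocks of pivots gives ℓ + 1 blocks, so the expected gain is an
  -- increment of the expected energy and `small-increment` applies. Hence pivots come in blocks as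
  -- long as a test tuple.
  choose-pivots : ∀ {s} r (En : ∀ {q} → Vec (Fin (suc s)) q → R) {η T} N →
    (∀ {q} (z : Vec (Fin (suc s)) q) → 0# ≤ En z) → (∀ {q} (z : Vec (Fin (suc s)) q) → En z ≤ T) → T < fromℕ N * η →
    ∃ λ ℓ → ℓ ℕ.< N × E (vec (uniformFin s) (ℓ ℕ.* r)) (λ z → E (vec (uniformFin s) r) (λ y → En (y Vec.++ z)) - En z) ≤ η
  choose-pivots {s} r En {η} N En≥0 En≤T big with small-increment (λ ℓ → E (vec (uniformFin s) (ℓ ℕ.* r)) En) N
      (λ ℓ → Dist.const≤ (vec (uniformFin s) (ℓ ℕ.* r)) En≥0) (λ ℓ → Dist.≤const (vec (uniformFin s) (ℓ ℕ.* r)) En≤T) big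
  ... | ℓ , ℓ<N , p = ℓ , ℓ<N , ≤-trans (≤-reflexive (trans (Dist.sub W _ _) (cong (_- E W En)
          (trans (Dist.fubini W (Dist.linear Y) (λ z y → En (y Vec.++ z))) (sym (vec-++ (uniformFin s) r (ℓ ℕ.* r) En))))))
        (≤-by (≤⇒0≤ p) (solve 3 (λ η x y → η := (x :- y) :+ ((y :+ η) :- x)) refl η _ _))
    where
    W = vec (uniformFin s) (ℓ ℕ.* r)
    Y = vec (uniformFin s) r

  patterns-mono : ∀ {q q′} r → q ℕ.≤ q′ → patterns q r ℕ.≤ patterns q′ r
  patterns-mono r p = ℕ.*-monoˡ-≤ ((2 ^ r) ^ r) (ℕ.^-monoˡ-≤ r (ℕ.^-monoʳ-≤ 2 p))

  module Core {n s : ℕ} (G : Graph (suc n)) (H : Graph (suc s)) (e : Fin (suc s) → Fin (suc n))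
    (embeds : ∀ a b → adj G (e a) (e b) ≡ adj H a b)
    {k : ℕ} (m : ℕ) (J : ColDigraph k (suc s)) (low high : Fin k)
    (shadow : ∀ a b → (isLow m (J a b) ∨ isLow m (J b a)) ≡ adj H a b) (J-diag : ∀ a b → J a a ≡ J b b)
    (low-low : isLow m low ≡ true) (high-high : isLow m high ≡ false) {r : ℕ}
    (g : ColDigraph k r → R) (g-cong : ∀ {C C′} → C ≈ C′ → g C ≡ g C′)
    (g≥0 : ∀ C → 0# ≤ g C) (g≤1 : ∀ C → g C ≤ 1#) {a : R} (κ : Constants k r a) where

    open Constants κ
    open Recolour m H J low high shadow J-diag r

    private
      Y = vec (uniformFin s) r
      V = vec (uniformFin n) r

    module WithPivots {q} (z : Vec (Fin (suc s)) q) (gain : E Y (λ y → pairEnergy (y Vec.++ z)) - pairEnergy z ≤ η₁)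
                      (q≤ : q ℕ.≤ N₁ ℕ.* r) where

      labelCode : Code (Vec (Fin k × Fin k) q)
      labelCode = code-Vec (code-× (code-Fin k) (code-Fin k)) q

      T : ℕ
      T = (k ℕ.* k) ^ q

      ℓ : Fin (suc s) → Fin T
      ℓ a = Code.enc labelCode (label z a)

      decode : Fin T → Vec (Fin k × Fin k) q
      decode = Code.dec labelCode

      open Labels H ℓ r using (typeEnergy; typeConditioning; relabel; relabelAt; relabel-bound)

      C₀ : ColDigraph k r
      C₀ _ _ = high

      val : Vec (Fin T) r → Matrix r → R
      val ζ M = recolour g g-cong g≥0 g≤1 z (pairs r) (Vec.map decode ζ) M C₀

      val≥0 : ∀ ζ M → 0# ≤ val ζ M
      val≥0 ζ M = resample≥ g≥0 (pairs r) C₀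

      val≤1 : ∀ ζ M → val ζ M ≤ 1#
      val≤1 ζ M = resample≤ g≤1 (pairs r) C₀

      k≥1 : 1 ℕ.≤ k ℕ.* k
      k≥1 = pos k low
        where pos : ∀ k → Fin k → 1 ℕ.≤ k ℕ.* k
              pos (suc k) _ = ℕ.s≤s ℕ.z≤n

      T≤ : T ℕ.≤ (k ℕ.* k) ^ (N₁ ℕ.* r)
      T≤ = ℕ.^-monoʳ-≤ (k ℕ.* k) {{ℕ.>-nonZero k≥1}} q≤

      -- `recolour-bound` passes from the true colours to a redraw of all pairs. That overwrites
      -- every colour, so it may start from `C₀` and sees the tuple only through its labels and
      -- adjacencies.
      step₁ : E Y (λ y → g (restrict g g-cong g≥0 g≤1 z y)) ≤ E Y (λ y → val (Vec.map ℓ y) (matrix (adj H) y)) + a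
      step₁ = ≤-trans (diff≤′ (recolour-bound g g-cong g≥0 g≤1 z (pairs r) (All.map Fin.<⇒≢ (pairs-< r)) l₁>0))
        (+-mono (≤-reflexive (Dist.ext Y (λ y → trans
            (recolour-cover g g-cong g≥0 g≤1 z (pairs r) (Vec.map (label z) y) (matrix (adj H) y) (cover y))
            (cong (λ ζ → recolour g g-cong g≥0 g≤1 z (pairs r) ζ (matrix (adj H) y) C₀) (labels y)))))
          (≤-trans (*-monoˡ (fromℕ-nonneg (length (pairs r))) (+-mono ≤-refl (*-monoʳ (proj₁ (⁻¹-pos l₁>0)) gain))) pair-error))
        where
        labels : ∀ y → Vec.map (label z) y ≡ Vec.map decode (Vec.map ℓ y)
        labels y = trans (Vec.map-cong (λ a → sym (Code.dec-enc labelCode (label z a))) y) (Vec.map-∘ decode ℓ y)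
        cover : ∀ y p q → p ≢ q → (p , q) ∈ pairs r ⊎ (q , p) ∈ pairs r ⊎ restrict g g-cong g≥0 g≤1 z y p q ≡ C₀ p q
        cover y p q p≢q with pairs-cover r p q p≢q
        ... | inj₁ x = inj₁ x
        ... | inj₂ x = inj₂ (inj₁ x)

      ζ₀ : Vec (Fin T) r
      ζ₀ = Vec.replicate r (ℓ zero)

      all : List (Fin r)
      all = allFin r

      relabel-cover : ∀ {q′} (w : Vec (Fin (suc s)) q′) is τs M {ζ ζ′} → (∀ i → i ∈ is ⊎ lookup ζ i ≡ lookup ζ′ i) →
        relabel val val≥0 val≤1 w is τs M ζ ≡ relabel val val≥0 val≤1 w is τs M ζ′
      relabel-cover w is τs M = resample-rel (λ ζ is ζ′ → ∀ i → i ∈ is ⊎ lookup ζ i ≡ lookup ζ′ i)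
        (λ {ζ} {ζ′} {i} {is} h → step {ζ} {ζ′} {i} {is} h)
        (λ {ζ} {ζ′} h → cong (λ ζ → val ζ M) (vec-ext {xs = ζ} {ys = ζ′} (λ i → done (h i)))) is
        where
        done : ∀ {i : Fin r} {X : Set} → i ∈ [] ⊎ X → X
        done (inj₂ x) = x
        step : ∀ {ζ ζ′ : Vec (Fin T) r} {i is} → (∀ j → j ∈ (i ∷ is) ⊎ lookup ζ j ≡ lookup ζ′ j) →
          ∀ b j → j ∈ is ⊎ lookup (ζ [ i ]≔ ℓ b) j ≡ lookup (ζ′ [ i ]≔ ℓ b) j
        step {ζ} {ζ′} {i} h b j with j Fin.≟ i
        ... | yes refl = inj₂ (trans (Vec.lookup∘update j ζ (ℓ b)) (sym (Vec.lookup∘update j ζ′ (ℓ b))))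
        ... | no j≢i with h j
        ...   | inj₁ (here e) = ⊥-elim (j≢i e)
        ...   | inj₁ (there x) = inj₁ x
        ...   | inj₂ x = inj₂ (trans (Vec.lookup∘update′ j≢i ζ (ℓ b)) (trans x (sym (Vec.lookup∘update′ j≢i ζ′ (ℓ b)))))

      open Deviation G r

      module _ {q′} (w : Vec (Fin (suc s)) q′) where

        private
          p = Vec.map e w

        -- Once labels are redrawn too, a tuple matters only through its pattern over the pivots, a
        -- finite statistic that makes sense in `H` and in `G`.
        Φ : Fin (patterns q′ r) → R
        Φ π = relabel val val≥0 val≤1 w all (proj₁ (Code.dec (patternCode q′ r) π)) (proj₂ (Code.dec (patternCode q′ r) π)) ζ₀

        Φ≥0 : ∀ π → 0# ≤ Φ π
        Φ≥0 π = resample≥ (λ ζ → val≥0 ζ (proj₂ (Code.dec (patternCode q′ r) π))) all ζ₀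

        Φ≤1 : ∀ π → Φ π ≤ 1#
        Φ≤1 π = resample≤ (λ ζ → val≤1 ζ (proj₂ (Code.dec (patternCode q′ r) π))) all ζ₀

        Φ-pattern : ∀ v → Φ (pattern′ p v) ≡ relabel val val≥0 val≤1 w all (Vec.map (types (adj G) p) v) (matrix (adj G) v) ζ₀
        Φ-pattern v = cong (λ (τs , M) → relabel val val≥0 val≤1 w all τs M ζ₀) (Code.dec-enc (patternCode q′ r) (Vec.map (types (adj G) p) v , matrix (adj G) v))

        typeGain : R
        typeGain = E Y (λ y → typeEnergy (y Vec.++ w)) - typeEnergy w

        outcome labelLoss patternLoss : R
        outcome = E V (λ v → relabel val val≥0 val≤1 w all (Vec.map (types (adj G) p) v) (matrix (adj G) v) ζ₀)
        labelLoss = fromℕ (length all) * (fromℕ T * l₂ + typeGain * l₂ ⁻¹)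
        patternLoss = fromℕ (patterns q′ r) * l₃ + localDeviation e w * l₃ ⁻¹

        step₂ : E Y (λ y → val (Vec.map ℓ y) (matrix (adj H) y)) ≤ outcome + (labelLoss + patternLoss)
        step₂ = ≤-trans (diff≤′ (relabel-bound val val≥0 val≤1 w all l₂>0)) (≤-trans (+-mono (≤-trans (≤-reflexive (Dist.ext Y observe))
            (transfer e w Φ Φ≥0 Φ≤1 l₃>0)) ≤-refl)
          (≤-reflexive (trans (cong (λ x → x + patternLoss + labelLoss) (trans (sym (mean-E n r (λ v → Φ (pattern′ p v)))) (Dist.ext V Φ-pattern)))
            (solve 3 (λ x y z → x :+ y :+ z := x :+ (z :+ y)) refl outcome patternLoss labelLoss))))
          where
          observe : ∀ y → relabelAt val val≥0 val≤1 w all y ≡ Φ (pattern′ p (Vec.map e y))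
          observe y = trans (relabel-cover w all (Vec.map (types (adj H) w) y) (matrix (adj H) y) {Vec.map ℓ y} {ζ₀} (λ i → inj₁ (∈-allFin i))) (sym (trans (Φ-pattern (Vec.map e y))
            (cong₂ (λ τs M → relabel val val≥0 val≤1 w all τs M ζ₀)
              (trans (sym (Vec.map-∘ (types (adj G) p) e y)) (Vec.map-cong (λ a → trans (sym (Vec.map-∘ (adj G (e a)) e w)) (Vec.map-cong (embeds a) w)) y))
              (matrix-cong (adj G) (adj H) (Vec.map e y) y (λ i j → trans (cong₂ (adj G) (Vec.lookup-map i e y) (Vec.lookup-map j e y)) (embeds _ _))))))

        -- Labels are lifted first, and the resulting map then prescribes the kernels for the
        -- colours. Each of the two derandomisations costs one collision term.
        step₃ : ∃ λ (L : ColDigraph k (suc n)) → HasShadow m L G ×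
          outcome ≤ E V (λ v → g (λ i j → L (lookup v i) (lookup v j))) + (collision V + collision V)
        step₃ =
          let ρ , h₁ = LiftLabels.lift-labels H ℓ val val≥0 val≤1 w G (types (adj G) p) V ζ₀
              L , sh , h₂ = LiftColours.lift-colours m H J low high shadow J-diag low-low high-high g g-cong g≥0 g≤1 z G (decode ∘ ρ) V C₀
          in L , sh , ≤-trans h₁ (≤-trans (+-mono (≤-trans (≤-reflexive (Dist.ext V (λ v →
                  cong (λ ζ → recolour g g-cong g≥0 g≤1 z (pairs r) ζ (matrix (adj G) v) C₀) (sym (Vec.map-∘ decode ρ v))))) h₂) ≤-refl)
                  (≤-reflexive (+-assoc _ _ _)))

      transport : (∀ ℓ → ℓ ℕ.< N₂ → deviation (suc s) e (ℓ ℕ.* r) ≤ ξ) →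
        ∃ λ (L : ColDigraph k (suc n)) → HasShadow m L G ×
        E Y (λ y → g (restrict g g-cong g≥0 g≤1 z y)) ≤
        E V (λ v → g (λ i j → L (lookup v i) (lookup v j))) + (collision V + collision V + (a + a + a + a + a))
      transport dev =
        let ℓ₂ , ℓ₂<N₂ , gain₂ = choose-pivots r typeEnergy {η₂} {fromℕ T} N₂ (λ w → energy-nonneg ℓ (typeConditioning w))
                                   (λ w → energy≤ ℓ (typeConditioning w)) (≤-<-trans (fromℕ-mono T≤) label-steps)
        in conclude ℓ₂ ℓ₂<N₂ gain₂
        where
        A : R
        A = fromℕ (length all)
        conclude : ∀ ℓ₂ → ℓ₂ ℕ.< N₂ → E (vec (uniformFin s) (ℓ₂ ℕ.* r)) typeGain ≤ η₂ →
          ∃ λ (L : ColDigraph k (suc n)) → HasShadow m L G ×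
          E Y (λ y → g (restrict g g-cong g≥0 g≤1 z y)) ≤
          E V (λ v → g (λ i j → L (lookup v i) (lookup v j))) + (collision V + collision V + (a + a + a + a + a))
        conclude ℓ₂ ℓ₂<N₂ gain₂ =
          -- Label gain and pattern deviation are controlled only on average over `w`; minimising
          -- their weighted sum yields pivots that are good enough for both.
          let w , good = Dist.attain-low W loss
              L , sh , h₃ = step₃ w
          in L , sh , ≤-trans step₁ (≤-trans (+-mono (≤-trans (step₂ w) (+-mono h₃ (errors w good))) ≤-refl)
              (≤-reflexive (solve 3 (λ x c a → x :+ c :+ (a :+ a :+ (a :+ a)) :+ a := x :+ (c :+ (a :+ a :+ a :+ a :+ a)))
                refl (E V (λ v → g (λ i j → L (lookup v i) (lookup v j)))) (collision V + collision V) a)))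
          where
          W = vec (uniformFin s) (ℓ₂ ℕ.* r)
          loss : Vec (Fin (suc s)) (ℓ₂ ℕ.* r) → R
          loss w = A * (typeGain w * l₂ ⁻¹) + localDeviation e w * l₃ ⁻¹
          average : E W loss ≤ a + a
          average = ≤-trans (≤-reflexive (trans (Dist.add W _ _) (cong₂ _+_ (trans (Dist.scale W _ _) (cong (A *_) (Dist.scaleʳ W _ _)))
              (trans (Dist.scaleʳ W _ _) (cong (_* l₃ ⁻¹) (sym (deviation-E e (ℓ₂ ℕ.* r))))))))
            (+-mono (≤-trans (*-monoˡ (fromℕ-nonneg (length all)) (*-monoʳ (proj₁ (⁻¹-pos l₂>0)) gain₂)) label-gain)
              (≤-trans (*-monoʳ (proj₁ (⁻¹-pos l₃>0)) (dev ℓ₂ ℓ₂<N₂)) pattern-gain))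
          errors : ∀ w → loss w ≤ E W loss → labelLoss w + patternLoss w ≤ a + a + (a + a)
          errors w good = ≤-trans (≤-reflexive (solve 5 (λ A t g p d → A :* (t :+ g) :+ (p :+ d) := (A :* t :+ p) :+ (A :* g :+ d)) refl A (fromℕ T * l₂) (typeGain w * l₂ ⁻¹) (fromℕ (patterns (ℓ₂ ℕ.* r) r) * l₃) (localDeviation e w * l₃ ⁻¹)))
            (+-mono (+-mono (≤-trans (*-monoˡ (fromℕ-nonneg (length all)) (*-monoʳ (proj₁ l₂>0) (fromℕ-mono T≤))) label-error)
                            (≤-trans (*-monoʳ (proj₁ l₃>0) (fromℕ-mono (patterns-mono r (ℕ.*-monoˡ-≤ r (ℕ.<⇒≤ ℓ₂<N₂))))) pattern-error))
              (≤-trans good average))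

    -- The hypothesis covers every number of blocks below `N₂`: the one eventually used depends on
    -- `J` through the labels, whereas the quality of a sample has to be judged from adjacencies
    -- alone.
    transport : (∀ ℓ → ℓ ℕ.< N₂ → Deviation.deviation G r (suc s) e (ℓ ℕ.* r) ≤ ξ) →
      ∃ λ (L : ColDigraph k (suc n)) → HasShadow m L G ×
      E Y (λ y → g (λ i j → J (lookup y i) (lookup y j))) ≤
      E V (λ v → g (λ i j → L (lookup v i) (lookup v j))) + (collision V + collision V + (a + a + a + a + a))
    transport dev =
      let ℓ₁ , ℓ₁<N₁ , gain₁ = choose-pivots r pairEnergy {η₁} {fromℕ (k ℕ.* k)} N₁ (λ z → energy-nonneg colourIndex (pairConditioning z))
                                 (λ z → energy≤ colourIndex (pairConditioning z)) pair-steps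
          z , good = Dist.attain-low (vec (uniformFin s) (ℓ₁ ℕ.* r)) (λ z → E Y (λ y → pairEnergy (y Vec.++ z)) - pairEnergy z)
      in WithPivots.transport z (≤-trans good gain₁) (ℕ.*-monoˡ-≤ r (ℕ.<⇒≤ ℓ₁<N₁)) dev

-- Choice of constants and the probability estimate

module Eventually (ℝ : RealField) where
  open Transport ℝ public

  -- If `x` bounded all natural numbers, their supremum lowered by 1 would still bound them.
  -- Completeness refutes the absence of `N` but does not exhibit one.
  archimedean : ∀ x → ¬ ¬ (∃ λ N → x < fromℕ N)
  archimedean x none =
    let s , upper , least = complete (λ y → ∃ λ N → y ≡ fromℕ N) (0# , 0 , refl) (x , λ { _ (N , refl) → ≮⇒≥ (λ p → none (N , p)) })
    in <⇒≱ 0<1 (≤-by (≤⇒0≤ (least (s - 1#) (λ { _ (N , refl) →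
          ≤-by (≤⇒0≤ (upper _ (suc N , refl))) (solve 2 (λ s n → s :- :1 := n :+ (s :- (:1 :+ n))) refl s (fromℕ N)) })))
        (solve 1 (λ s → :0 := :1 :+ ((s :- :1) :- s)) refl s))

  small : ∀ {C a} → 0# ≤ C → 0# < a → ∃ λ l → 0# < l × C * l ≤ a
  small {C} {a} C≥0 a>0 = a * D ⁻¹ , *-pos a>0 (⁻¹-pos D>0) ,
      ≤-trans (≤-reflexive (sym (*-assoc C a _))) (div-≤ D>0 (≤-by (proj₁ a>0) (solve 2 (λ C a → a :* (:1 :+ C) := C :* a :+ a) refl C a)))
    where
    -- Positive even for C = 0.
    D = 1# + C
    D>0 : 0# < D
    D>0 = +-pos 0<1 C≥0

  small₂ : ∀ {C a D b} → 0# ≤ C → 0# < a → 0# ≤ D → 0# < b → ∃ λ l → 0# < l × C * l ≤ a × D * l ≤ b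
  small₂ {C} {a} {D} {b} C≥0 a>0 D≥0 b>0 = least (small C≥0 a>0) (small D≥0 b>0)
    where
    least : (∃ λ l → 0# < l × C * l ≤ a) → (∃ λ l → 0# < l × D * l ≤ b) → ∃ λ l → 0# < l × C * l ≤ a × D * l ≤ b
    least (l , l>0 , p) (l′ , l′>0 , q) with ≤-total l l′
    ... | inj₁ l≤l′ = l , l>0 , p , ≤-trans (*-monoˡ D≥0 l≤l′) q
    ... | inj₂ l′≤l = l′ , l′>0 , ≤-trans (*-monoˡ C≥0 l′≤l) p , q

  part : ∀ n {a} → 0# < a → ∃ λ h → 0# < h × fromℕ (suc n) * h ≡ a
  part n {a} a>0 = a * fromℕ (suc n) ⁻¹ , *-pos a>0 (⁻¹-pos (fromℕ-pos {suc n} (ℕ.s≤s ℕ.z≤n))) ,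
    trans (*-comm _ _) (*⁻¹-cancelʳ′ a (fromℕ-pos {suc n} (ℕ.s≤s ℕ.z≤n)))

  many : ∀ x {η} → 0# < η → ¬ ¬ (∃ λ N → x < fromℕ N * η)
  many x {η} η>0 none = archimedean (x * η ⁻¹) (λ (N , p) → none (N ,
    subst (_< fromℕ N * η) (*⁻¹-cancelʳ′ x η>0) (*-monoʳ-< η>0 p)))

  -- Both step numbers come from `many`, hence only up to double negation, and so the proof is a
  -- refutation in stages. The first stage halves `a` because its error has two summands.
  constants-exist : ∀ k r {a} → 0# < a → ¬ ¬ Constants k r a
  constants-exist k r {a} a>0 none = stage₁ (part 1 a>0)
    where
    P A T : R
    P = fromℕ (length (pairs r))
    A = fromℕ (length (allFin r))
    T = fromℕ (k ℕ.* k)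
    P≥0 : 0# ≤ P
    P≥0 = fromℕ-nonneg (length (pairs r))
    A≥0 : 0# ≤ A
    A≥0 = fromℕ-nonneg (length (allFin r))
    T₂ : ℕ → R
    T₂ N₁ = fromℕ ((k ℕ.* k) ^ (N₁ ℕ.* r))
    M : ℕ → R
    M N₂ = fromℕ (patterns (N₂ ℕ.* r) r)
    PairStage LabelStage : ℕ → Set
    PairStage N₁ = ∃ λ l → ∃ λ η → 0# < l × P * (T * l + η * l ⁻¹) ≤ a × T < fromℕ N₁ * η
    LabelStage N₁ = ∃ λ N₂ → ∃ λ l → ∃ λ η → 0# < l × A * (T₂ N₁ * l) ≤ a × A * (η * l ⁻¹) ≤ a × T₂ N₁ < fromℕ N₂ * η
    stage₃ : ∀ N₁ → PairStage N₁ → (label : LabelStage N₁) → (∃ λ l → 0# < l × M (proj₁ label) * l ≤ a) → ⊥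
    stage₃ N₁ (l₁ , η₁ , l₁>0 , e₁ , s₁) (N₂ , l₂ , η₂ , l₂>0 , e₂ , g₂ , s₂) (l₃ , l₃>0 , e₃) = finish (small (proj₁ (⁻¹-pos l₃>0)) a>0)
      where
      finish : (∃ λ ξ → 0# < ξ × l₃ ⁻¹ * ξ ≤ a) → ⊥
      finish (ξ , ξ>0 , g₃) = none (record
        { l₁ = l₁ ; η₁ = η₁ ; l₂ = l₂ ; η₂ = η₂ ; l₃ = l₃ ; ξ = ξ ; N₁ = N₁ ; N₂ = N₂
        ; l₁>0 = l₁>0 ; l₂>0 = l₂>0 ; l₃>0 = l₃>0 ; ξ>0 = ξ>0
        ; pair-error = e₁ ; pair-steps = s₁ ; label-error = e₂ ; label-gain = g₂ ; label-steps = s₂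
        ; pattern-error = e₃ ; pattern-gain = ≤-trans (≤-reflexive (*-comm _ _)) g₃ })
    stage₂ : ∀ N₁ → PairStage N₁ → ⊥
    stage₂ N₁ pair = choose (small (*-nonneg′ A≥0 (fromℕ-nonneg ((k ℕ.* k) ^ (N₁ ℕ.* r)))) a>0)
      where
      choose′ : ∀ l → 0# < l → A * T₂ N₁ * l ≤ a → (∃ λ η → 0# < η × A * l ⁻¹ * η ≤ a) → ⊥
      choose′ l l>0 p (η , η>0 , q) = many (T₂ N₁) η>0 λ (N₂ , steps) → stage₃ N₁ pair
        (N₂ , l , η , l>0 , ≤-trans (≤-reflexive (sym (*-assoc _ _ _))) p ,
          ≤-trans (≤-reflexive (solve 3 (λ A η i → A :* (η :* i) := A :* i :* η) refl A η (l ⁻¹))) q , steps)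
        (small (fromℕ-nonneg (patterns (N₂ ℕ.* r) r)) a>0)
      choose : (∃ λ l → 0# < l × A * T₂ N₁ * l ≤ a) → ⊥
      choose (l , l>0 , p) = choose′ l l>0 p (small (*-nonneg′ A≥0 (proj₁ (⁻¹-pos l>0))) a>0)
    stage₁ : (∃ λ h → 0# < h × fromℕ 2 * h ≡ a) → ⊥
    stage₁ (h , h>0 , hh) = choose (small (*-nonneg′ P≥0 (fromℕ-nonneg (k ℕ.* k))) h>0)
      where
      choose′ : ∀ l → 0# < l → P * T * l ≤ h → (∃ λ η → 0# < η × P * l ⁻¹ * η ≤ h) → ⊥
      choose′ l l>0 p (η , η>0 , q) = many T η>0 λ (N₁ , steps) → stage₂ N₁ (l , η , l>0 ,
        ≤-trans (≤-reflexive (solve 5 (λ P T l η i → P :* (T :* l :+ η :* i) := P :* T :* l :+ P :* i :* η) refl P T l η (l ⁻¹)))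
          (≤-trans (+-mono p q) (≤-reflexive (trans (solve 1 (λ h → h :+ h := (:1 :+ (:1 :+ :0)) :* h) refl h) hh))) , steps)
      choose : (∃ λ l → 0# < l × P * T * l ≤ h) → ⊥
      choose (l , l>0 , p) = choose′ l l>0 p (small (*-nonneg′ P≥0 (proj₁ (⁻¹-pos l>0))) h>0)

  -- The loss in `lower`: 3 for comparing the lifted colouring with its tuple mean, 2 for
  -- collisions, 5 for the errors in `Constants`, and 3 for comparing the colouring of the sample
  -- with its tuple mean.
  thirteen : ∀ x a → x + (a + a + a) + (a + a + (a + a + a + a + a)) + (a + a + a) ≡ x + fromℕ 13 * a
  thirteen x a = solve 2 (λ x a → x :+ (a :+ a :+ a) :+ (a :+ a :+ (a :+ a :+ a :+ a :+ a)) :+ (a :+ a :+ a) :=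
    x :+ (:1 :+ (:1 :+ (:1 :+ (:1 :+ (:1 :+ (:1 :+ (:1 :+ (:1 :+ (:1 :+ (:1 :+ (:1 :+ (:1 :+ (:1 :+ :0))))))))))))) :* a) refl x a

  -- The bounds of `deviation-average` without the factor 1/s, added up over all numbers of pivot
  -- blocks.
  budget : ℕ → ℕ → R
  budget N r = ∑ (allFin N) (λ ℓ → fromℕ (patterns (Fin.toℕ ℓ ℕ.* r) r) *
    ((1# + 1#) * fromℕ ((Fin.toℕ ℓ ℕ.* r ℕ.+ (r ℕ.+ r)) ℕ.* (Fin.toℕ ℓ ℕ.* r ℕ.+ (r ℕ.+ r)))))

  module Normalised {k m : ℕ} (m≥1 : 1 ℕ.≤ m) (m<k : m ℕ.< k) (g : DigraphParam ℝ k) (invariant : IsInvariantDigraphParam ℝ g)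
    (g≥0 : ∀ {n} (L : ColDigraph k n) → 0# ≤ g L) (g≤1 : ∀ {n} (L : ColDigraph k n) → g L ≤ 1#)
    (g′ : GraphParam ℝ) (shadowMax : ∀ {n} (G : Graph n) → IsShadowMax ℝ m g G (g′ G)) where

    open Digraphs g invariant public

    low high : Fin k
    low = Fin.fromℕ< (ℕ.≤-<-trans ℕ.z≤n m<k)
    high = Fin.fromℕ< m<k

    low-low : isLow m low ≡ true
    low-low rewrite Fin.toℕ-fromℕ< (ℕ.≤-<-trans ℕ.z≤n m<k) with 0 ℕ.<? m
    ... | yes _ = refl
    ... | no n = ⊥-elim (n m≥1)

    high-high : isLow m high ≡ false
    high-high rewrite Fin.toℕ-fromℕ< m<k with m ℕ.<? m
    ... | yes p = ⊥-elim (ℕ.<-irrefl refl p)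
    ... | no _ = refl

    -- With the diagonal outside the shadow, restrictions along tuples with repetitions keep the right shadow.
    clearDiagonal : ∀ {n} → ColDigraph k n → ColDigraph k n
    clearDiagonal J a b = if ⌊ a Fin.≟ b ⌋ then high else J a b

    clearDiagonal-≈ : ∀ {n} (J : ColDigraph k n) → clearDiagonal J ≈ J
    clearDiagonal-≈ J a b a≢b with a Fin.≟ b
    ... | yes e = ⊥-elim (a≢b e)
    ... | no _ = refl

    clearDiagonal-diag : ∀ {n} (J : ColDigraph k n) a b → clearDiagonal J a a ≡ clearDiagonal J b b
    clearDiagonal-diag J a b with a Fin.≟ a | b Fin.≟ b
    ... | yes _ | yes _ = refl
    ... | no n | _ = ⊥-elim (n refl)
    ... | _ | no n = ⊥-elim (n refl)

    clearDiagonal-shadow : ∀ {n} (J : ColDigraph k n) (H : Graph n) → HasShadow m J H → ∀ a b →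
      (isLow m (clearDiagonal J a b) ∨ isLow m (clearDiagonal J b a)) ≡ adj H a b
    clearDiagonal-shadow J H sh a b with a Fin.≟ b | b Fin.≟ a | sh a b
    ... | yes refl | yes _ | _ rewrite high-high = sym (Graph.irrefl H a)
    ... | yes e | no n | _ = ⊥-elim (n (sym e))
    ... | no n | yes e | _ = ⊥-elim (n (sym e))
    ... | no _ | no _ | h = h

    induced-shadow : ∀ {n} (G : Graph n) (X : Subset n) (L : ColDigraph k n) → HasShadow m L G → HasShadow m (inducedDigraph X L) (inducedGraph X G)
    induced-shadow G X L sh i j with i Fin.≟ j | emb X i Fin.≟ emb X j | sh (emb X i) (emb X j)
    ... | yes refl | _ | _ = sym (Graph.irrefl G (emb X i))
    ... | no i≢j | yes e | _ = ⊥-elim (i≢j (emb-injective X e))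
    ... | no _ | no _ | h = h

    WorksFor : R → R → ℕ → Set
    WorksFor ε δ r = 1 ℕ.≤ r × (∀ {n} (A : Graph n) → r ℕ.≤ n → prBad ℝ Graph inducedGraph g′ r ε A < δ)

    module Estimate {a : R} (a>0 : 0# < a) {r : ℕ} (r≥1 : 1 ℕ.≤ r)
      (est : ∀ {n} (L : ColDigraph k n) → r ℕ.≤ n → prBad ℝ (ColDigraph k) inducedDigraph g r a L < a)
      (κ : Constants k r a) (s′ : ℕ) (r≤s : r ℕ.≤ suc s′) (small-collision : fromℕ (r ℕ.* r) ≤ a * fromℕ (suc s′)) where

      open Constants κ

      s : ℕ
      s = suc s′

      a≥0 = proj₁ a>0

      collision≤ : ∀ {n} → s ℕ.≤ n → fromℕ (r ℕ.* r) * fromℕ n ⁻¹ ≤ a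
      collision≤ {suc n} s≤n = div-≤ (fromℕ-pos {suc n} (ℕ.s≤s ℕ.z≤n)) (≤-trans small-collision (*-monoˡ a≥0 (fromℕ-mono s≤n)))

      tuples : ∀ {n} (L : ColDigraph k n) → s ℕ.≤ n → mean n r (λ v → ∣ g L - g (along L v) ∣) ≤ a + a + a
      tuples L s≤n = ≤-trans (tuple-estimate g≥0 g≤1 a≥0 r≥1 est L (ℕ.≤-trans r≤s s≤n)) (+-mono ≤-refl (collision≤ s≤n))

      tuples-E : ∀ {n} (L : ColDigraph k (suc n)) → s ℕ.≤ suc n → ∣ g L - E (vec (uniformFin n) r) (λ v → g (along L v)) ∣ ≤ a + a + a
      tuples-E {n} L s≤n = ≤-trans (≤-reflexive (cong (λ x → ∣ x - E V (λ v → g (along L v)) ∣) (sym (Dist.const V (g L)))))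
        (≤-trans (Dist.∣E-E∣≤E V (λ v → ≤-refl)) (≤-trans (≤-reflexive (mean-E n r _)) (tuples L s≤n)))
        where V = vec (uniformFin n) r

      -- Estimability speaks of samples of size r, while the larger size s is needed. The parameters
      -- of `L` and of its restriction are both compared with that of a random r-tuple of `X`, which
      -- by `sampling` is nearly a random r-tuple of all vertices. The 7 is 3 for each comparison
      -- and 1 for sampling.
      restriction : ∀ {n} (L : ColDigraph k n) → s ℕ.≤ n →
        avgSub n s (λ X → ∣ g L - g (inducedDigraph X L) ∣) ≤ fromℕ 7 * a
      restriction {n} L s≤n = ≤-trans (avgSub-mono s≤n pointwise) (≤-trans (≤-reflexive (trans (Linear.add (avgSub-linear n s) _ _)
          (cong₂ _+_ refl (avgSub-const s≤n _)))) (≤-trans (+-mono (sampling r (ℕ.s≤s ℕ.z≤n) r≤s s≤n (λ v → ∣ g L - g (along L v) ∣)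
            (λ v → ∣x∣-nonneg _) (λ v → diff≤1 g≥0 g≤1 L (along L v))) ≤-refl)
          (≤-trans (+-mono (+-mono (tuples L s≤n) (≤-trans (≤-reflexive (*-identityˡ _)) (collision≤ ℕ.≤-refl))) ≤-refl)
            (≤-reflexive (solve 1 (λ a → a :+ a :+ a :+ a :+ (a :+ a :+ a) := (:1 :+ (:1 :+ (:1 :+ (:1 :+ (:1 :+ (:1 :+ (:1 :+ :0))))))) :* a) refl a)))))
        where
        pointwise : ∀ X → size X ≡ s → ∣ g L - g (inducedDigraph X L) ∣ ≤
          mean (size X) r (λ y → ∣ g L - g (along L (Vec.map (emb X) y)) ∣) + (a + a + a)
        pointwise X e = ≤-trans (≤-reflexive (sym (mean-const r N≥1 _))) (≤-trans (mean-mono r N≥1 at)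
          (≤-trans (≤-reflexive (Linear.add (mean-linear (size X) r) _ _)) (+-mono ≤-refl (tuples (inducedDigraph X L) (ℕ.≤-reflexive (sym e))))))
          where
          N≥1 : 1 ℕ.≤ size X
          N≥1 = ℕ.≤-trans (ℕ.s≤s ℕ.z≤n) (ℕ.≤-reflexive (sym e))
          at : ∀ y → ∣ g L - g (inducedDigraph X L) ∣ ≤ ∣ g L - g (along L (Vec.map (emb X) y)) ∣ + ∣ g (inducedDigraph X L) - g (along (inducedDigraph X L) y) ∣
          at y = ∣-∣-trans ≤-refl (≤-trans (≤-reflexive (cong (λ x → ∣ x - g (inducedDigraph X L) ∣)
              (g-cong (λ i j _ → cong₂ L (Vec.lookup-map i (emb X) y) (Vec.lookup-map j (emb X) y))))) (∣x-y∣-sym _ _))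

      lower : ∀ {n N} (G : Graph (suc n)) (H : Graph N) (e : Fin N → Fin (suc n)) → N ≡ s → s ℕ.≤ suc n →
        (∀ i j → adj G (e i) (e j) ≡ adj H i j) → (∀ ℓ → ℓ ℕ.< N₂ → Deviation.deviation G r N e (ℓ ℕ.* r) ≤ ξ) →
        g′ H ≤ g′ G + fromℕ 13 * a
      lower {n} G H e refl s≤n embeds dev = attained (proj₁ (shadowMax H))
        where
        V = vec (uniformFin n) r
        coll : collision V ≤ a
        coll = ≤-trans (collision-bound n r) (collision≤ s≤n)
        lifted : (J : ColDigraph k s) → (∃ λ (L : ColDigraph k (suc n)) → HasShadow m L G × E (vec (uniformFin s′) r) (λ y → g (along J y)) ≤
          E V (λ v → g (along L v)) + (collision V + collision V + (a + a + a + a + a))) → g J ≤ g′ G + fromℕ 13 * a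
        lifted J (L , sh , p) = ≤-trans (diff≤ (tuples-E J ℕ.≤-refl))
          (≤-trans (+-mono (≤-trans p (+-mono (≤-trans (diff≤′ (tuples-E L s≤n)) (+-mono (proj₂ (shadowMax G) L sh) ≤-refl)) (+-mono (+-mono coll coll) ≤-refl))) ≤-refl)
            (≤-reflexive (thirteen (g′ G) a)))
        attained : (∃ λ (J : ColDigraph k s) → HasShadow m J H × g J ≡ g′ H) → g′ H ≤ g′ G + fromℕ 13 * a
        attained (J , sh , e₀) = ≤-trans (≤-reflexive (trans (sym e₀) (sym (g-cong (clearDiagonal-≈ J))))) (lifted (clearDiagonal J)
          (Core.transport G H e embeds m (clearDiagonal J) low high (clearDiagonal-shadow J H sh) (clearDiagonal-diag J) low-low high-high
            g g-cong g≥0 g≤1 κ dev))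

      totalDeviation : ∀ {n} (G : Graph n) N → (Fin N → Fin n) → R
      totalDeviation G N e = ∑ (allFin N₂) (λ ℓ → Deviation.deviation G r N e (Fin.toℕ ℓ ℕ.* r))

      deviation≥0 : ∀ {n N} (G : Graph n) (e : Fin N → Fin n) q → N ≡ s → 0# ≤ Deviation.deviation G r N e q
      deviation≥0 G e q refl = ≤-trans (Dist.const≤ (vec (uniformFin s′) q) (λ w →
          ≤-trans (≤-reflexive (sym (Linear.zero-on (∑-linear (allFin (patterns q r)))))) (∑-mono (allFin (patterns q r)) (λ π → sq-nonneg _))))
        (≤-reflexive (sym (Deviation.deviation-E G r e q)))

      -- Markov's inequality, pointwise. If the deviations total at most `ξ`, then `lower` prevents
      -- the sample from exceeding `g′ G` by more than `ε`, so a far sample makes the optimal `L`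
      -- change by at least `ε`. In either case one summand reaches 1.
      far≤ : ∀ {n ε} (G : Graph (suc n)) → s ℕ.≤ suc n → 0# < ε → fromℕ 13 * a ≤ ε → ∀ L → HasShadow m L G → g L ≡ g′ G → ∀ X → size X ≡ s →
        indicator (farOff ℝ Graph inducedGraph g′ ε G X) ≤ ∣ g L - g (inducedDigraph X L) ∣ * ε ⁻¹ + totalDeviation G (size X) (emb X) * ξ ⁻¹
      far≤ {n} {ε} G s≤n ε>0 13a≤ε L sh gL X e = go (∣ g′ G - g′ (inducedGraph X G) ∣ ≤? ε) (D ≤? ξ)
        where
        D drop′ : R
        D = totalDeviation G (size X) (emb X)
        drop′ = ∣ g L - g (inducedDigraph X L) ∣
        each≥0 : ∀ ℓ → 0# ≤ Deviation.deviation G r (size X) (emb X) (Fin.toℕ {N₂} ℓ ℕ.* r)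
        each≥0 ℓ = deviation≥0 G (emb X) (Fin.toℕ {N₂} ℓ ℕ.* r) e
        total≥0 : 0# ≤ totalDeviation G (size X) (emb X)
        total≥0 = ≤-trans (≤-reflexive (sym (Linear.zero-on (∑-linear (allFin N₂))))) (∑-mono (allFin N₂) each≥0)
        dev : D ≤ ξ → ∀ ℓ → ℓ ℕ.< N₂ → Deviation.deviation G r (size X) (emb X) (ℓ ℕ.* r) ≤ ξ
        dev few ℓ ℓ<N₂ = ≤-trans (subst (λ i → Deviation.deviation G r (size X) (emb X) (i ℕ.* r) ≤ totalDeviation G (size X) (emb X))
          (Fin.toℕ-fromℕ< ℓ<N₂) (≤∑ _ each≥0 (Fin.fromℕ< ℓ<N₂))) few
        upper : D ≤ ξ → g′ (inducedGraph X G) ≤ g′ G + ε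
        upper few = ≤-trans (lower G (inducedGraph X G) (emb X) e s≤n (λ i j → refl) (dev few)) (+-mono ≤-refl 13a≤ε)
        large : ¬ (∣ g′ G - g′ (inducedGraph X G) ∣ ≤ ε) → D ≤ ξ → ε ≤ drop′
        large far few = ≮⇒≥ (λ small → far (∣-∣≤ (≤-trans (≤-reflexive (sym gL)) (≤-trans (diff≤ (proj₁ small))
          (+-mono (proj₂ (shadowMax (inducedGraph X G)) _ (induced-shadow G X L sh)) ≤-refl))) (upper few)))
        drop≥0 : 0# ≤ drop′ * ε ⁻¹
        drop≥0 = *-nonneg′ (∣x∣-nonneg _) (proj₁ (⁻¹-pos ε>0))
        dev≥0 : 0# ≤ D * ξ ⁻¹
        dev≥0 = *-nonneg′ total≥0 (proj₁ (⁻¹-pos ξ>0))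
        go : (d : Dec (∣ g′ G - g′ (inducedGraph X G) ∣ ≤ ε)) → Dec (D ≤ ξ) → indicator (not ⌊ d ⌋) ≤ drop′ * ε ⁻¹ + D * ξ ⁻¹
        go (yes _) _ = +-nonneg drop≥0 dev≥0
        go (no _) (no big) = ≤-by (+-nonneg drop≥0 (≤⇒0≤ (≤-div ξ>0 (≤-trans (≤-reflexive (*-identityˡ ξ)) (proj₁ (≰⇒< big))))))
          (solve 2 (λ x y → x :+ y := :1 :+ (x :+ (y :- :1))) refl (drop′ * ε ⁻¹) (D * ξ ⁻¹))
        go (no far) (yes few) = ≤-by (+-nonneg (≤⇒0≤ (≤-div ε>0 (≤-trans (≤-reflexive (*-identityˡ ε)) (large far few)))) dev≥0)
          (solve 2 (λ x y → x :+ y := :1 :+ ((x :- :1) :+ y)) refl (drop′ * ε ⁻¹) (D * ξ ⁻¹))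

      far-probability : ∀ {n ε} (G : Graph n) → s ℕ.≤ n → 0# < ε → fromℕ 13 * a ≤ ε → N₂ ℕ.* r ℕ.+ (r ℕ.+ r) ℕ.≤ s →
        prBad ℝ Graph inducedGraph g′ s ε G ≤ fromℕ 7 * a * ε ⁻¹ + budget N₂ r * fromℕ s ⁻¹ * ξ ⁻¹
      far-probability {suc n} {ε} G s≤n ε>0 13a≤ε deep = optimal (proj₁ (shadowMax G))
        where
        A = avgSub-linear (suc n) s
        total : avgSub (suc n) s (λ X → totalDeviation G (size X) (emb X)) ≤ budget N₂ r * fromℕ s ⁻¹
        total = ≤-trans (≤-reflexive (sym (∑-swap (allFin N₂) A _))) (≤-trans (∑-mono (allFin N₂) (λ ℓ →
            Deviation.deviation-average G r {s} {Fin.toℕ ℓ ℕ.* r} (ℕ.s≤s ℕ.z≤n)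
              (ℕ.≤-trans (ℕ.+-monoˡ-≤ (r ℕ.+ r) (ℕ.*-monoˡ-≤ r (ℕ.<⇒≤ (Fin.toℕ<n ℓ)))) deep) s≤n))
          (≤-reflexive (trans (Linear.ext (∑-linear (allFin N₂)) (λ ℓ → solve 4 (λ p t q i → p :* (t :* (q :* i)) := p :* (t :* q) :* i) refl
              (fromℕ (patterns (Fin.toℕ ℓ ℕ.* r) r)) (1# + 1#) (fromℕ ((Fin.toℕ ℓ ℕ.* r ℕ.+ (r ℕ.+ r)) ℕ.* (Fin.toℕ ℓ ℕ.* r ℕ.+ (r ℕ.+ r)))) (fromℕ s ⁻¹)))
            (Linear.scaleʳ (∑-linear (allFin N₂)) (fromℕ s ⁻¹) _))))
        optimal : (∃ λ (L : ColDigraph k (suc n)) → HasShadow m L G × g L ≡ g′ G) →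
          prBad ℝ Graph inducedGraph g′ s ε G ≤ fromℕ 7 * a * ε ⁻¹ + budget N₂ r * fromℕ s ⁻¹ * ξ ⁻¹
        optimal (L , sh , gL) = ≤-trans (≤-reflexive (prBad≡ Graph inducedGraph g′ s ε G)) (≤-trans (avgSub-mono s≤n (far≤ G s≤n ε>0 13a≤ε L sh gL))
            (≤-trans (≤-reflexive (trans (Linear.add A _ _) (cong₂ _+_ (Linear.scaleʳ A _ _) (Linear.scaleʳ A _ _))))
              (+-mono (*-monoʳ (proj₁ (⁻¹-pos ε>0)) (restriction L s≤n)) (*-monoʳ (proj₁ (⁻¹-pos ξ>0)) total))))

    eventually-works : EstimableDigraphParam ℝ g → ∀ {ε δ} → 0# < ε → 0# < δ → ¬ ¬ (∃ λ r → WorksFor ε δ r)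
    -- Two thirds of `δ` bound the probability; the last third keeps the inequality strict.
    eventually-works estimable {ε} {δ} ε>0 δ>0 none = start (part 2 δ>0)
      where
      module _ {h a : R} (h>0 : 0# < h) (hδ : fromℕ 3 * h ≡ δ) (a>0 : 0# < a) (a₁ : fromℕ 13 * a ≤ ε) (a₂ : fromℕ 7 * ε ⁻¹ * a ≤ h)
        {r : ℕ} (r≥1 : 1 ℕ.≤ r) (est : ∀ {n} (L : ColDigraph k n) → r ℕ.≤ n → prBad ℝ (ColDigraph k) inducedDigraph g r a L < a)
        (κ : Constants k r a) {S₁ S₂ : ℕ} (p₁ : fromℕ (r ℕ.* r) < fromℕ S₁ * a)
        (p₂ : budget (Constants.N₂ κ) r * Constants.ξ κ ⁻¹ < fromℕ S₂ * h) where
        open Constants κ using (N₂; ξ)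
        D s′ : ℕ
        D = N₂ ℕ.* r ℕ.+ (r ℕ.+ r)
        -- `S₁` makes collisions rare, `S₂` pushes the deviation term below `h`, and `D` makes room
        -- for all pivots and two test tuples.
        s′ = S₁ ℕ.+ (S₂ ℕ.+ D)
        s>0 : 0# < fromℕ (suc s′)
        s>0 = fromℕ-pos {suc s′} (ℕ.s≤s ℕ.z≤n)
        D≤s : D ℕ.≤ suc s′
        D≤s = ℕ.m≤n⇒m≤1+n (ℕ.≤-trans (ℕ.m≤n+m D S₂) (ℕ.m≤n+m (S₂ ℕ.+ D) S₁))
        r≤s : r ℕ.≤ suc s′
        r≤s = ℕ.≤-trans (ℕ.≤-trans (ℕ.m≤m+n r r) (ℕ.m≤n+m (r ℕ.+ r) (N₂ ℕ.* r))) D≤s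
        few : fromℕ (r ℕ.* r) ≤ a * fromℕ (suc s′)
        few = ≤-trans (proj₁ p₁) (≤-trans (*-monoʳ (proj₁ a>0) (fromℕ-mono (ℕ.m≤n⇒m≤1+n (ℕ.m≤m+n S₁ (S₂ ℕ.+ D))))) (≤-reflexive (*-comm _ a)))
        rest : budget N₂ r * fromℕ (suc s′) ⁻¹ * ξ ⁻¹ ≤ h
        rest = ≤-trans (≤-reflexive (solve 3 (λ b i x → b :* i :* x := b :* x :* i) refl (budget N₂ r) (fromℕ (suc s′) ⁻¹) (ξ ⁻¹)))
          (div-≤ s>0 (≤-trans (proj₁ p₂) (≤-trans (*-monoʳ (proj₁ h>0) (fromℕ-mono
            (ℕ.m≤n⇒m≤1+n (ℕ.≤-trans (ℕ.m≤m+n S₂ D) (ℕ.m≤n+m (S₂ ℕ.+ D) S₁))))) (≤-reflexive (*-comm _ h)))))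
        2h<δ : h + h < δ
        2h<δ = subst (h + h <_) (trans (solve 1 (λ h → h :+ h :+ h := (:1 :+ (:1 :+ (:1 :+ :0))) :* h) refl h) hδ)
          (subst (_< h + h + h) (+-identityˡ (h + h)) (subst (0# + (h + h) <_) (+-comm h (h + h)) (+-mono-<-≤ h>0 ≤-refl)))
        works : WorksFor ε δ (suc s′)
        works = ℕ.s≤s ℕ.z≤n , λ G s≤n → ≤-<-trans (≤-trans (Estimate.far-probability a>0 r≥1 est κ s′ r≤s few G s≤n ε>0 a₁ D≤s)
          (+-mono (≤-trans (≤-reflexive (solve 3 (λ s a e → s :* a :* e := s :* e :* a) refl (fromℕ 7) a (ε ⁻¹))) a₂) rest)) 2h<δ
      start : (∃ λ h → 0# < h × fromℕ 3 * h ≡ δ) → ⊥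
      start (h , h>0 , hδ) = scale (small₂ (fromℕ-nonneg 13) ε>0 (*-nonneg′ (fromℕ-nonneg 7) (proj₁ (⁻¹-pos ε>0))) h>0)
        where
        scale : (∃ λ a → 0# < a × fromℕ 13 * a ≤ ε × fromℕ 7 * ε ⁻¹ * a ≤ h) → ⊥
        scale (a , a>0 , a₁ , a₂) = sample (estimable a a a>0 a>0)
          where
          sample : (∃ λ r → 1 ℕ.≤ r × (∀ {n} (L : ColDigraph k n) → r ℕ.≤ n → prBad ℝ (ColDigraph k) inducedDigraph g r a L < a)) → ⊥
          sample (r , r≥1 , est) = constants-exist k r a>0 λ κ →
            many (fromℕ (r ℕ.* r)) a>0 λ (S₁ , p₁) →
            many (budget (Constants.N₂ κ) r * Constants.ξ κ ⁻¹) h>0 λ (S₂ , p₂) →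
            none (_ , works h>0 hδ a>0 a₁ a₂ r≥1 est κ {S₁} {S₂} p₁ p₂)

-- Extending a colouring of a vertex subset

∈-allSubsets : ∀ {n} (X : Subset n) → X ∈ allSubsets n
∈-allSubsets [] = here refl
∈-allSubsets (true ∷ X) = ∈-++⁺ˡ (∈-map⁺ (true ∷_) (∈-allSubsets X))
∈-allSubsets {suc n} (false ∷ X) = ∈-++⁺ʳ (List.map (true ∷_) (allSubsets n)) (∈-map⁺ (false ∷_) (∈-allSubsets X))

position : ∀ {n} (X : Subset n) → Fin n → Maybe (Fin (size X))
position (true ∷ X)  zero    = just zero
position (false ∷ X) zero    = nothing
position (true ∷ X)  (suc i) = Maybe.map suc (position X i)
position (false ∷ X) (suc i) = position X i

position-emb : ∀ {n} (X : Subset n) a → position X (emb X a) ≡ just a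
position-emb (true ∷ X) zero = refl
position-emb (true ∷ X) (suc a) = cong (Maybe.map suc) (position-emb X a)
position-emb (false ∷ X) a = position-emb X a

emb-position : ∀ {n} (X : Subset n) i {a} → position X i ≡ just a → emb X a ≡ i
emb-position (true ∷ X) zero refl = refl
emb-position (true ∷ X) (suc i) e with position X i in eq
emb-position (true ∷ X) (suc i) refl | just a = cong suc (emb-position X i eq)
emb-position (false ∷ X) (suc i) e = cong suc (emb-position X i e)

module _ {k n : ℕ} (X : Subset n) (J : ColDigraph k (size X)) (L : ColDigraph k n) where

  patch : Maybe (Fin (size X)) → Maybe (Fin (size X)) → Fin k → Fin k
  patch (just a) (just b) c = J a b
  patch (just a) nothing  c = c
  patch nothing  _        c = c

  extend : ColDigraph k n
  extend i j = patch (position X i) (position X j) (L i j)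

  extend-emb : inducedDigraph X extend ≈ J
  extend-emb a b _ rewrite position-emb X a | position-emb X b = refl

  -- A pair is recoloured only if both ends lie in `X`, where `J` has the same shadow as `L`. So
  -- every admissible colouring of the sample is the restriction of an admissible one of the graph.
  extend-shadow : ∀ {m G} → HasShadow m J (inducedGraph X G) → HasShadow m L G → HasShadow m extend G
  extend-shadow {m} {G} shJ shL i j = go (position X i) (position X j) refl refl
    where
    go : ∀ p q → position X i ≡ p → position X j ≡ q →
         (not ⌊ i Fin.≟ j ⌋ ∧ (isLow m (patch p q (L i j)) Bool.∨ isLow m (patch q p (L j i)))) ≡ adj G i j
    go nothing nothing _ _ = shL i j
    go nothing (just _) _ _ = shL i j
    go (just _) nothing _ _ = shL i j
    go (just a) (just b) ea eb with emb-position X i ea | emb-position X j eb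
    ... | refl | refl with emb X a Fin.≟ emb X b | a Fin.≟ b | shJ a b
    ...   | yes _ | yes _ | h = h
    ...   | no _ | no _ | h = h
    ...   | yes e | no n | _ = ⊥-elim (n (emb-injective X e))
    ...   | no n | yes refl | _ = ⊥-elim (n refl)

-- Extracting a sample size from its double negation

module Extraction (ℝ : RealField) where
  open Eventually ℝ public

  -- Suprema of arbitrary bounded families decide negated statements.
  weak-excluded-middle : (A : Set) → ¬ A ⊎ ¬ ¬ A
  weak-excluded-middle A = decide (complete (λ x → x ≡ 0# ⊎ x ≡ 1# × A) (0# , inj₁ refl)
      (1# , λ { _ (inj₁ refl) → 0≤1 ; _ (inj₂ (refl , _)) → ≤-refl }))
    where
    decide : (∃ λ s → (∀ x → x ≡ 0# ⊎ x ≡ 1# × A → x ≤ s) × (∀ b → (∀ x → x ≡ 0# ⊎ x ≡ 1# × A → x ≤ b) → s ≤ b)) → ¬ A ⊎ ¬ ¬ A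
    decide (s , upper , least) with s ≤? 0#
    ... | yes s≤0 = inj₁ (λ a → <⇒≱ 0<1 (≤-trans (upper 1# (inj₂ (refl , a))) s≤0))
    ... | no s≰0 = inj₂ (λ ¬a → s≰0 (least 0# (λ { _ (inj₁ refl) → ≤-refl ; _ (inj₂ (_ , a)) → ⊥-elim (¬a a) })))

  -- V r x says that r is a sample size good enough for precision x. The supremum s of the precisions x
  -- beyond the reach of all sample sizes r for which W fails up to r is positive, and a sample size for
  -- the precision s / 2 bounds a search for a solution of W.
  module _ (W : ℕ → Set) (V : ℕ → R → Set)
    (W-stable : ∀ r → ¬ ¬ W r → W r) (V-stable : ∀ r x → ¬ ¬ V r x → V r x)
    (V-mono : ∀ {r x y} → 0# < x → x ≤ y → V r x → V r y) (V-exists : ∀ x → 0# < x → ∃ λ r → V r x)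
    (degenerate : ∀ r → (∀ x → 0# < x → V r x) → W r) where

    private
      NoneUpTo : ℕ → Set
      NoneUpTo r = ∀ j → j ℕ.≤ r → ¬ W j

      Beyond : R → Set
      Beyond x = 0# < x × x ≤ 1# × (∀ r → NoneUpTo r → ¬ V r x)

      -- Induction on `N`. If `V N` fails at some precision `y`, the smaller of `x` and `y` defeats
      -- `N` as well; if it fails nowhere, `degenerate` makes `N` a solution, so `NoneUpTo N` cannot
      -- hold.
      beyond-below : ∀ N → ¬ ¬ (∃ λ x → 0# < x × x ≤ 1# × (∀ r → r ℕ.< N → NoneUpTo r → ¬ V r x))
      beyond-below zero none = none (1# , 0<1 , ≤-refl , λ r ())
      beyond-below (suc N) none = beyond-below N λ (x , x>0 , x≤1 , h) →
        let fallback : (∀ y → 0# < y → V N y) → ⊥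
            fallback all = none (x , x>0 , x≤1 , λ r r<1+N free v → case r r<1+N free v h (λ free′ → free′ N ℕ.≤-refl (degenerate N all)))
        in fallback (λ y y>0 → V-stable N y (λ ¬v → none (combine x>0 x≤1 h y>0 ¬v)))
        where
        case : ∀ {x} r → r ℕ.< suc N → NoneUpTo r → V r x → (∀ r → r ℕ.< N → NoneUpTo r → ¬ V r x) → ¬ NoneUpTo N → ⊥
        case r r<1+N free v h stop with ℕ.m≤n⇒m<n∨m≡n (ℕ.s≤s⁻¹ r<1+N)
        ... | inj₁ r<N = h r r<N free v
        ... | inj₂ refl = stop free
        combine : ∀ {x y} → 0# < x → x ≤ 1# → (∀ r → r ℕ.< N → NoneUpTo r → ¬ V r x) → 0# < y → ¬ V N y →
                  ∃ λ x → 0# < x × x ≤ 1# × (∀ r → r ℕ.< suc N → NoneUpTo r → ¬ V r x)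
        combine {x} {y} x>0 x≤1 h y>0 ¬v with ≤-total x y
        ... | inj₁ x≤y = x , x>0 , x≤1 , λ r r<1+N free v → both r r<1+N free v
          where
          both : ∀ r → r ℕ.< suc N → NoneUpTo r → ¬ V r x
          both r r<1+N free v with ℕ.m≤n⇒m<n∨m≡n (ℕ.s≤s⁻¹ r<1+N)
          ... | inj₁ r<N = h r r<N free v
          ... | inj₂ refl = ¬v (V-mono x>0 x≤y v)
        ... | inj₂ y≤x = y , y>0 , ≤-trans y≤x x≤1 , λ r r<1+N free v → both r r<1+N free v
          where
          both : ∀ r → r ℕ.< suc N → NoneUpTo r → ¬ V r y
          both r r<1+N free v with ℕ.m≤n⇒m<n∨m≡n (ℕ.s≤s⁻¹ r<1+N)
          ... | inj₁ r<N = h r r<N free (V-mono y>0 y≤x v)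
          ... | inj₂ refl = ¬v v

      -- `weak-excluded-middle` decides each candidate, and stability turns the failure to refute
      -- one into a solution.
      search : ∀ N → ¬ NoneUpTo N → ∃ W
      search N some with weak-excluded-middle (W N)
      ... | inj₂ w = N , W-stable N w
      search zero some | inj₁ ¬w = ⊥-elim (some (λ { zero _ → ¬w }))
      search (suc N) some | inj₁ ¬w = search N (λ free → some (λ j j≤ → step free j (ℕ.m≤n⇒m<n∨m≡n j≤)))
        where
        step : NoneUpTo N → ∀ j → j ℕ.< suc N ⊎ j ≡ suc N → ¬ W j
        step free j (inj₁ j<) = free j (ℕ.s≤s⁻¹ j<)
        step free j (inj₂ refl) = ¬w

    extract : ¬ ¬ ∃ W → ∃ W
    extract exists = conclude (complete (λ x → x ≡ 0# ⊎ Beyond x) (0# , inj₁ refl)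
        (1# , λ { _ (inj₁ refl) → 0≤1 ; _ (inj₂ (_ , x≤1 , _)) → x≤1 }))
      where
      conclude : (∃ λ s → (∀ x → x ≡ 0# ⊎ Beyond x → x ≤ s) × (∀ b → (∀ x → x ≡ 0# ⊎ Beyond x → x ≤ b) → s ≤ b)) → ∃ W
      conclude (s , upper , least) = halve (part 1 s>0)
        where
        -- Given a solution `N`, `NoneUpTo r` is impossible from `N` on, so the precision that
        -- `beyond-below N` supplies lies beyond every `r`. Strict inequality is stable, which
        -- absorbs the double negations.
        s>0 : 0# < s
        s>0 = <-stable (λ ¬s>0 → exists (λ (N , w) → beyond-below N (λ (x , x>0 , x≤1 , h) →
          ¬s>0 (<-≤-trans x>0 (upper x (inj₂ (x>0 , x≤1 , λ r free v → h r (ℕ.≰⇒> (λ N≤r → free N N≤r w)) free v)))))))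
        halve : (∃ λ t → 0# < t × fromℕ 2 * t ≡ s) → ∃ W
        halve (t , t>0 , 2t≡s) = found (V-exists t t>0)
          where
          found : (∃ λ r → V r t) → ∃ W
          -- Were there no solution up to `r`, no precision above `t` could lie beyond reach, since
          -- `r` would serve it by monotonicity. Then `s` would be at most `t`, its half.
          found (r , v) = search r (λ free → <⇒≱ t>0 (≤-by (≤⇒0≤ (≤-trans (≤-reflexive 2t≡s) (least t (λ
            { _ (inj₁ refl) → proj₁ t>0
            ; x (inj₂ (x>0 , _ , h)) → ≮⇒≥ (λ t<x → h r free (V-mono t>0 (proj₁ t<x) v)) }))))
            (solve 1 (λ t → :0 := t :+ (t :- (:1 :+ (:1 :+ :0)) :* t)) refl t)))

  prBad-≤ : ∀ {S : ℕ → Set} {restrict : ∀ {n} (X : Subset n) → S n → S (size X)} (f h : ∀ {n} → S n → R) {n r ε ε′} (A : S n) → r ℕ.≤ n →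
    (∀ X → ∣ h A - h (restrict X A) ∣ ≤ ε′ → ∣ f A - f (restrict X A) ∣ ≤ ε) →
    prBad ℝ S restrict f r ε A ≤ prBad ℝ S restrict h r ε′ A
  prBad-≤ {S} {restrict} f h {n} {r} {ε} {ε′} A r≤n imp = ≤-trans (≤-reflexive (prBad≡ S restrict f r ε A))
    (≤-trans (avgSub-mono r≤n {λ X → indicator (farOff ℝ S restrict f ε A X)} {λ X → indicator (farOff ℝ S restrict h ε′ A X)} (λ X _ → compare (imp X) (∣ f A - f (restrict X A) ∣ ≤? ε) (∣ h A - h (restrict X A) ∣ ≤? ε′)))
      (≤-reflexive (sym (prBad≡ S restrict h r ε′ A))))
    where
    compare : ∀ {P Q : Set} → (P → Q) → (q : Dec Q) (p : Dec P) → indicator (not ⌊ q ⌋) ≤ indicator (not ⌊ p ⌋)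
    compare i (yes _) p = indicator≥0 (not ⌊ p ⌋)
    compare i (no n) (yes p) = ⊥-elim (n (i p))
    compare i (no _) (no _) = ≤-refl

  estimable-affine : ∀ {S : ℕ → Set} {restrict : ∀ {n} (X : Subset n) → S n → S (size X)} (f h : ∀ {n} → S n → R) {v} → 0# < v →
    (∀ {m n} (A : S m) (B : S n) → f A - f B ≡ (h A - h B) * v) → IsEstimable ℝ S restrict h → IsEstimable ℝ S restrict f
  estimable-affine {S} {restrict} f h {v} v>0 scale est ε δ ε>0 δ>0 = use (est (ε * v ⁻¹) δ (*-pos ε>0 (⁻¹-pos v>0)) δ>0)
    where
    use : (∃ λ r → 1 ℕ.≤ r × (∀ {n} (A : S n) → r ℕ.≤ n → prBad ℝ S restrict h r (ε * v ⁻¹) A < δ)) →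
          ∃ λ r → 1 ℕ.≤ r × (∀ {n} (A : S n) → r ℕ.≤ n → prBad ℝ S restrict f r ε A < δ)
    use (r , r≥1 , good) = r , r≥1 , λ A r≤n → ≤-<-trans (prBad-≤ {S} {restrict} f h {r = r} {ε} {ε * v ⁻¹} A r≤n (λ X p → ≤-trans (≤-reflexive (cong ∣_∣ (scale A (restrict X A))))
        (scaled p))) (good A r≤n)
      where
      scaled : ∀ {x} → ∣ x ∣ ≤ ε * v ⁻¹ → ∣ x * v ∣ ≤ ε
      scaled {x} p = ∣x∣≤ (bound (x≤∣x∣ x)) (≤-trans (≤-reflexive (-‿distribˡ-* x v)) (bound (-x≤∣x∣ x)))
        where
        bound : ∀ {y} → y ≤ ∣ x ∣ → y * v ≤ ε
        bound q = ≤-trans (*-monoʳ (proj₁ v>0) (≤-trans q p)) (≤-reflexive (*⁻¹-cancelʳ′ ε v>0))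

  ∑-≥-term : ∀ {A : Set} (f : A → R) → (∀ a → 0# ≤ f a) → ∀ {xs a} → a ∈ xs → f a ≤ ∑ xs f
  ∑-≥-term f f≥0 {x ∷ xs} (here refl) = ≤-by (≤-trans (≤-reflexive (sym (Linear.zero-on (∑-linear xs)))) (∑-mono xs f≥0)) refl
  ∑-≥-term f f≥0 {x ∷ xs} (there p) = ≤-trans (∑-≥-term f f≥0 p) (≤-by (f≥0 x) (+-comm _ _))

  -- Sample sizes that serve every precision

  module Main {k m : ℕ} (m≥1 : 1 ℕ.≤ m) (m<k : m ℕ.< k) (g : DigraphParam ℝ k) (invariant : IsInvariantDigraphParam ℝ g)
    (g≥0 : ∀ {n} (L : ColDigraph k n) → 0# ≤ g L) (g≤1 : ∀ {n} (L : ColDigraph k n) → g L ≤ 1#)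
    (estimable : EstimableDigraphParam ℝ g)
    (g′ : GraphParam ℝ) (shadowMax : ∀ {n} (G : Graph n) → IsShadowMax ℝ m g G (g′ G)) where

    open Normalised m≥1 m<k g invariant g≥0 g≤1 g′ shadowMax

    Good : ℕ → R → Set
    Good r x = 1 ℕ.≤ r × (∀ {n} (L : ColDigraph k n) → r ℕ.≤ n → prBad ℝ (ColDigraph k) inducedDigraph g r x L < x)

    single-bad : ∀ {n r x} (L : ColDigraph k n) X → size X ≡ r → ¬ (∣ g L - g (inducedDigraph X L) ∣ ≤ x) →
      fromℕ (n choose r) ⁻¹ ≤ prBad ℝ (ColDigraph k) inducedDigraph g r x L
    single-bad {n} {r} {x} L X e far = ≤-trans (≤-trans (≤-reflexive (sym (*-identityˡ _))) (*-monoʳ (proj₁ (⁻¹-pos (choose>0 r≤n)))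
        (≤-trans (≤-reflexive (sym term)) (∑-≥-term _ (λ Y → *-nonneg′ (𝟙-nonneg (size Y ℕ.≟ r)) (indicator≥0 (bad Y))) (∈-allSubsets X)))))
        (≤-reflexive (sym (prBad≡ (ColDigraph k) inducedDigraph g r x L)))
      where
      r≤n : r ℕ.≤ n
      r≤n = ℕ.≤-trans (ℕ.≤-reflexive (sym e)) (size≤ X)
      bad : Subset n → Bool
      bad = farOff ℝ (ColDigraph k) inducedDigraph g x L
      isBad : (d : Dec (∣ g L - g (inducedDigraph X L) ∣ ≤ x)) → indicator (not ⌊ d ⌋) ≡ 1#
      isBad (yes p) = ⊥-elim (far p)
      isBad (no _) = refl
      term : 𝟙 (size X ℕ.≟ r) * indicator (bad X) ≡ 1#
      term = trans (cong₂ _*_ (𝟙-yes (size X ℕ.≟ r) e) (isBad (∣ g L - g (inducedDigraph X L) ∣ ≤? x))) (*-identityˡ 1#)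

    -- One subset with discrepancy d > 0 already has probability 1/C(n,r). A precision of at most
    -- d/2 and at most 1/C(n,r) then contradicts the estimate.
    constant : ∀ {r} → (∀ x → 0# < x → Good r x) → ∀ {n} (L : ColDigraph k n) X → size X ≡ r → g L ≡ g (inducedDigraph X L)
    constant {r} good {n} L X e = conclude (g L ≟ g (inducedDigraph X L))
      where
      d : R
      d = ∣ g L - g (inducedDigraph X L) ∣
      r≤n : r ℕ.≤ n
      r≤n = ℕ.≤-trans (ℕ.≤-reflexive (sym e)) (size≤ X)
      conclude : Dec (g L ≡ g (inducedDigraph X L)) → g L ≡ g (inducedDigraph X L)
      conclude (yes p) = p
      conclude (no ≢) = ⊥-elim (refute (small₂ {fromℕ 2} {d} {1#} (fromℕ-nonneg 2) d>0 0≤1 (⁻¹-pos (choose>0 r≤n))))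
        where
        d>0 : 0# < d
        d>0 = ≰⇒< (λ d≤0 → ≢ (≤-antisym (≤-trans (diff≤ d≤0) (≤-reflexive (+-identityʳ _))) (≤-trans (diff≤′ d≤0) (≤-reflexive (+-identityʳ _)))))
        refute : (∃ λ x → 0# < x × fromℕ 2 * x ≤ d × 1# * x ≤ fromℕ (n choose r) ⁻¹) → ⊥
        refute (x , x>0 , 2x≤d , x≤) = <⇒≱ (proj₂ (good x x>0) L r≤n) (≤-trans (≤-trans (≤-reflexive (sym (*-identityˡ x))) x≤)
          (single-bad L X e (λ d≤x → <⇒≱ x>0 (≤-by (≤⇒0≤ (≤-trans 2x≤d d≤x)) (solve 1 (λ x → :0 := x :+ (x :- (:1 :+ (:1 :+ :0)) :* x)) refl x)))))

    -- By `constant` restriction to r-sets preserves `g`, hence also the maxima: an optimal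
    -- colouring of the graph restricts and an optimal one of the sample extends, both with
    -- unchanged value.
    works-if-constant : ∀ {ε δ} → 0# < ε → 0# < δ → ∀ r → (∀ x → 0# < x → Good r x) → WorksFor ε δ r
    works-if-constant {ε} {δ} ε>0 δ>0 r good = proj₁ (good 1# 0<1) , λ A r≤n → ≤-<-trans
        (≤-trans (≤-reflexive (prBad≡ Graph inducedGraph g′ r ε A)) (≤-trans (avgSub-mono r≤n (λ X e → never (∣ g′ A - g′ (inducedGraph X A) ∣ ≤? ε) (same A X e)))
          (≤-reflexive (avgSub-const r≤n 0#)))) δ>0
      where
      never : ∀ {x y} (d : Dec (∣ x - y ∣ ≤ ε)) → x ≡ y → indicator (not ⌊ d ⌋) ≤ 0#
      never (yes _) _ = ≤-refl
      never (no n) e = ⊥-elim (n (≤-trans (≡⇒∣-∣≤0 e) (proj₁ ε>0)))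
      same : ∀ {n} (G : Graph n) X → size X ≡ r → g′ G ≡ g′ (inducedGraph X G)
      same G X e = between (proj₁ (shadowMax G)) (proj₁ (shadowMax (inducedGraph X G)))
        where
        between : (∃ λ L → HasShadow m L G × g L ≡ g′ G) → (∃ λ J → HasShadow m J (inducedGraph X G) × g J ≡ g′ (inducedGraph X G)) → g′ G ≡ g′ (inducedGraph X G)
        between (L , sh , gL) (J , shJ , gJ) = ≤-antisym
          (≤-trans (≤-reflexive (trans (sym gL) (constant good L X e))) (proj₂ (shadowMax (inducedGraph X G)) (inducedDigraph X L) (induced-shadow G X L sh)))
          (≤-trans (≤-reflexive (trans (sym gJ) (trans (sym (g-cong (extend-emb X J L))) (sym (constant good (extend X J L) X e)))))
            (proj₂ (shadowMax G) (extend X J L) (extend-shadow X J L {m} {G} shJ sh)))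

    shadowMax-estimable : EstimableGraphParam ℝ g′
    shadowMax-estimable ε δ ε>0 δ>0 = extract (WorksFor ε δ) Good
      (λ r ¬¬w → decidable-stable (1 ℕ.≤? r) (λ n → ¬¬w (λ w → n (proj₁ w))) ,
        λ A r≤n → <-stable (λ n → ¬¬w (λ w → n (proj₂ w A r≤n))))
      (λ r x ¬¬v → decidable-stable (1 ℕ.≤? r) (λ n → ¬¬v (λ v → n (proj₁ v))) ,
        λ L r≤n → <-stable (λ n → ¬¬v (λ v → n (proj₂ v L r≤n))))
      (λ {r} {x} {y} x>0 x≤y (r≥1 , v) → r≥1 , λ L r≤n → <-≤-trans (≤-<-trans (prBad-≤ {ColDigraph k} {inducedDigraph} g g {r = r} {y} {x} L r≤n (λ X p → ≤-trans p x≤y)) (v L r≤n)) x≤y)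
      (λ x x>0 → estimable x x x>0 x>0)
      (works-if-constant ε>0 δ>0)
      (eventually-works estimable ε>0 δ>0)

theorem5p1 : (ℝ : RealField) (k m : ℕ) → 1 ℕ.≤ m → m ℕ.< k →
    (g : DigraphParam ℝ k) →
    IsInvariantDigraphParam ℝ g → BoundedDigraphParam ℝ g → EstimableDigraphParam ℝ g →
    (g′ : GraphParam ℝ) → (∀ {n} (G : Graph n) → IsShadowMax ℝ m g G (g′ G)) →
    EstimableGraphParam ℝ g′
theorem5p1 ℝ k m m≥1 m<k g invariant (M , bounded) estimable g′ shadowMax =
  estimable-affine g′ g₁′ W>0 (λ A B → unscale (g′ A) (g′ B)) (Main.shadowMax-estimable m≥1 m<k g₁
    (λ π L₁ L₂ h → cong (λ x → (x + M) * W ⁻¹) (invariant π L₁ L₂ h))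
    (λ L → *-nonneg′ (≤-trans (≤⇒0≤ (≤-trans (-x≤∣x∣ (g L)) (bounded L))) (≤-reflexive (solve 2 (λ x M → M :- (:- x) := x :+ M) refl (g L) M))) (proj₁ (⁻¹-pos W>0)))
    (λ L → div-≤ W>0 (≤-trans (+-mono (≤-trans (x≤∣x∣ (g L)) (bounded L)) ≤-refl) (≤-by 0≤1 (solve 1 (λ M → :1 :* (M :+ M :+ :1) := M :+ M :+ :1) refl M))))
    (estimable-affine g₁ g (⁻¹-pos W>0) (λ A B → solve 4 (λ x y M w → (x :+ M) :* w :- (y :+ M) :* w := (x :- y) :* w) refl (g A) (g B) M (W ⁻¹)) estimable)
    g₁′ normalisedMax)
  where
  open Extraction ℝ
  W : R
  -- Shifting by `M` and dividing by 2M + 1 maps the range into [0, 1]; the added 1 keeps the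
  -- divisor positive when M = 0.
  W = M + M + 1#
  M≥0 : 0# ≤ M
  M≥0 = ≤-trans (∣x∣-nonneg _) (bounded {0} (λ ()))
  W>0 : 0# < W
  W>0 = subst (0# <_) (+-comm 1# (M + M)) (+-pos 0<1 (+-nonneg M≥0 M≥0))
  g₁ : DigraphParam ℝ k
  g₁ L = (g L + M) * W ⁻¹
  g₁′ : GraphParam ℝ
  g₁′ G = (g′ G + M) * W ⁻¹
  unscale : ∀ x y → x - y ≡ ((x + M) * W ⁻¹ - (y + M) * W ⁻¹) * W
  unscale x y = sym (trans (solve 5 (λ x y M i W → ((x :+ M) :* i :- (y :+ M) :* i) :* W := (x :- y) :* i :* W) refl x y M (W ⁻¹) W) (*⁻¹-cancelʳ′ (x - y) W>0))
  normalisedMax : ∀ {n} (G : Graph n) → IsShadowMax ℝ m g₁ G (g₁′ G)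
  normalisedMax G = (let (L , sh , e) , _ = shadowMax G in L , sh , cong (λ x → (x + M) * W ⁻¹) e) ,
    λ L sh → *-monoʳ (proj₁ (⁻¹-pos W>0)) (+-mono (proj₂ (shadowMax G) L sh) ≤-refl)
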